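{- Every 2-connected claw-free and $N$-$pq$-heavy graph is hamiltonian.
   Context: All graphs are finite and simple. For a graph $G$ on $n$ vertices, $d(v)$ is the degree of $v$ in $G$; $v$ is heavy if $d(v)\ge n/2$; an adjacent pair $\{u,v\}$ is $a$-heavy if $d(u)+d(v)\ge n$. The net has vertices $a_1,a_2,a_3,b_1,b_2,b_3$ and edges $a_1a_2,a_2a_3,a_1a_3,a_1b_1,a_2b_2,a_3b_3$. An induced net of $G$ (labelled this way) is $p$-heavy if $\{a_1,a_2,a_3\}$ contains an $a$-heavy pair of $G$; it is $q$-heavy if there is $i\in\{1,2,3\}$ such that (i) $a_i,b_i$ are heavy in $G$; (ii) $d(a_j)=3$ and $d(b_j)=2$ for both $j\ne i$; (iii) for both $j\ne i$, the neighbor of $b_j$ other than $a_j$ is heavy in $G$. $G$ is $N$-$pq$-heavy if every induced net of $G$ is $p$-heavy or $q$-heavy. -}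

module Defs where

open import Data.Nat using (ℕ; zero; suc; _+_; _*_; _≤_; _<?_)
open import Data.Bool using (Bool; true; false; if_then_else_)
open import Data.Fin using (Fin; zero; suc; toℕ; fromℕ<; _↑ˡ_; _↑ʳ_)
open import Data.List using (allFin; map)
open import Data.Nat.ListAction using (sum)
open import Data.Product using (Σ; _×_; Σ-syntax)
open import Data.Unit using (⊤)
open import Relation.Binary.PropositionalEquality using (_≡_; _≢_)
open import Relation.Nullary using (yes; no; ¬_)
open import Function.Definitions using (Injective)

record Graph (n : ℕ) : Set where
  field
    adj    : Fin n → Fin n → Bool
    sym    : ∀ u v → adj u v ≡ adj v u
    irrefl : ∀ v → adj v v ≡ false
open Graph public

Adj : ∀ {n} → Graph n → Fin n → Fin n → Set
Adj G u v = adj G u v ≡ true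

deg : ∀ {n} → Graph n → Fin n → ℕ
deg {n} G v = sum (map (λ w → if adj G v w then 1 else 0) (allFin n))

Heavy : ∀ {n} → Graph n → Fin n → Set
Heavy {n} G v = n ≤ 2 * deg G v

AHeavyPair : ∀ {n} → Graph n → Fin n → Fin n → Set
AHeavyPair {n} G u v = Adj G u v × (n ≤ deg G u + deg G v)

record InducedCopy {n : ℕ} (k : ℕ) (H : Fin k → Fin k → Bool) (G : Graph n) : Set where
  field
    emb     : Fin k → Fin n
    emb-inj : Injective _≡_ _≡_ emb
    emb-adj : ∀ x y → adj G (emb x) (emb y) ≡ H x y
open InducedCopy public

clawℕ : ℕ → ℕ → Bool
clawℕ zero (suc _) = true
clawℕ (suc _) zero = true
clawℕ _ _ = false

clawAdj : Fin 4 → Fin 4 → Bool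
clawAdj x y = clawℕ (toℕ x) (toℕ y)

ClawFree : ∀ {n} → Graph n → Set
ClawFree G = ¬ InducedCopy 4 clawAdj G

-- net: indices 0,1,2 = a₁,a₂,a₃ ; 3,4,5 = b₁,b₂,b₃
netℕ : ℕ → ℕ → Bool
netℕ 0 1 = true
netℕ 1 0 = true
netℕ 1 2 = true
netℕ 2 1 = true
netℕ 0 2 = true
netℕ 2 0 = true
netℕ 0 3 = true
netℕ 3 0 = true
netℕ 1 4 = true
netℕ 4 1 = true
netℕ 2 5 = true
netℕ 5 2 = true
netℕ _ _ = false

netAdj : Fin 6 → Fin 6 → Bool
netAdj x y = netℕ (toℕ x) (toℕ y)

InducedNet : ∀ {n} → Graph n → Set
InducedNet G = InducedCopy 6 netAdj G

module _ {n : ℕ} {G : Graph n} (N : InducedNet G) where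
  netA : Fin 3 → Fin n
  netA i = emb N (i ↑ˡ 3)

  netB : Fin 3 → Fin n
  netB i = emb N (3 ↑ʳ i)

PHeavy : ∀ {n} (G : Graph n) → InducedNet G → Set
PHeavy G N = Σ[ i ∈ Fin 3 ] Σ[ j ∈ Fin 3 ] (i ≢ j × AHeavyPair G (netA N i) (netA N j))

QHeavy : ∀ {n} (G : Graph n) → InducedNet G → Set
QHeavy {n} G N = Σ[ i ∈ Fin 3 ]
  ( Heavy G (netA N i) × Heavy G (netB N i)
  × (∀ j → j ≢ i → deg G (netA N j) ≡ 3 × deg G (netB N j) ≡ 2)
  × (∀ j → j ≢ i → ∀ (w : Fin n) → Adj G (netB N j) w → w ≢ netA N j → Heavy G w))

NpqHeavy : ∀ {n} → Graph n → Set
NpqHeavy G = ∀ (N : InducedNet G) → PHeavy G N Data.Sum.⊎ QHeavy G N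
  where import Data.Sum

data Reach {n : ℕ} (G : Graph n) (ok : Fin n → Set) : Fin n → Fin n → Set where
  here : ∀ {u} → ok u → Reach G ok u u
  step : ∀ {u w v} → ok u → Adj G u w → Reach G ok w v → Reach G ok u v

Connected : ∀ {n} → Graph n → Set
Connected G = ∀ u v → Reach G (λ _ → ⊤) u v

ConnectedWithout : ∀ {n} → Graph n → Fin n → Set
ConnectedWithout G x = ∀ u v → u ≢ x → v ≢ x → Reach G (λ w → w ≢ x) u v

TwoConnected : ∀ {n} → Graph n → Set
TwoConnected {n} G = (3 ≤ n) × Connected G × (∀ x → ConnectedWithout G x)

cnext : ∀ {n} → Fin n → Fin n
cnext {suc m} i with suc (toℕ i) <? suc m
... | yes p = fromℕ< p
... | no _  = zero

Hamiltonian : ∀ {n} → Graph n → Set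
Hamiltonian {n} G = (3 ≤ n) × Σ[ c ∈ (Fin n → Fin n) ]
  (Injective _≡_ _≡_ c × (∀ i → Adj G (c i) (c (cnext i))))

{-# OPTIONS --safe #-}
module Submission where

open import Defs
open import Data.Nat using (ℕ)
open import Data.Nat using (zero; suc; pred; _+_; _∸_; _≤_; _<_; _<?_; z≤n; s≤s)
open import Data.Nat.Properties using (≤-refl; ≤-trans; ≤-reflexive; ≤-antisym; ≤-total; <-irrefl; n≤1+n; m≤m+n; m≤n⇒m<n∨m≡n; ≮⇒≥; suc-injective; +-comm; +-identityʳ; +-mono-≤; +-monoˡ-≤; +-monoʳ-≤; *-monoʳ-≤; ∸-monoʳ-<; module ≤-Reasoning)
open import Data.Nat.Induction using (<-wellFounded)
open import Data.Nat.ListAction using (sum)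
open import Data.Nat.ListAction.Properties using (sum-++; sum-↭)
open import Data.Nat.Tactic.RingSolver using (solve-∀)
open import Data.Bool using (Bool; true; false; if_then_else_; _∨_; _∧_; not)
import Data.Bool.Properties as Bool
open import Data.Fin using (Fin; zero; suc; toℕ; cast; _≟_)
open import Data.Fin.Patterns using (0F; 1F; 2F; 3F; 4F; 5F)
open import Data.Fin.Properties using (all?; toℕ-fromℕ<; toℕ-cast; toℕ<n; toℕ-injective) renaming (any? to anyFin?)
open import Data.List using (List; []; _∷_; _++_; map; concat; filter; cartesianProduct; lookup; length; allFin; reverse)
open import Data.List.Properties using (length-++; length-tabulate; length-filter; map-++; unfold-reverse; ++-identityʳ)
open import Data.List.Membership.Propositional using (_∈_; _∉_)
open import Data.List.Membership.Propositional.Properties using (∈-allFin; ∈-++⁻; ∈-++⁺ˡ; ∈-++⁺ʳ; ∈-∃++; ∈-cartesianProduct⁺; ∈-lookup)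
open import Data.List.Relation.Unary.Any using (here; there; any?)
open import Data.List.Relation.Unary.All using (All; []; _∷_)
open import Data.List.Relation.Unary.All.Properties using (All¬⇒¬Any; ¬Any⇒All¬)
open import Data.List.Relation.Unary.AllPairs using ([]; _∷_)
open import Data.List.Relation.Unary.Unique.Propositional using (Unique)
open import Data.List.Relation.Unary.Unique.Propositional.Properties using (allFin⁺) renaming (++⁺ to Unique-++⁺)
open import Data.List.Relation.Binary.Permutation.Propositional using (_↭_; ↭-refl; ↭-sym; ↭-trans; ↭-reflexive; prep; ↭⇒↭ₛ)
open import Data.List.Relation.Binary.Permutation.Propositional.Properties using (∈-resp-↭; shift; ↭-length; ++⁺; ++⁺ˡ; ++⁺ʳ; ++-comm; map⁺; ↭-reverse; ++-commutativeMonoid)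
import Data.List.Relation.Binary.Permutation.Setoid.Properties as ↭ₛ
open import Data.Product using (Σ; ∃-syntax; Σ-syntax; _×_; _,_; proj₁; proj₂)
open import Data.Sum using (_⊎_; inj₁; inj₂; [_,_]′) renaming (map to ⊎-map)
open import Data.Empty using (⊥; ⊥-elim)
open import Function using (_∘_)
open import Induction.WellFounded using (Acc; acc)
open import Relation.Binary.PropositionalEquality using (_≡_; _≢_; refl; trans; cong; cong₂; subst; subst₂; setoid) renaming (sym to ≡-sym)
open import Relation.Nullary using (¬_; Dec; yes; no; does; contradiction; ¬?)
open import Relation.Nullary.Decidable using (_⊎-dec_; _×-dec_; _→-dec_; dec-true; dec-false; from-yes; decidable-stable)

-- Completing the neighbourhoods of eligible vertices one at a time (Ryjáček's closure) turns G into
-- a claw-free and diamond-free graph F on the same vertices, in which every edge lies in a unique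
-- maximal clique, and a Hamilton cycle of F can be pulled back to G.  If a cycle of F cannot be
-- extended by a vertex outside it, claw-freeness at the two attachments of an ear produces a theta:
-- two triangles a₁a₂a₃ and b₁b₂b₃ joined by disjoint paths from aᵢ to bᵢ that cover the cycle and
-- more.  A path that uses all of a theta may absorb every clique it visits, so it suffices to find a
-- cycle through everything that the theta visits.  An unimprovable theta has a net of F at each
-- triangle, and connectedness of G inside the cliques of F turns it into a net of G on the same
-- clique.  A q-heavy net lets one shorten the theta.  If both nets are p-heavy, some aᵢ and bⱼ with
-- i ≠ j have degree sum at least n, and since aᵢ and bⱼ are the ends of a path through the whole
-- theta, Ore's exchange argument closes it to a cycle.

-- In `F` an edge determines its maximal clique, so what matters about a path is which cliques it
-- visits, not which vertices it uses; thetas are therefore made smaller rather than larger. Size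
-- alone does not measure progress: when two candidates for pendant vertices are adjacent, rerouting
-- the theta through them can keep the number of vertices, and what grows is the set of pairs lying
-- in a common visited clique. The other obstacle is that the hypothesis concerns nets and degrees
-- of `G`, while completion changes both. The net found in `G` need not use the triangle of the
-- theta; a vertex that replaces some aᵢ has its whole `G`-neighbourhood trapped in the clique by
-- claw-freeness, so its degree in `G` is at most that of aᵢ in `F`, and large degree sums pass to
-- the theta. For a q-heavy net it is shown instead that no completion touches its pendant paths.
-- The condition i ≠ j comes from the paths through a whole theta, which run from aᵢ to bⱼ with i ≠
-- j. Given a pair with large sum at either triangle, a crosswise comparison of degrees always
-- yields such indices.

module _ {A : Set} where

  unique-↭ : {L M : List A} → L ↭ M → Unique L → Unique M
  unique-↭ p = ↭ₛ.Unique-resp-↭ (setoid A) (↭⇒↭ₛ p)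

  unique-++ʳ : (L : List A) {M : List A} → Unique (L ++ M) → Unique M
  unique-++ʳ []      u       = u
  unique-++ʳ (_ ∷ L) (_ ∷ u) = unique-++ʳ L u

  unique-++ˡ : (L : List A) {M : List A} → Unique (L ++ M) → Unique L
  unique-++ˡ L {M} u = unique-++ʳ M (unique-↭ (++-comm L M) u)

  unique-∷ : {x : A} {L : List A} → x ∉ L → Unique L → Unique (x ∷ L)
  unique-∷ x∉ u = ¬Any⇒All¬ _ x∉ ∷ u

  head∉ : {x : A} {L : List A} → Unique (x ∷ L) → x ∉ L
  head∉ (a ∷ _) = All¬⇒¬Any a

  head≢ : {x y : A} {L : List A} → Unique (x ∷ L) → y ∈ L → x ≢ y
  head≢ u y∈ refl = head∉ u y∈

  disjoint : (L : List A) {M : List A} {x y : A} → Unique (L ++ M) → x ∈ L → y ∈ M → x ≢ y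
  disjoint (x ∷ L) u       (here refl) y∈ = head≢ u (∈-++⁺ʳ L y∈)
  disjoint (_ ∷ L) (_ ∷ u) (there x∈)  y∈ = disjoint L u x∈ y∈

  ∈⇒↭ : {x : A} {L : List A} → x ∈ L → ∃[ M ] L ↭ x ∷ M
  ∈⇒↭ {x} x∈ with ∈-∃++ x∈
  ... | L , M , refl = L ++ M , shift x L M

  module ↭-Solver where
    open import Algebra.Solver.CommutativeMonoid (++-commutativeMonoid {A = A}) public using (solve; _⊜_; _⊕_)

open ↭-Solver public

-- Sums over the vertex set, split along a list and its complement

Σᶠ : {n : ℕ} → (Fin n → ℕ) → ℕ
Σᶠ {n} f = sum (map f (allFin n))

module _ {n : ℕ} where

  complement : {L : List (Fin n)} → Unique L → ∃[ M ] allFin n ↭ L ++ M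
  complement []  = allFin n , ↭-refl
  complement {x ∷ L} u@(_ ∷ v) with complement v
  ... | M , p with ∈-++⁻ L (∈-resp-↭ p (∈-allFin x))
  ...   | inj₁ x∈ = contradiction x∈ (head∉ u)
  ...   | inj₂ x∈ with ∈⇒↭ x∈
  ...     | M′ , q = M′ , ↭-trans p (↭-trans (++⁺ˡ L q) (shift x L M′))

  length-complement : (L : List (Fin n)) {M : List (Fin n)} → allFin n ↭ L ++ M → length L + length M ≡ n
  length-complement L p = trans (≡-sym (length-++ L)) (trans (≡-sym (↭-length p)) (length-tabulate (λ x → x)))

  length≤n : {L : List (Fin n)} → Unique L → length L ≤ n
  length≤n {L} u with complement u
  ... | M , p = ≤-trans (m≤m+n _ (length M)) (≤-reflexive (length-complement L p))

  Σᶠ-split : (f : Fin n → ℕ) {L M : List (Fin n)} → allFin n ↭ L ++ M → Σᶠ f ≡ sum (map f L) + sum (map f M)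
  Σᶠ-split f {L} {M} p = trans (sum-↭ (map⁺ f p)) (trans (cong sum (map-++ f L M)) (sum-++ (map f L) (map f M)))

sum-mono : {A : Set} (f g : A → ℕ) (L : List A) → (∀ {v} → v ∈ L → f v ≤ g v) → sum (map f L) ≤ sum (map g L)
sum-mono f g []      h = z≤n
sum-mono f g (x ∷ L) h = +-mono-≤ (h (here refl)) (sum-mono f g L (λ v∈ → h (there v∈)))

sum-≤length : {A : Set} (f : A → ℕ) (L : List A) → (∀ {v} → v ∈ L → f v ≤ 1) → sum (map f L) ≤ length L
sum-≤length f []      h = z≤n
sum-≤length f (x ∷ L) h = +-mono-≤ (h (here refl)) (sum-≤length f L (λ v∈ → h (there v∈)))

sum-+ : {A : Set} (f g : A → ℕ) (L : List A) → sum (map (λ v → f v + g v) L) ≡ sum (map f L) + sum (map g L)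
sum-+ f g []      = refl
sum-+ f g (x ∷ L) rewrite sum-+ f g L = ℕ-swap (f x) (g x) _ _
  where
  open import Data.Nat.Solver using (module +-*-Solver)
  open +-*-Solver using (_:+_; _:=_) renaming (solve to solveℕ)
  ℕ-swap : ∀ a b c d → a + b + (c + d) ≡ a + c + (b + d)
  ℕ-swap = solveℕ 4 (λ a b c d → a :+ b :+ (c :+ d) := a :+ c :+ (b :+ d)) refl

-- Adjacency, claws, paths and cycles

module Basics {n : ℕ} (G : Graph n) where

  V : Set
  V = Fin n

  infix 4 _~_ _≃_ _~?_ _≃?_ _∈?_

  _~_ : V → V → Set
  _~_ = Adj G

  _≃_ : V → V → Set
  u ≃ v = u ≡ v ⊎ u ~ v

  _~?_ : (u v : V) → Dec (u ~ v)
  u ~? v = adj G u v Bool.≟ true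

  _≃?_ : (u v : V) → Dec (u ≃ v)
  u ≃? v = (u ≟ v) ⊎-dec (u ~? v)

  _∈?_ : (v : V) (L : List V) → Dec (v ∈ L)
  v ∈? L = any? (v ≟_) L

  ~-sym : {u v : V} → u ~ v → v ~ u
  ~-sym {u} {v} e = trans (sym G v u) e

  ≃-sym : {u v : V} → u ≃ v → v ≃ u
  ≃-sym (inj₁ e) = inj₁ (≡-sym e)
  ≃-sym (inj₂ e) = inj₂ (~-sym e)

  ~⇒≢ : {u v : V} → u ~ v → u ≢ v
  ~⇒≢ {u} e refl with trans (≡-sym (irrefl G u)) e
  ... | ()

  ≃⇒~ : {u v : V} → u ≢ v → u ≃ v → u ~ v
  ≃⇒~ u≢v (inj₁ e) = contradiction e u≢v
  ≃⇒~ _   (inj₂ e) = e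

  ¬~⇒false : {u v : V} → ¬ u ~ v → adj G u v ≡ false
  ¬~⇒false = Bool.¬-not

  -- With `≃` in place of adjacency, leaves that coincide are harmless and no distinctness has to be
  -- supplied at a use.
  NoClaw : Set
  NoClaw = ∀ {c x y z} → c ~ x → c ~ y → c ~ z → x ≃ y ⊎ y ≃ z ⊎ x ≃ z

  clawFree⇒noClaw : ClawFree G → NoClaw
  clawFree⇒noClaw cf {c} {x} {y} {z} cx cy cz with x ≃? y | y ≃? z | x ≃? z
  ... | yes e | _     | _     = inj₁ e
  ... | no _  | yes e | _     = inj₂ (inj₁ e)
  ... | no _  | no _  | yes e = inj₂ (inj₂ e)
  ... | no a  | no b  | no d  = contradiction claw cf
    where
    f : Fin 4 → V
    f 0F                   = c
    f 1F             = x
    f 2F       = y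
    f 3F = z
    no-edge : ∀ {u v} → ¬ u ≃ v → adj G u v ≡ false
    no-edge h = ¬~⇒false (h ∘ inj₂)
    no-edge′ : ∀ {u v} → ¬ u ≃ v → adj G v u ≡ false
    no-edge′ h = ¬~⇒false (h ∘ ≃-sym ∘ inj₂)
    inj : ∀ {i j} → f i ≡ f j → i ≡ j
    inj {0F} {0F} e = refl
    inj {0F} {1F} e = contradiction e (~⇒≢ cx)
    inj {0F} {2F} e = contradiction e (~⇒≢ cy)
    inj {0F} {3F} e = contradiction e (~⇒≢ cz)
    inj {1F} {0F} e = contradiction (≡-sym e) (~⇒≢ cx)
    inj {1F} {1F} e = refl
    inj {1F} {2F} e = contradiction (inj₁ e) a
    inj {1F} {3F} e = contradiction (inj₁ e) d
    inj {2F} {0F} e = contradiction (≡-sym e) (~⇒≢ cy)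
    inj {2F} {1F} e = contradiction (inj₁ (≡-sym e)) a
    inj {2F} {2F} e = refl
    inj {2F} {3F} e = contradiction (inj₁ e) b
    inj {3F} {0F} e = contradiction (≡-sym e) (~⇒≢ cz)
    inj {3F} {1F} e = contradiction (inj₁ (≡-sym e)) d
    inj {3F} {2F} e = contradiction (inj₁ (≡-sym e)) b
    inj {3F} {3F} e = refl
    ad : ∀ i j → adj G (f i) (f j) ≡ clawAdj i j
    ad 0F 0F = irrefl G c
    ad 0F 1F = cx
    ad 0F 2F = cy
    ad 0F 3F = cz
    ad 1F 0F = ~-sym cx
    ad 2F 0F = ~-sym cy
    ad 3F 0F = ~-sym cz
    ad 1F 1F = irrefl G x
    ad 1F 2F = no-edge a
    ad 1F 3F = no-edge d
    ad 2F 1F = no-edge′ a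
    ad 2F 2F = irrefl G y
    ad 2F 3F = no-edge b
    ad 3F 1F = no-edge′ d
    ad 3F 2F = no-edge′ b
    ad 3F 3F = irrefl G z
    claw : InducedCopy 4 clawAdj G
    claw = record { emb = f ; emb-inj = inj ; emb-adj = ad }

  data Path : V → List V → V → Set where
    one : ∀ {u} → Path u (u ∷ []) u
    _∷_ : ∀ {u w L v} → u ~ w → Path w L v → Path u (u ∷ L) v

  join : ∀ {u L v w M z} → Path u L v → v ~ w → Path w M z → Path u (L ++ M) z
  join one     e q = e ∷ q
  join (d ∷ p) e q = d ∷ join p e q

  rev : ∀ {u L v} → Path u L v → Path v (reverse L) u
  rev one = one
  rev (_∷_ {u} {L = L} e p) rewrite unfold-reverse u L = join (rev p) (~-sym e) one

  start∈ : ∀ {u L v} → Path u L v → u ∈ L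
  start∈ one     = here refl
  start∈ (_ ∷ _) = here refl

  end∈ : ∀ {u L v} → Path u L v → v ∈ L
  end∈ one     = here refl
  end∈ (_ ∷ p) = there (end∈ p)

  -- A `Path` has at least one vertex, so an empty side of a splitting point needs its own
  -- constructor.
  data Pre (u : V) : List V → V → Set where
    ε   : Pre u [] u
    seg : ∀ {α q p} → Path u α q → q ~ p → Pre u α p

  data Post (p : V) : List V → V → Set where
    ε   : Post p [] p
    seg : ∀ {q β v} → p ~ q → Path q β v → Post p β v

  data Split (p u v : V) : List V → Set where
    at : ∀ {α β} → Pre u α p → Post p β v → Split p u v (α ++ p ∷ β)

  split : ∀ {u L v p} → Path u L v → p ∈ L → Split p u v L
  split one     (here refl) = at ε ε
  split (e ∷ q) (here refl) = at ε (seg e q)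
  split (e ∷ q) (there p∈) with split q p∈
  ... | at ε           post = at (seg one e) post
  ... | at (seg q₁ e₁) post = at (seg (e ∷ q₁) e₁) post

  record Cycle : Set where
    constructor cycle
    field
      {vs}  : List V
      {s t} : V
      path  : Path s vs t
      close : t ~ s
      uniq  : Unique vs

  CycleThrough : (V → Set) → Set
  CycleThrough S = Σ[ C ∈ Cycle ] (∀ {v} → S v → v ∈ Cycle.vs C)

  Spanning : List V → Set
  Spanning L = ∀ v → v ∈ L

  HamCycle : Set
  HamCycle = Σ[ C ∈ Cycle ] Spanning (Cycle.vs C)

  rotate : (C : Cycle) {x : V} → x ∈ Cycle.vs C →
           Σ[ L ∈ List V ] Σ[ u ∈ V ] Σ[ v ∈ V ] (x ~ u × Path u L v × v ~ x × x ∷ L ↭ Cycle.vs C)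
  rotate (cycle p c u) {x} x∈ with split p x∈
  ... | at ε ε = contradiction refl (~⇒≢ c)
  ... | at ε (seg e q) = _ , _ , _ , e , q , c , ↭-refl
  ... | at {α} (seg q e) ε = _ , _ , _ , c , q , e , solve 2 (λ x a → x ⊕ a ⊜ a ⊕ x) ↭-refl (x ∷ []) α
  ... | at {α} {β} (seg q e) (seg e′ q′) =
    _ , _ , _ , e′ , join q′ c q , e , solve 3 (λ x a b → x ⊕ (b ⊕ a) ⊜ a ⊕ (x ⊕ b)) ↭-refl (x ∷ []) α β

-- Local completion

module _ {n : ℕ} (H : Graph n) (x : Fin n) where

  open Basics H

  private
    adj′ : V → V → Bool
    adj′ u v = adj H u v ∨ (adj H x u ∧ (adj H x v ∧ not (does (u ≟ v))))

    swap∧ : ∀ a b c → a ∧ (b ∧ c) ≡ b ∧ (a ∧ c)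
    swap∧ true  true  c = refl
    swap∧ true  false c = refl
    swap∧ false true  c = refl
    swap∧ false false c = refl

    does-sym : ∀ (u v : V) → does (u ≟ v) ≡ does (v ≟ u)
    does-sym u v with u ≟ v
    ... | yes e = ≡-sym (dec-true (v ≟ u) (≡-sym e))
    ... | no ¬e = ≡-sym (dec-false (v ≟ u) (¬e ∘ ≡-sym))

  complete : Graph n
  complete = record
    { adj    = adj′
    ; sym    = λ u v → cong₂ _∨_ (sym H u v)
                 (trans (swap∧ (adj H x u) (adj H x v) _) (cong (λ b → adj H x v ∧ (adj H x u ∧ not b)) (does-sym u v)))
    ; irrefl = irr
    }
    where
    irr : ∀ v → adj′ v v ≡ false
    irr v rewrite irrefl H v | dec-true (v ≟ v) refl | Bool.∧-zeroʳ (adj H x v) | Bool.∧-zeroʳ (adj H x v) = refl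

module Completion {n : ℕ} (H : Graph n) (x : Fin n) where

  open Basics H
  private module H′ = Basics (complete H x)

  old : ∀ {u v} → u ~ v → u H′.~ v
  old e rewrite e = refl

  new : ∀ {u v} → x ~ u → x ~ v → u ≢ v → u H′.~ v
  new {u} {v} xu xv u≢v rewrite xu | xv | dec-false (u ≟ v) u≢v = Bool.∨-zeroʳ (adj H u v)

  inv : ∀ {u v} → u H′.~ v → u ~ v ⊎ (x ~ u × x ~ v)
  inv {u} {v} e with adj H u v | adj H x u | adj H x v
  ... | true  | _    | _    = inj₁ refl
  ... | false | true | true = inj₂ (refl , refl)

  inv-x : ∀ {v} → x H′.~ v → x ~ v
  inv-x e = [ (λ d → d) , proj₂ ]′ (inv e)

  ≃-old : ∀ {u v} → u ≃ v → u H′.≃ v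
  ≃-old (inj₁ e) = inj₁ e
  ≃-old (inj₂ e) = inj₂ (old e)

  nbhd-clique : ∀ {u v} → x ≃ u → x ≃ v → u H′.≃ v
  nbhd-clique (inj₁ refl) xv          = ≃-old xv
  nbhd-clique (inj₂ xu)   (inj₁ refl) = inj₂ (old (~-sym xu))
  nbhd-clique {u} {v} (inj₂ xu) (inj₂ xv) = by (u ≟ v)
    where
    by : Dec (u ≡ v) → u H′.≃ v
    by (yes e) = inj₁ e
    by (no ¬e) = inj₂ (new xu xv ¬e)

  module _ (nc : NoClaw) where

    private
      -- Since `c` is itself a neighbour of `x`, the vertex `x` can replace `u` as a leaf of the old
      -- graph at `c`; anything that sees `x` sees `u` after completion.
      new-leaf : ∀ {c u v w} → x ~ c → x ~ u → c H′.~ v → c H′.~ w → u H′.≃ v ⊎ v H′.≃ w ⊎ u H′.≃ w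
      new-leaf {u = u} {v} {w} xc xu dv dw with x ≃? v | x ≃? w
      ... | yes xv | _      = inj₁ (nbhd-clique (inj₂ xu) xv)
      ... | no _   | yes xw = inj₂ (inj₂ (nbhd-clique (inj₂ xu) xw))
      ... | no ¬xv | no ¬xw with inv dv | inv dw
      ...   | inj₂ (_ , xv) | _             = contradiction (inj₂ xv) ¬xv
      ...   | inj₁ _        | inj₂ (_ , xw) = contradiction (inj₂ xw) ¬xw
      ...   | inj₁ cv       | inj₁ cw with nc (~-sym xc) cv cw
      ...     | inj₁ e        = contradiction e ¬xv
      ...     | inj₂ (inj₁ e) = inj₂ (inj₁ (≃-old e))
      ...     | inj₂ (inj₂ e) = contradiction e ¬xw

    noClaw-complete : H′.NoClaw
    noClaw-complete d₁ d₂ d₃ with inv d₁ | inv d₂ | inv d₃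
    ... | inj₂ (xc , x₁) | _ | _ = new-leaf xc x₁ d₂ d₃
    ... | inj₁ _ | inj₂ (xc , x₂) | _ with new-leaf xc x₂ d₁ d₃
    ...   | inj₁ e        = inj₁ (H′.≃-sym e)
    ...   | inj₂ (inj₁ e) = inj₂ (inj₂ e)
    ...   | inj₂ (inj₂ e) = inj₂ (inj₁ e)
    noClaw-complete d₁ d₂ d₃ | inj₁ _ | inj₁ _ | inj₂ (xc , x₃) with new-leaf xc x₃ d₁ d₂
    ... | inj₁ e        = inj₂ (inj₂ (H′.≃-sym e))
    ... | inj₂ (inj₁ e) = inj₁ e
    ... | inj₂ (inj₂ e) = inj₂ (inj₁ (H′.≃-sym e))
    noClaw-complete d₁ d₂ d₃ | inj₁ e₁ | inj₁ e₂ | inj₁ e₃ with nc e₁ e₂ e₃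
    ... | inj₁ e        = inj₁ (≃-old e)
    ... | inj₂ (inj₁ e) = inj₂ (inj₁ (≃-old e))
    ... | inj₂ (inj₂ e) = inj₂ (inj₂ (≃-old e))

-- In a claw-free graph this says that N(x) is connected but not complete: a vertex of N(x) is adjacent to u or z.
record Eligible {n : ℕ} (H : Graph n) (x : Fin n) : Set where
  open Basics H
  field
    {u w z} : V
    xu : x ~ u
    xw : x ~ w
    xz : x ~ z
    uw : u ~ w
    wz : w ~ z
    u≄z : ¬ u ≃ z

-- Pulling a Hamilton cycle back through one completion

module Uncomplete {n : ℕ} (H : Graph n) (x : Fin n) (nc : Basics.NoClaw H) (el : Eligible H x) where

  open Basics H
  open Eligible el

  Target : List V → Set
  Target M = Σ[ C ∈ Cycle ] (Cycle.vs C ↭ x ∷ M)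

  target : ∀ {M s L t} → Unique (x ∷ M) → x ~ s → Path s L t → x ~ t → L ↭ M → Target M
  target u xs p xt q = cycle (xs ∷ p) (~-sym xt) (unique-↭ (prep x (↭-sym q)) u) , prep x q

  target-↭ : ∀ {M N} → M ↭ N → Target M → Target N
  target-↭ p (C , q) = C , ↭-trans q (prep x p)

  private
    piece-≢ : ∀ α {p β M a b} → Unique (x ∷ (α ++ p ∷ β) ++ M) → a ∈ α → b ∈ β → a ≢ b
    piece-≢ α u a∈ b∈ = disjoint α (unique-++ˡ (α ++ _ ∷ _) (unique-++ʳ (x ∷ []) u)) a∈ (there b∈)

  -- The obstructed configuration: an edge between an end of `A` and an end of `B` would close a
  -- cycle through `x` at once. Claw-freeness at `x` then makes the two ends of each path equal or
  -- adjacent.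
  record State (e₁ e₂ f₁ f₂ : V) (A B : List V) : Set where
    field
      pA   : Path e₁ A e₂
      pB   : Path f₁ B f₂
      xe₁  : x ~ e₁
      xe₂  : x ~ e₂
      xf₁  : x ~ f₁
      xf₂  : x ~ f₂
      n₁₁  : ¬ e₁ ≃ f₁
      n₁₂  : ¬ e₁ ≃ f₂
      n₂₁  : ¬ e₂ ≃ f₁
      n₂₂  : ¬ e₂ ≃ f₂
      uniq : Unique (x ∷ A ++ B)

    e₁≃e₂ : e₁ ≃ e₂
    e₁≃e₂ with nc xe₁ xe₂ xf₁
    ... | inj₁ e        = e
    ... | inj₂ (inj₁ e) = contradiction e n₂₁
    ... | inj₂ (inj₂ e) = contradiction e n₁₁

  swapSt : ∀ {e₁ e₂ f₁ f₂ A B} → State e₁ e₂ f₁ f₂ A B → State f₁ f₂ e₁ e₂ B A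
  swapSt {A = A} {B} S = record
    { pA = pB ; pB = pA ; xe₁ = xf₁ ; xe₂ = xf₂ ; xf₁ = xe₁ ; xf₂ = xe₂
    ; n₁₁ = n₁₁ ∘ ≃-sym ; n₁₂ = n₂₁ ∘ ≃-sym ; n₂₁ = n₁₂ ∘ ≃-sym ; n₂₂ = n₂₂ ∘ ≃-sym
    ; uniq = unique-↭ (prep x (++-comm A B)) uniq }
    where open State S

  revSt : ∀ {e₁ e₂ f₁ f₂ A B} → State e₁ e₂ f₁ f₂ A B → State e₂ e₁ f₁ f₂ (reverse A) B
  revSt {A = A} {B} S = record
    { pA = rev pA ; pB = pB ; xe₁ = xe₂ ; xe₂ = xe₁ ; xf₁ = xf₁ ; xf₂ = xf₂
    ; n₁₁ = n₂₁ ; n₁₂ = n₂₂ ; n₂₁ = n₁₁ ; n₂₂ = n₁₂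
    ; uniq = unique-↭ (prep x (++⁺ʳ B (↭-sym (↭-reverse A)))) uniq }
    where open State S

  revStB : ∀ {e₁ e₂ f₁ f₂ A B} → State e₁ e₂ f₁ f₂ A B → State e₁ e₂ f₂ f₁ A (reverse B)
  revStB = swapSt ∘ revSt ∘ swapSt

  module _ {e₁ e₂ f₁ f₂ A B} (S : State e₁ e₂ f₁ f₂ A B) where
    open State S

    private
      x∉ : ∀ {v} → v ∈ A ++ B → v ≢ x
      x∉ v∈ refl = head∉ uniq v∈

    -- Claw-freeness at `p`, with its two neighbours on the path and `x`, gives three cases. In
    -- each, `p` is the passage to `f₁`, and the rest of `A` is held together by the chord past `p`
    -- or by the edge between its ends.
    both-ends : ∀ {p} → p ∈ A → x ~ p → p ~ f₁ → p ~ e₁ → Target (A ++ B)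
    both-ends {p} p∈ xp pf pe with split pA p∈
    ... | at ε _ = contradiction (inj₂ pf) n₁₁
    ... | at (seg _ _) ε = contradiction (inj₂ pf) n₂₁
    ... | at {α} {β} (seg {q = p⁻} qα d⁻) (seg {q = p⁺} d⁺ qβ)
        with nc (~-sym d⁻) d⁺ (~-sym xp)
    ...   | inj₁ (inj₁ refl) =
            contradiction refl (piece-≢ α uniq (end∈ qα) (start∈ qβ))
    ...   | inj₁ (inj₂ d) =
            target uniq xf₂ (join (rev pB) (~-sym pf) (pe ∷ join qα d qβ)) xe₂
              (↭-trans (++⁺ʳ (p ∷ α ++ β) (↭-reverse B)) (solve 4 (λ p a b c → c ⊕ (p ⊕ (a ⊕ b)) ⊜ (a ⊕ (p ⊕ b)) ⊕ c) ↭-refl (p ∷ []) α β B))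
    ...   | inj₂ (inj₁ (inj₁ refl)) = contradiction refl (x∉ (∈-++⁺ˡ (∈-++⁺ʳ α (there (start∈ qβ)))))
    ...   | inj₂ (inj₁ (inj₂ d)) =
            target uniq (~-sym d) (join qβ (~-sym (≃⇒~ (piece-≢ α uniq (start∈ qα) (end∈ qβ)) e₁≃e₂)) (join qα d⁻ (pf ∷ pB))) xf₂
              (solve 4 (λ p a b c → b ⊕ (a ⊕ (p ⊕ c)) ⊜ (a ⊕ (p ⊕ b)) ⊕ c) ↭-refl (p ∷ []) α β B)
    ...   | inj₂ (inj₂ (inj₁ refl)) = contradiction refl (x∉ (∈-++⁺ˡ (∈-++⁺ˡ (end∈ qα))))
    ...   | inj₂ (inj₂ (inj₂ d)) =
            target uniq (~-sym d) (join (rev qα) (≃⇒~ (piece-≢ α uniq (start∈ qα) (end∈ qβ)) e₁≃e₂) (join (rev qβ) (~-sym d⁺) (pf ∷ pB))) xf₂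
              (↭-trans (++⁺ (↭-reverse α) (++⁺ʳ (p ∷ B) (↭-reverse β)))
                (solve 4 (λ p a b c → a ⊕ (b ⊕ (p ⊕ c)) ⊜ (a ⊕ (p ⊕ b)) ⊕ c) ↭-refl (p ∷ []) α β B))

  private
    linked₁ : ∀ {e₁ e₂ f₁ f₂ A B p} → State e₁ e₂ f₁ f₂ A B → p ∈ A → x ~ p → p ~ f₁ → p ~ e₁ ⊎ p ~ e₂ → Target (A ++ B)
    linked₁ S p∈ xp pf (inj₁ pe) = both-ends S p∈ xp pf pe
    linked₁ {A = A} {B} S p∈ xp pf (inj₂ pe) =
      target-↭ (++⁺ʳ B (↭-reverse A)) (both-ends (revSt S) (∈-resp-↭ (↭-sym (↭-reverse A)) p∈) xp pf pe)

  linked : ∀ {e₁ e₂ f₁ f₂ A B p} → State e₁ e₂ f₁ f₂ A B → p ∈ A → x ~ p → p ~ f₁ ⊎ p ~ f₂ → p ~ e₁ ⊎ p ~ e₂ → Target (A ++ B)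
  linked S p∈ xp (inj₁ pf) pe = linked₁ S p∈ xp pf pe
  linked {A = A} {B} S p∈ xp (inj₂ pf) pe = target-↭ (++⁺ˡ A (↭-reverse B)) (linked₁ (revStB S) p∈ xp pf pe)

  -- If p sees both ends of A and q an end of B, rearrange so that p becomes an end of the A-side piece.
  module Bridge {e₁ e₂ f₁ f₂ A B} (S : State e₁ e₂ f₁ f₂ A B) {p q : Fin n}
    (xp : x ~ p) (pe₁ : p ~ e₁) (pe₂ : p ~ e₂) (p≄f₁ : ¬ p ≃ f₁) (p≄f₂ : ¬ p ≃ f₂)
    (xq : x ~ q) (qf₁ : q ~ f₁) (pq : p ~ q) (q∈ : q ∈ A ++ B) where

    open State S

    private
      -- Once `p` is an end, `q` is adjacent to an end of each path, so `both-ends` applies to `q`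
      -- whichever path contains it.
      finish : ∀ {e′ A′ B′} → State p e′ f₁ f₂ A′ B′ → A′ ++ B′ ↭ A ++ B → Target (A ++ B)
      finish {A′ = A′} {B′} S′ π with ∈-++⁻ A′ (∈-resp-↭ (↭-sym π) q∈)
      ... | inj₁ q∈A = target-↭ π (both-ends S′ q∈A xq qf₁ (~-sym pq))
      ... | inj₂ q∈B = target-↭ (↭-trans (++-comm B′ A′) π) (both-ends (swapSt S′) q∈B xq (~-sym pq) qf₁)

      restart : ∀ {e′ A′ B′} → Path p A′ e′ → Path f₁ B′ f₂ → x ~ e′ → ¬ e′ ≃ f₁ → ¬ e′ ≃ f₂ → A′ ++ B′ ↭ A ++ B → Target (A ++ B)
      restart pA′ pB′ xe′ m₁ m₂ π = finish (record
        { pA = pA′ ; pB = pB′ ; xe₁ = xp ; xe₂ = xe′ ; xf₁ = xf₁ ; xf₂ = xf₂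
        ; n₁₁ = p≄f₁ ; n₁₂ = p≄f₂ ; n₂₁ = m₁ ; n₂₂ = m₂ ; uniq = unique-↭ (prep x (↭-sym π)) uniq }) π

      -- The edge between `c₁` and `c₂` turns the path into a cycle, which is reopened at the edge
      -- from `p` to `p⁺`; now `p` is an end, and so is `p⁺`, a neighbour of `x`. If `p⁺` sees an
      -- end of `B`, a cycle through `x` closes immediately.
      turn : ∀ {c₁ c₂ α β p⁻ p⁺} → Path c₁ α p⁻ → p⁻ ~ p → p ~ p⁺ → Path p⁺ β c₂ → c₁ ~ c₂ → x ~ p⁺ →
             (α ++ p ∷ β) ++ B ↭ A ++ B → Target (A ++ B)
      turn {α = α} {β} {p⁺ = p⁺} qα d⁻ d⁺ qβ c d π with p⁺ ≃? f₁ | p⁺ ≃? f₂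
      ... | yes (inj₁ refl) | _ = contradiction (inj₂ d⁺) p≄f₁
      ... | yes (inj₂ pf) | _ =
        target uniq xp (~-sym d⁻ ∷ join (rev qα) c (join (rev qβ) pf pB)) xf₂
          (↭-trans (prep p (++⁺ (↭-reverse α) (++⁺ʳ B (↭-reverse β))))
            (↭-trans (solve 4 (λ p a b c → p ⊕ (a ⊕ (b ⊕ c)) ⊜ (a ⊕ (p ⊕ b)) ⊕ c) ↭-refl (p ∷ []) α β B) π))
      ... | no _ | yes (inj₁ refl) = contradiction (inj₂ d⁺) p≄f₂
      ... | no _ | yes (inj₂ pf) =
        target uniq xp (~-sym d⁻ ∷ join (rev qα) c (join (rev qβ) pf (rev pB))) xf₁
          (↭-trans (prep p (++⁺ (↭-reverse α) (++⁺ (↭-reverse β) (↭-reverse B))))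
            (↭-trans (solve 4 (λ p a b c → p ⊕ (a ⊕ (b ⊕ c)) ⊜ (a ⊕ (p ⊕ b)) ⊕ c) ↭-refl (p ∷ []) α β B) π))
      ... | no m₁ | no m₂ =
        restart (~-sym d⁻ ∷ join (rev qα) c (rev qβ)) pB d m₁ m₂
          (↭-trans (prep p (++⁺ʳ B (++⁺ (↭-reverse α) (↭-reverse β))))
            (↭-trans (solve 4 (λ p a b c → p ⊕ ((a ⊕ b) ⊕ c) ⊜ (a ⊕ (p ⊕ b)) ⊕ c) ↭-refl (p ∷ []) α β B) π))

      x∉ : ∀ {v} → v ∈ A ++ B → v ≢ x
      x∉ v∈ refl = head∉ uniq v∈

    bridge : p ∈ A ++ B → Target (A ++ B)
    bridge p∈ with ∈-++⁻ A p∈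
    bridge p∈ | inj₁ p∈A with split pA p∈A
    ... | at ε _ = contradiction refl (~⇒≢ pe₁)
    ... | at (seg _ _) ε = contradiction refl (~⇒≢ pe₂)
    ... | at {α} {β} (seg {q = p⁻} qα d⁻) (seg {q = p⁺} d⁺ qβ) with nc (~-sym d⁻) d⁺ (~-sym xp)
    ...   | inj₁ (inj₁ refl) =
            contradiction refl (piece-≢ α uniq (end∈ qα) (start∈ qβ))
    ...   | inj₁ (inj₂ d) =
            restart (pe₁ ∷ join qα d qβ) pB xe₂ n₂₁ n₂₂
              (solve 4 (λ p a b c → (p ⊕ (a ⊕ b)) ⊕ c ⊜ (a ⊕ (p ⊕ b)) ⊕ c) ↭-refl (p ∷ []) α β B)
    ...   | inj₂ (inj₁ (inj₁ refl)) = contradiction refl (x∉ (∈-++⁺ˡ (∈-++⁺ʳ α (there (start∈ qβ)))))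
    ...   | inj₂ (inj₁ (inj₂ d)) = turn qα d⁻ d⁺ qβ (≃⇒~ (piece-≢ α uniq (start∈ qα) (end∈ qβ)) e₁≃e₂) (~-sym d) ↭-refl
    ...   | inj₂ (inj₂ (inj₁ refl)) = contradiction refl (x∉ (∈-++⁺ˡ (∈-++⁺ˡ (end∈ qα))))
    ...   | inj₂ (inj₂ (inj₂ d)) =
            turn (rev qβ) (~-sym d⁺) (~-sym d⁻) (rev qα) (~-sym (≃⇒~ (piece-≢ α uniq (start∈ qα) (end∈ qβ)) e₁≃e₂)) (~-sym d)
              (↭-trans (++⁺ʳ B (++⁺ (↭-reverse β) (prep p (↭-reverse α))))
                (solve 4 (λ p a b c → (b ⊕ (p ⊕ a)) ⊕ c ⊜ (a ⊕ (p ⊕ b)) ⊕ c) ↭-refl (p ∷ []) α β B))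
    bridge p∈ | inj₂ p∈B with split pB p∈B
    ... | at ε _ = contradiction (inj₁ refl) p≄f₁
    ... | at (seg _ _) ε = contradiction (inj₁ refl) p≄f₂
    -- Here the third leaf is `e₁` instead of `x`: either `p` leaves `B` and is put in front of `A`,
    -- or all of `A` fits into `B` next to `p`.
    ... | at {α} {β} (seg {q = p⁻} qα d⁻) (seg {q = p⁺} d⁺ qβ) with nc (~-sym d⁻) d⁺ pe₁
    ...   | inj₁ (inj₁ refl) =
            contradiction refl (disjoint α (unique-++ʳ A (unique-++ʳ (x ∷ []) uniq)) (end∈ qα) (there (start∈ qβ)))
    ...   | inj₁ (inj₂ d) =
            restart (pe₁ ∷ pA) (join qα d qβ) xe₂ n₂₁ n₂₂
              (solve 4 (λ p a b c → (p ⊕ c) ⊕ (a ⊕ b) ⊜ c ⊕ (a ⊕ (p ⊕ b))) ↭-refl (p ∷ []) α β A)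
    ...   | inj₂ (inj₁ e) =
            target uniq xf₁ (join qα d⁻ (pe₂ ∷ join (rev pA) (~-sym (≃⇒~ p⁺≢e₁ e)) qβ)) xf₂
              (↭-trans (++⁺ˡ α (prep p (++⁺ʳ β (↭-reverse A))))
                (solve 4 (λ p a b c → a ⊕ (p ⊕ (c ⊕ b)) ⊜ c ⊕ (a ⊕ (p ⊕ b))) ↭-refl (p ∷ []) α β A))
      where
      p⁺≢e₁ : p⁺ ≢ e₁
      p⁺≢e₁ e = disjoint A (unique-++ʳ (x ∷ []) uniq) (start∈ pA) (∈-++⁺ʳ α (there (start∈ qβ))) (≡-sym e)
    ...   | inj₂ (inj₂ e) =
            target uniq xf₁ (join qα (≃⇒~ p⁻≢e₁ e) (join pA (~-sym pe₂) (d⁺ ∷ qβ))) xf₂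
              (solve 4 (λ p a b c → a ⊕ (c ⊕ (p ⊕ b)) ⊜ c ⊕ (a ⊕ (p ⊕ b))) ↭-refl (p ∷ []) α β A)
      where
      p⁻≢e₁ : p⁻ ≢ e₁
      p⁻≢e₁ e = disjoint A (unique-++ʳ (x ∷ []) uniq) (start∈ pA) (∈-++⁺ˡ (end∈ qα)) (≡-sym e)

  module Merge {e₁ e₂ f₁ f₂ A B} (S : State e₁ e₂ f₁ f₂ A B) (cov : ∀ {v} → x ~ v → v ∈ A ++ B) where

    open State S

    private
      mixed : ∀ {p} → x ~ p → p ≃ e₁ ⊎ p ≃ e₂ → p ≃ f₁ ⊎ p ≃ f₂ → Target (A ++ B)
      mixed {p} xp e f = [ (λ p∈ → linked S p∈ xp f′ e′)
                         , (λ p∈ → target-↭ (++-comm B A) (linked (swapSt S) p∈ xp e′ f′)) ]′ (∈-++⁻ A (cov xp))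
        where
        e′ : p ~ e₁ ⊎ p ~ e₂
        e′ = ⊎-map (≃⇒~ (λ { refl → [ n₁₁ , n₁₂ ]′ f })) (≃⇒~ (λ { refl → [ n₂₁ , n₂₂ ]′ f })) e
        f′ : p ~ f₁ ⊎ p ~ f₂
        f′ = ⊎-map (≃⇒~ (λ { refl → [ n₁₁ ∘ ≃-sym , n₂₁ ∘ ≃-sym ]′ e })) (≃⇒~ (λ { refl → [ n₁₂ ∘ ≃-sym , n₂₂ ∘ ≃-sym ]′ e })) f

      ESide FSide : V → Set
      ESide p = (p ≃ e₁ × p ≃ e₂) × ¬ p ≃ f₁ × ¬ p ≃ f₂
      FSide p = (p ≃ f₁ × p ≃ f₂) × ¬ p ≃ e₁ × ¬ p ≃ e₂

      third : ∀ {a b c} → x ~ a → x ~ b → x ~ c → ¬ b ≃ c → ¬ a ≃ c → a ≃ b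
      third xa xb xc ¬bc ¬ac with nc xa xb xc
      ... | inj₁ e        = e
      ... | inj₂ (inj₁ e) = contradiction e ¬bc
      ... | inj₂ (inj₂ e) = contradiction e ¬ac

      side : ∀ {p} → x ~ p → Target (A ++ B) ⊎ ESide p ⊎ FSide p
      side {p} xp with (p ≃? e₁) ⊎-dec (p ≃? e₂) | (p ≃? f₁) ⊎-dec (p ≃? f₂)
      ... | yes e | yes f = inj₁ (mixed xp e f)
      ... | _     | no ¬f = inj₂ (inj₁ ((third xp xe₁ xf₁ n₁₁ (¬f ∘ inj₁) , third xp xe₂ xf₁ n₂₁ (¬f ∘ inj₁)) , ¬f ∘ inj₁ , ¬f ∘ inj₂))
      ... | no ¬e | yes _ = inj₂ (inj₂ ((third xp xf₁ xe₁ (n₁₁ ∘ ≃-sym) (¬e ∘ inj₁) , third xp xf₂ xe₁ (n₁₂ ∘ ≃-sym) (¬e ∘ inj₁)) , ¬e ∘ inj₁ , ¬e ∘ inj₂))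

      cross : ∀ {p q} → x ~ p → x ~ q → p ~ q → ESide p → FSide q → Target (A ++ B)
      cross xp xq pq ((pe₁ , pe₂) , p≄f₁ , p≄f₂) ((qf₁ , qf₂) , q≄e₁ , q≄e₂) =
        Bridge.bridge S xp (≃⇒~ (λ { refl → q≄e₁ (inj₂ (~-sym pq)) }) pe₁) (≃⇒~ (λ { refl → q≄e₂ (inj₂ (~-sym pq)) }) pe₂)
          p≄f₁ p≄f₂ xq (≃⇒~ (λ { refl → p≄f₁ (inj₂ pq) }) qf₁) pq (cov xq) (cov xp)

    -- A neighbour of `x` that sees ends of both paths finishes at once; otherwise N(x) falls into
    -- two cliques, one per path. As `u` and `z` are not adjacent, they lie on different sides, and
    -- one of the edges `uw`, `wz` crosses.
    merge : Target (A ++ B)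
    merge with side xu | side xw | side xz
    ... | inj₁ t | _ | _ = t
    ... | inj₂ _ | inj₁ t | _ = t
    ... | inj₂ _ | inj₂ _ | inj₁ t = t
    ... | inj₂ (inj₁ U) | inj₂ (inj₂ W) | inj₂ _        = cross xu xw uw U W
    ... | inj₂ (inj₁ _) | inj₂ (inj₁ W) | inj₂ (inj₂ Z) = cross xw xz wz W Z
    ... | inj₂ (inj₁ U) | inj₂ (inj₁ _) | inj₂ (inj₁ Z) = contradiction (third xu xz xf₁ (proj₁ (proj₂ Z)) (proj₁ (proj₂ U))) u≄z
    ... | inj₂ (inj₂ U) | inj₂ (inj₁ W) | inj₂ _        = cross xw xu (~-sym uw) W U
    ... | inj₂ (inj₂ _) | inj₂ (inj₂ W) | inj₂ (inj₁ Z) = cross xz xw (~-sym wz) Z W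
    ... | inj₂ (inj₂ U) | inj₂ (inj₂ _) | inj₂ (inj₂ Z) = contradiction (third xu xz xe₁ (proj₁ (proj₂ Z)) (proj₁ (proj₂ U))) u≄z

  -- A Hamilton cycle of the completed graph, cut at x and at its new edges, falls into such pieces;
  -- there any order and orientation of them is again a Hamilton cycle.
  record Piece (L : List V) : Set where
    constructor piece
    field
      {e f} : V
      path  : Path e L f
      xe    : x ~ e
      xf    : x ~ f

  private
    glue : ∀ {A B} → (P : Piece A) (Q : Piece B) → Piece.e P ~ Piece.e Q → Piece (reverse A ++ B)
    glue (piece p xe xf) (piece q xe′ xf′) d = piece (join (rev p) d q) xf xf′

    two : ∀ {A B} → Unique (x ∷ A ++ B) → (∀ {v} → x ~ v → v ∈ A ++ B) → Piece A → Piece B → Target (A ++ B)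
    two {A} {B} u cov P@(piece {e₁} {e₂} p xe₁ xe₂) Q@(piece {f₁} {f₂} q xf₁ xf₂) with e₁ ~? f₁ | e₁ ~? f₂ | e₂ ~? f₁ | e₂ ~? f₂
    ... | yes d | _ | _ | _ = target u xe₂ (join (rev p) d q) xf₂ (++⁺ʳ B (↭-reverse A))
    ... | no _ | yes d | _ | _ = target u xe₂ (join (rev p) d (rev q)) xf₁ (++⁺ (↭-reverse A) (↭-reverse B))
    ... | no _ | no _ | yes d | _ = target u xe₁ (join p d q) xf₂ ↭-refl
    ... | no _ | no _ | no _ | yes d = target u xe₁ (join p d (rev q)) xf₁ (++⁺ˡ A (↭-reverse B))
    ... | no a | no b | no c | no d = Merge.merge (record
        { pA = p ; pB = q ; xe₁ = xe₁ ; xe₂ = xe₂ ; xf₁ = xf₁ ; xf₂ = xf₂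
        ; n₁₁ = a ∘ ≃⇒~ (dis (start∈ p) (start∈ q)) ; n₁₂ = b ∘ ≃⇒~ (dis (start∈ p) (end∈ q))
        ; n₂₁ = c ∘ ≃⇒~ (dis (end∈ p) (start∈ q)) ; n₂₂ = d ∘ ≃⇒~ (dis (end∈ p) (end∈ q)) ; uniq = u }) cov
      where
      dis : ∀ {a b} → a ∈ A → b ∈ B → a ≢ b
      dis = disjoint A (unique-++ʳ (x ∷ []) u)

  -- Three ends in N(x) are never independent, so two pieces suffice.
  assemble : ∀ k {Ls} → length Ls ≡ suc k → All Piece Ls → ∀ {M} → concat Ls ↭ M → Unique (x ∷ M) → (∀ {v} → x ~ v → v ∈ M) → Target M
  assemble k {A ∷ []} _ (piece p xe xf ∷ []) π u cov =
    target u xe p xf (↭-trans (↭-reflexive (≡-sym (++-identityʳ A))) π)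
  assemble k {A ∷ B ∷ []} _ (P ∷ Q ∷ []) {M} π u cov =
    target-↭ π′ (two (unique-↭ (prep x (↭-sym π′)) u) (∈-resp-↭ (↭-sym π′) ∘ cov) P Q)
    where
    π′ : A ++ B ↭ M
    π′ = ↭-trans (++⁺ˡ A (↭-reflexive (≡-sym (++-identityʳ B)))) π
  assemble (suc k) {A ∷ B ∷ C ∷ Ls} eq (P ∷ Q ∷ R ∷ Ps) π u cov
    with nc (Piece.xe P) (Piece.xe Q) (Piece.xe R)
  ... | inj₁ e =
        assemble k (cong pred eq) (glue P Q (≃⇒~ ne e) ∷ R ∷ Ps)
          (↭-trans (++⁺ʳ (C ++ concat Ls) (++⁺ʳ B (↭-reverse A))) (↭-trans (solve 4 (λ a b c d → (a ⊕ b) ⊕ (c ⊕ d) ⊜ a ⊕ (b ⊕ (c ⊕ d))) ↭-refl A B C (concat Ls)) π)) u cov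
    where
    ne : Piece.e P ≢ Piece.e Q
    ne = disjoint A (unique-↭ (↭-sym π) (unique-++ʳ (x ∷ []) u)) (start∈ (Piece.path P)) (∈-++⁺ˡ (start∈ (Piece.path Q)))
  ... | inj₂ (inj₁ e) =
        assemble k (cong pred eq) (glue Q R (≃⇒~ ne e) ∷ P ∷ Ps)
          (↭-trans (++⁺ʳ (A ++ concat Ls) (++⁺ʳ C (↭-reverse B))) (↭-trans (solve 4 (λ a b c d → (b ⊕ c) ⊕ (a ⊕ d) ⊜ a ⊕ (b ⊕ (c ⊕ d))) ↭-refl A B C (concat Ls)) π)) u cov
    where
    ne : Piece.e Q ≢ Piece.e R
    ne = disjoint B (unique-++ʳ A (unique-↭ (↭-sym π) (unique-++ʳ (x ∷ []) u))) (start∈ (Piece.path Q)) (∈-++⁺ˡ (start∈ (Piece.path R)))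
  ... | inj₂ (inj₂ e) =
        assemble k (cong pred eq) (glue P R (≃⇒~ ne e) ∷ Q ∷ Ps)
          (↭-trans (++⁺ʳ (B ++ concat Ls) (++⁺ʳ C (↭-reverse A))) (↭-trans (solve 4 (λ a b c d → (a ⊕ c) ⊕ (b ⊕ d) ⊜ a ⊕ (b ⊕ (c ⊕ d))) ↭-refl A B C (concat Ls)) π)) u cov
    where
    ne : Piece.e P ≢ Piece.e R
    ne = disjoint A (unique-↭ (↭-sym π) (unique-++ʳ (x ∷ []) u)) (start∈ (Piece.path P)) (∈-++⁺ʳ B (∈-++⁺ˡ (start∈ (Piece.path R))))

  private
    module C = Completion H x
    module H′ = Basics (complete H x)

    cut : ∀ {w L v} → H′.Path w L v → x ~ v →
          Σ[ A ∈ List V ] Σ[ e ∈ V ] Σ[ Ls ∈ List (List V) ] (Path w A e × x ~ e × All Piece Ls × concat (A ∷ Ls) ≡ L)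
    cut H′.one xv = _ , _ , [] , one , xv , [] , refl
    cut (e H′.∷ p) xv with cut p xv
    ... | A , f , Ls , q , xf , Ps , refl with C.inv e
    ...   | inj₁ d         = _ , f , Ls , d ∷ q , xf , Ps , refl
    ...   | inj₂ (xu , xw) = _ , _ , A ∷ Ls , one , xu , piece q xw xf ∷ Ps , refl

  uncomplete : H′.HamCycle → HamCycle
  uncomplete (C , sp) with H′.rotate C (sp x)
  ... | L , u , v , xu , p , vx , π with cut p (C.inv-x (H′.~-sym vx))
  ...   | A , f , Ls , q , xf , Ps , refl
      with assemble (length Ls) refl (piece q (C.inv-x xu) xf ∷ Ps) ↭-refl (unique-↭ (↭-sym π) (H′.Cycle.uniq C)) cov
    where
    cov : ∀ {v} → x ~ v → v ∈ concat (A ∷ Ls)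
    cov {v} xv with ∈-resp-↭ (↭-sym π) (sp v)
    ... | here refl = contradiction refl (~⇒≢ xv)
    ... | there v∈  = v∈
  ...     | D , ρ = D , λ v → ∈-resp-↭ (↭-sym ρ) (∈-resp-↭ (↭-sym π) (sp v))

-- Cliques visited by a path

module Visits {n : ℕ} (G : Graph n) where

  open Basics G

  -- The relation is left open so that visits by one vertex and by a pair of vertices share the same
  -- lemmas.
  data AnyEdge (Φ : V → V → Set) : List V → Set where
    hd : ∀ {p q L} → Φ p q → AnyEdge Φ (p ∷ q ∷ L)
    tl : ∀ {p L} → AnyEdge Φ L → AnyEdge Φ (p ∷ L)

  module _ {Φ : V → V → Set} where

    anyEdge? : (∀ p q → Dec (Φ p q)) → (L : List V) → Dec (AnyEdge Φ L)
    anyEdge? Φ? [] = no λ ()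
    anyEdge? Φ? (_ ∷ []) = no λ { (tl ()) }
    anyEdge? Φ? (p ∷ q ∷ L) with Φ? p q | anyEdge? Φ? (q ∷ L)
    ... | yes h | _     = yes (hd h)
    ... | no _  | yes t = yes (tl t)
    ... | no ¬h | no ¬t = no λ { (hd h) → ¬h h ; (tl t) → ¬t t }

    any-++ˡ : ∀ {L} M → AnyEdge Φ L → AnyEdge Φ (L ++ M)
    any-++ˡ M (hd h) = hd h
    any-++ˡ M (tl a) = tl (any-++ˡ M a)

    any-++ʳ : ∀ L {M} → AnyEdge Φ M → AnyEdge Φ (L ++ M)
    any-++ʳ []      a = a
    any-++ʳ (_ ∷ L) a = tl (any-++ʳ L a)

    any-join : ∀ {u L v w M z} → Path u L v → Path w M z → Φ v w → AnyEdge Φ (L ++ M)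
    any-join one     one     φ = hd φ
    any-join one     (_ ∷ _) φ = hd φ
    any-join (_ ∷ p) q       φ = tl (any-join p q φ)

    any-reverse : (∀ {p q} → Φ p q → Φ q p) → ∀ {u L v} → Path u L v → AnyEdge Φ L → AnyEdge Φ (reverse L)
    any-reverse s (_∷_ {u} {L = L} _ p) a rewrite unfold-reverse u L with p | a
    ... | one     | hd φ = any-join (rev p) one (s φ)
    ... | one     | tl b = any-++ˡ (u ∷ []) (any-reverse s p b)
    ... | (_ ∷ _) | hd φ = any-join (rev p) one (s φ)
    ... | (_ ∷ _) | tl b = any-++ˡ (u ∷ []) (any-reverse s p b)
    any-reverse s one (tl ())

  -- In a diamond-free graph, the maximal clique that contains the edge pq.
  K : V → V → V → Set
  K p q v = v ≃ p × v ≃ q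

  K? : ∀ p q v → Dec (K p q v)
  K? p q v = (v ≃? p) ×-dec (v ≃? q)

  K-swap : ∀ {p q v} → K p q v → K q p v
  K-swap (a , b) = b , a

  NoDiamond : Set
  NoDiamond = ∀ {p q x y} → p ~ q → K p q x → K p q y → x ≃ y

  Vis : List V → V → Set
  Vis L v = AnyEdge (λ p q → K p q v) L

  -- A one-vertex path has no edge and visits nothing, hence the separate alternative for the
  -- starting vertex.
  on-path : ∀ {u L w v} → Path u L w → v ∈ L → v ≡ u ⊎ Vis L v
  on-path one     (here e) = inj₁ e
  on-path (_ ∷ _) (here e) = inj₁ e
  on-path (e ∷ one) (there (here refl)) = inj₂ (hd (inj₂ (~-sym e) , inj₁ refl))
  on-path (e ∷ p@(_ ∷ _)) (there v∈) with on-path p v∈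
  ... | inj₁ refl = inj₂ (hd (inj₂ (~-sym e) , inj₁ refl))
  ... | inj₂ a    = inj₂ (tl a)

  module _ (nd : NoDiamond) where

    private
      -- An edge whose clique contains `v` is subdivided by `v`. By diamond-freeness the new edges
      -- lie in the same clique, so no visit is lost and the process can be repeated.
      insert : ∀ {u L w v} → Path u L w → v ∉ L → Vis L v →
               Σ[ L′ ∈ List V ] (Path u L′ w × L′ ↭ v ∷ L × (∀ {z} → Vis L z → Vis L′ z))
      insert {v = v} (e ∷ p) v∉ a with p | a
      ... | one {q} | hd (vp , vq) = _ , ~-sym (≃⇒~ (v∉ ∘ here) vp) ∷ (≃⇒~ (v∉ ∘ there ∘ here) vq ∷ one)
              , solve 3 (λ p v l → p ⊕ (v ⊕ l) ⊜ v ⊕ (p ⊕ l)) ↭-refl (_ ∷ []) (v ∷ []) (q ∷ [])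
              , λ { (hd k) → hd (proj₁ k , nd e k (vp , vq)) ; (tl b) → tl (tl b) }
      ... | (_∷_ {q} {L = L} _ _) | hd (vp , vq) = _ , ~-sym (≃⇒~ (v∉ ∘ here) vp) ∷ (≃⇒~ (v∉ ∘ there ∘ here) vq ∷ p)
              , solve 3 (λ p v l → p ⊕ (v ⊕ l) ⊜ v ⊕ (p ⊕ l)) ↭-refl (_ ∷ []) (v ∷ []) (q ∷ L)
              , λ { (hd k) → hd (proj₁ k , nd e k (vp , vq)) ; (tl b) → tl (tl b) }
      ... | p | tl b with insert p (v∉ ∘ there) b
      ...   | L′ , p′ , π , f = _ , e ∷ p′ , ↭-trans (prep _ π) (solve 3 (λ p v l → p ⊕ (v ⊕ l) ⊜ v ⊕ (p ⊕ l)) ↭-refl (_ ∷ []) (v ∷ []) _)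
              , λ z → shift-vis p p′ f z
        where
        shift-vis : ∀ {u q L L′ w} → Path q L w → Path q L′ w → (∀ {z} → Vis L z → Vis L′ z) → ∀ {z} → Vis (u ∷ L) z → Vis (u ∷ L′) z
        shift-vis one     one     f (hd k) = hd k
        shift-vis one     (_ ∷ _) f (hd k) = hd k
        shift-vis (_ ∷ _) one     f (hd k) = hd k
        shift-vis (_ ∷ _) (_ ∷ _) f (hd k) = hd k
        shift-vis _       _       f (tl b) = tl (f b)
      insert one v∉ (tl ())

      absorb-list : ∀ vs {u L w} → Path u L w → Unique L →
               Σ[ L′ ∈ List V ] (Path u L′ w × Unique L′ × (∀ {z} → z ∈ L → z ∈ L′) × (∀ {z} → Vis L z → Vis L′ z)
                 × (∀ {z} → z ∈ vs → Vis L z → z ∈ L′))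
      absorb-list [] p u = _ , p , u , (λ z → z) , (λ z → z) , λ ()
      absorb-list (v ∷ vs) {L = L} p u with v ∈? L | anyEdge? (λ p q → K? p q v) L
      ... | no v∉ | yes a with insert p v∉ a
      ...   | L₁ , p₁ , π , f₁ with absorb-list vs p₁ (unique-↭ (↭-sym π) (unique-∷ v∉ u))
      ...     | L₂ , p₂ , u₂ , s₂ , f₂ , g₂ = L₂ , p₂ , u₂ , s₂ ∘ ∈-resp-↭ (↭-sym π) ∘ there , f₂ ∘ f₁
              , λ { (here refl) _ → s₂ (∈-resp-↭ (↭-sym π) (here refl)) ; (there z∈) b → g₂ z∈ (f₁ b) }
      absorb-list (v ∷ vs) p u | yes v∈ | _ with absorb-list vs p u
      ... | L₂ , p₂ , u₂ , s₂ , f₂ , g₂ = L₂ , p₂ , u₂ , s₂ , f₂ , λ { (here refl) _ → s₂ v∈ ; (there z∈) b → g₂ z∈ b }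
      absorb-list (v ∷ vs) p u | no _ | no ¬a with absorb-list vs p u
      ... | L₂ , p₂ , u₂ , s₂ , f₂ , g₂ = L₂ , p₂ , u₂ , s₂ , f₂ , λ { (here refl) b → contradiction b ¬a ; (there z∈) b → g₂ z∈ b }

    absorb : ∀ {u L w} → Path u L w → Unique L →
             Σ[ L′ ∈ List V ] (Path u L′ w × Unique L′ × (∀ {z} → Vis L z → z ∈ L′))
    absorb p u with absorb-list (allFin n) p u
    ... | L′ , p′ , u′ , _ , _ , g = L′ , p′ , u′ , g (∈-allFin _)

-- Degree sums

module Degrees {n : ℕ} (G : Graph n) where

  open Basics G

  ind : V → V → ℕ
  ind u v = if adj G u v then 1 else 0

  ind≤1 : ∀ u v → ind u v ≤ 1
  ind≤1 u v with adj G u v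
  ... | true  = s≤s z≤n
  ... | false = z≤n

  ind-no : ∀ {u v} → ¬ u ~ v → ind u v ≡ 0
  ind-no {u} {v} h rewrite ¬~⇒false h = refl

  ind-yes : ∀ {u v} → u ~ v → ind u v ≡ 1
  ind-yes e rewrite e = refl

  ind-self : ∀ u → ind u u ≡ 0
  ind-self u rewrite irrefl G u = refl

  ind₂ : V → V → V → ℕ
  ind₂ u w v = ind u v + ind w v

  ind₂≤1 : ∀ {u w v} → ¬ (v ~ u × v ~ w) → ind₂ u w v ≤ 1
  ind₂≤1 {u} {w} {v} h with u ~? v | w ~? v
  ... | yes a | yes b = contradiction (~-sym a , ~-sym b) h
  ... | no a  | _     rewrite ind-no a = ind≤1 w v
  ... | yes _ | no b  rewrite ind-no b | +-comm (ind u v) 0 = ind≤1 u v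

  deg₂-split : ∀ u w {L M} → allFin n ↭ L ++ M → deg G u + deg G w ≡ sum (map (ind₂ u w) L) + sum (map (ind₂ u w) M)
  deg₂-split u w {L} {M} π = trans (≡-sym (sum-+ (ind u) (ind w) (allFin n))) (Σᶠ-split (ind₂ u w) {L} {M} π)

  -- Outside `L` each vertex is counted at most once, so a deficit of one on `L` keeps the degree
  -- sum below `n`.
  few-on-L : ∀ {u w} L → Unique L → sum (map (ind₂ u w) L) + 1 ≤ length L →
             (∀ {v} → v ∉ L → ¬ (v ~ u × v ~ w)) → n ≤ deg G u + deg G w → ⊥
  few-on-L {u} {w} L uL small none big with complement uL
  ... | M , π = <-irrefl refl (begin-strict
    n                                                      ≤⟨ big ⟩
    deg G u + deg G w                                      ≡⟨ deg₂-split u w {L} {M} π ⟩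
    sum (map (ind₂ u w) L) + sum (map (ind₂ u w) M)        <⟨ s≤s (+-monoʳ-≤ _ (sum-≤length (ind₂ u w) M (λ v∈ → ind₂≤1 (none (λ v∈L → disjoint L (unique-↭ π (allFin⁺ n)) v∈L v∈ refl))))) ⟩
    suc (sum (map (ind₂ u w) L) + length M)                ≡⟨ cong (λ z → z + length M) (+-comm 1 (sum (map (ind₂ u w) L))) ⟩
    sum (map (ind₂ u w) L) + 1 + length M                  ≤⟨ +-monoˡ-≤ (length M) small ⟩
    length L + length M                                    ≡⟨ length-complement L π ⟩
    n                                                      ∎)
    where
    open ≤-Reasoning

  -- At most one common neighbour would leave u, w themselves uncovered by either neighbourhood.
  two-common : ∀ {u w} → u ≢ w → ¬ u ~ w → n ≤ deg G u + deg G w →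
               Σ[ x ∈ V ] Σ[ y ∈ V ] (x ≢ y × (x ~ u × x ~ w) × (y ~ u × y ~ w))
  two-common {u} {w} u≢w u≁w big with anyFin? (λ x → (x ~? u) ×-dec (x ~? w))
  ... | no none = ⊥-elim (few-on-L (u ∷ []) ([] ∷ []) (s≤s′ (self-w)) (λ {v} _ c → none (v , c)) big)
    where
    self-w : ind₂ u w u + 0 ≡ 0
    self-w rewrite ind-self u | ind-no (u≁w ∘ ~-sym) = refl
    s≤s′ : ∀ {a} → a ≡ 0 → a + 1 ≤ 1
    s≤s′ refl = ≤-refl
  ... | yes (x , xu , xw) with anyFin? (λ y → ¬? (x ≟ y) ×-dec ((y ~? u) ×-dec (y ~? w)))
  ...   | yes (y , x≢y , c) = x , y , x≢y , (xu , xw) , c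
  ...   | no none = ⊥-elim (few-on-L (u ∷ w ∷ x ∷ []) uniq3 small (λ {v} v∉ c → none (v , (λ { refl → v∉ (there (there (here refl))) }) , c)) big)
    where
    uniq3 : Unique (u ∷ w ∷ x ∷ [])
    uniq3 = (u≢w ∷ (~⇒≢ xu ∘ ≡-sym) ∷ []) ∷ ((~⇒≢ xw ∘ ≡-sym) ∷ []) ∷ [] ∷ []
    small : sum (map (ind₂ u w) (u ∷ w ∷ x ∷ [])) + 1 ≤ 3
    small rewrite ind-self u | ind-self w | ind-no u≁w | ind-no (u≁w ∘ ~-sym) | ind-yes (~-sym xu) | ind-yes (~-sym xw) = ≤-refl

  module _ (u w : V) where

    private
      Crossing : V → List V → Set
      Crossing a M = Σ[ α ∈ List V ] Σ[ β ∈ List V ] Σ[ p ∈ V ] Σ[ q ∈ V ] (M ≡ α ++ β × Path a α p × Path q β w × u ~ q × p ~ w)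

      -- Ore's count with a shift: adjacency of `u` to a vertex is paired with adjacency of `w` to
      -- its predecessor, and without a crossing each consecutive pair counts at most once. Left
      -- over are the term of `u` at the first vertex, kept as `ind u a`, and the term of `w` at
      -- itself, which is zero.
      crossing : ∀ {a M} → Path a M w → Crossing a M ⊎ sum (map (ind₂ u w) M) + 1 ≤ ind u a + length M
      crossing one rewrite ind-self w = inj₂ (≤-reflexive (lem (ind u w)))
        where
        lem : ∀ m → m + 0 + 0 + 1 ≡ m + 1
        lem = solve-∀
      crossing {a} (_∷_ {w = a′} {L = M′} e p) with crossing p
      ... | inj₁ (α , β , x , y , refl , P , Q , uy , xw) = inj₁ (a ∷ α , β , x , y , refl , e ∷ P , Q , uy , xw)
      ... | inj₂ h with u ~? a′ | a ~? w
      ...   | yes ua′ | yes aw = inj₁ (a ∷ [] , M′ , a , a′ , refl , one , p , ua′ , aw)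
      ...   | yes _ | no aw = inj₂ (begin
        ind u a + ind w a + S + 1             ≡⟨ cong (λ z → ind u a + z + S + 1) (ind-no (aw ∘ ~-sym)) ⟩
        ind u a + 0 + S + 1                   ≡⟨ lem (ind u a) S ⟩
        ind u a + (S + 1)                     ≤⟨ +-monoʳ-≤ (ind u a) (≤-trans h (+-monoˡ-≤ (length M′) (ind≤1 u a′))) ⟩
        ind u a + (1 + length M′)             ∎)
        where
        open ≤-Reasoning
        S = sum (map (ind₂ u w) M′)
        lem : ∀ a s → a + 0 + s + 1 ≡ a + (s + 1)
        lem = solve-∀
      ...   | no ua′ | _ = inj₂ (begin
        ind u a + ind w a + S + 1             ≡⟨ lem (ind u a) (ind w a) S ⟩
        ind u a + (ind w a + (S + 1))         ≤⟨ +-monoʳ-≤ (ind u a) (+-mono-≤ (ind≤1 w a) (≤-trans h (≤-reflexive (cong (_+ length M′) (ind-no ua′))))) ⟩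
        ind u a + (1 + length M′)             ∎)
        where
        open ≤-Reasoning
        S = sum (map (ind₂ u w) M′)
        lem : ∀ a b s → a + b + s + 1 ≡ a + (b + (s + 1))
        lem = solve-∀

    -- A common neighbour off the path closes it to a cycle with one more vertex, which is why the
    -- cycle only has to contain `L`. Otherwise the degree sum forces a crossing.
    ore : ∀ {L} → Path u L w → Unique L → n ≤ deg G u + deg G w → CycleThrough (_∈ L)
    ore {L} p uq big with anyFin? (λ z → ¬? (z ∈? L) ×-dec ((z ~? u) ×-dec (z ~? w)))
    ... | yes (z , z∉ , zu , zw) = cycle (zu ∷ p) (~-sym zw) (unique-∷ z∉ uq) , there
    ... | no none with crossing p
    ...   | inj₁ (α , β , x , y , refl , P , Q , uy , xw) =
            cycle (join P xw (rev Q)) (~-sym uy) (unique-↭ (++⁺ˡ α (↭-sym (↭-reverse β))) uq)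
            , ∈-resp-↭ (++⁺ˡ α (↭-sym (↭-reverse β)))
    ...   | inj₂ h = ⊥-elim (few-on-L L uq (≤-trans h (≤-reflexive (cong (_+ length L) (ind-self u)))) (λ {v} v∉ c → none (v , v∉ , c)) big)

-- Counting for the termination measures

module _ {A : Set} {P Q : A → Set} (P? : ∀ x → Dec (P x)) (Q? : ∀ x → Dec (Q x)) (P⊆Q : ∀ {x} → P x → Q x) where

  count-≤ : ∀ xs → length (filter P? xs) ≤ length (filter Q? xs)
  count-≤ [] = z≤n
  count-≤ (x ∷ xs) with P? x | Q? x
  ... | yes _ | yes _ = s≤s (count-≤ xs)
  ... | yes p | no ¬q = contradiction (P⊆Q p) ¬q
  ... | no _  | yes _ = ≤-trans (count-≤ xs) (n≤1+n _)
  ... | no _  | no _  = count-≤ xs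

  count-< : ∀ {x xs} → x ∈ xs → Q x → ¬ P x → length (filter P? xs) < length (filter Q? xs)
  count-< {x} {_ ∷ xs} (here refl) q ¬p with P? x | Q? x
  ... | yes p | _     = contradiction p ¬p
  ... | no _  | no ¬q = contradiction q ¬q
  ... | no _  | yes _ = s≤s (count-≤ xs)
  count-< {x} {y ∷ xs} (there x∈) q ¬p with P? y | Q? y
  ... | yes _ | yes _ = s≤s (count-< x∈ q ¬p)
  ... | yes p | no ¬q = contradiction (P⊆Q p) ¬q
  ... | no _  | yes _ = ≤-trans (count-< x∈ q ¬p) (n≤1+n _)
  ... | no _  | no _  = count-< x∈ q ¬p

pairs : (n : ℕ) → List (Fin n × Fin n)
pairs n = cartesianProduct (allFin n) (allFin n)

∈-pairs : ∀ {n} (u v : Fin n) → (u , v) ∈ pairs n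
∈-pairs u v = ∈-cartesianProduct⁺ (∈-allFin u) (∈-allFin v)

⊆⇒length≤ : {A : Set} {L M : List A} → Unique L → (∀ {v} → v ∈ L → v ∈ M) → length L ≤ length M
⊆⇒length≤ {L = []} _ _ = z≤n
⊆⇒length≤ {L = x ∷ L} {M} u@(_ ∷ u′) sub with ∈⇒↭ (sub (here refl))
... | M′ , π = ≤-trans (s≤s (⊆⇒length≤ u′ sub′)) (≤-reflexive (≡-sym (↭-length π)))
  where
  sub′ : ∀ {v} → v ∈ L → v ∈ M′
  sub′ v∈ with ∈-resp-↭ π (sub (there v∈))
  ... | here refl = contradiction v∈ (head∉ u)
  ... | there v∈′ = v∈′

-- Thetas

module NetCentres {n : ℕ} (F : Graph n) where

  open Basics F
  open Visits F using (K)

  Triangle : V → V → V → Set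
  Triangle a b c = a ~ b × b ~ c × a ~ c

  Ore : V → V → Set
  Ore u v = n ≤ deg F u + deg F v

  -- The trace in `F` of a q-heavy net with triangle `a`, `b`, `c`, where `a` is its heavy corner:
  -- degrees two and three are recorded as bounds on neighbourhoods, which is the form that survives
  -- completion.
  record QType (a b c : V) : Set where
    field
      {τ σ τ′ σ′} : V
      heavy-a  : Heavy F a
      heavy-σ  : Heavy F σ
      heavy-σ′ : Heavy F σ′
      N-b  : ∀ {v} → b ~ v → v ≡ a ⊎ v ≡ c ⊎ v ≡ τ
      N-c  : ∀ {v} → c ~ v → v ≡ a ⊎ v ≡ b ⊎ v ≡ τ′
      N-τ  : ∀ {v} → τ ~ v → v ≡ b ⊎ v ≡ σ
      N-τ′ : ∀ {v} → τ′ ~ v → v ≡ c ⊎ v ≡ σ′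

  -- A net of `F`: in a diamond-free graph a neighbour of one corner that lies outside the clique of
  -- the triangle sees no other corner, so the `o` fields supply the remaining non-edges and the
  -- distinctness.
  record Tails (a₁ a₂ a₃ : V) : Set where
    constructor tails
    field
      {t₁ t₂ t₃} : V
      e₁  : a₁ ~ t₁
      e₂  : a₂ ~ t₂
      e₃  : a₃ ~ t₃
      o₁  : ¬ K a₁ a₂ t₁
      o₂  : ¬ K a₁ a₂ t₂
      o₃  : ¬ K a₁ a₂ t₃
      n₁₂ : ¬ t₁ ~ t₂
      n₁₃ : ¬ t₁ ~ t₃
      n₂₃ : ¬ t₂ ~ t₃

  OrePair : V → V → V → Set
  OrePair a₁ a₂ a₃ = Ore a₁ a₂ ⊎ Ore a₁ a₃ ⊎ Ore a₂ a₃

  NetAlternative : V → V → V → Set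
  NetAlternative a₁ a₂ a₃ = OrePair a₁ a₂ a₃ ⊎ QType a₁ a₂ a₃ ⊎ QType a₂ a₁ a₃ ⊎ QType a₃ a₁ a₂

module Thetas {n : ℕ} (F : Graph n) (nc : Basics.NoClaw F) (nd : Visits.NoDiamond F)
  (nets : ∀ {a₁ a₂ a₃} → NetCentres.Triangle F a₁ a₂ a₃ → NetCentres.Tails F a₁ a₂ a₃ → NetCentres.NetAlternative F a₁ a₂ a₃) where

  open Basics F
  open Visits F
  open NetCentres F

  data Theta : Set where
    θ : ∀ {a₁ a₂ a₃ b₁ b₂ b₃ A B C} → Path a₁ A b₁ → Path a₂ B b₂ → Path a₃ C b₃ →
        Triangle a₁ a₂ a₃ → Triangle b₁ b₂ b₃ → Unique (A ++ B ++ C) → Theta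

  vertices : Theta → List V
  vertices (θ {A = A} {B} {C} _ _ _ _ _ _) = A ++ B ++ C

  size : Theta → ℕ
  size Θ = length (vertices Θ)

  -- Some edge of a path or of a triangle satisfies Φ; by clique invariance one edge per triangle suffices.
  Cov : (V → V → Set) → Theta → Set
  Cov Φ (θ {a₁} {a₂} {a₃} {b₁} {b₂} {b₃} {A} {B} {C} _ _ _ _ _ _) =
    AnyEdge Φ A ⊎ AnyEdge Φ B ⊎ AnyEdge Φ C ⊎ Φ a₁ a₂ ⊎ Φ b₁ b₂

  pattern onA x = inj₁ x
  pattern onB x = inj₂ (inj₁ x)
  pattern onC x = inj₂ (inj₂ (inj₁ x))
  pattern onX x = inj₂ (inj₂ (inj₂ (inj₁ x)))
  pattern onY x = inj₂ (inj₂ (inj₂ (inj₂ x)))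

  K₂ : V → V → V → V → Set
  K₂ u v p q = K p q u × K p q v

  D : Theta → V → Set
  D Θ v = Cov (λ p q → K p q v) Θ

  D₂ : Theta → V → V → Set
  D₂ Θ u v = Cov (K₂ u v) Θ

  cov? : ∀ {Φ} → (∀ p q → Dec (Φ p q)) → ∀ Θ → Dec (Cov Φ Θ)
  cov? φ? (θ {A = A} {B} {C} _ _ _ _ _ _) =
    anyEdge? φ? A ⊎-dec (anyEdge? φ? B ⊎-dec (anyEdge? φ? C ⊎-dec (φ? _ _ ⊎-dec φ? _ _)))

  D? : ∀ Θ v → Dec (D Θ v)
  D? Θ v = cov? (λ p q → K? p q v) Θ

  D₂? : ∀ Θ u v → Dec (D₂ Θ u v)
  D₂? Θ u v = cov? (λ p q → K? p q u ×-dec K? p q v) Θ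

  any-map : ∀ {Φ Ψ : V → V → Set} → (∀ {p q} → Φ p q → Ψ p q) → ∀ {L} → AnyEdge Φ L → AnyEdge Ψ L
  any-map f (hd φ) = hd (f φ)
  any-map f (tl a) = tl (any-map f a)

  cov-map : ∀ {Φ Ψ : V → V → Set} → (∀ {p q} → Φ p q → Ψ p q) → ∀ Θ → Cov Φ Θ → Cov Ψ Θ
  cov-map f (θ _ _ _ _ _ _) (onA x) = onA (any-map f x)
  cov-map f (θ _ _ _ _ _ _) (onB x) = onB (any-map f x)
  cov-map f (θ _ _ _ _ _ _) (onC x) = onC (any-map f x)
  cov-map f (θ _ _ _ _ _ _) (onX x) = onX (f x)
  cov-map f (θ _ _ _ _ _ _) (onY x) = onY (f x)

  any-∷ : ∀ {Φ p q L v} → Path q L v → Φ p q → AnyEdge Φ (p ∷ L)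
  any-∷ one     φ = hd φ
  any-∷ (_ ∷ _) φ = hd φ

  any-∷⁻ : ∀ {Φ p q L v} → Path q L v → AnyEdge Φ (p ∷ L) → Φ p q ⊎ AnyEdge Φ L
  any-∷⁻ one     (hd φ) = inj₁ φ
  any-∷⁻ (_ ∷ _) (hd φ) = inj₁ φ
  any-∷⁻ _       (tl a) = inj₂ a

  -- Comparison and symmetries of thetas

  Goal : Theta → Set
  Goal Θ = CycleThrough (D Θ)

  infix 4 _⊑_ _≺_

  -- On edges, `Φ` depends only on the maximal clique; the representatives `p′`, `q′` may be any
  -- vertices of it.
  ClosedΦ : (V → V → Set) → Set
  ClosedΦ Φ = ∀ {p q p′ q′} → p ~ q → K p q p′ → K p q q′ → Φ p q → Φ p′ q′

  -- Quantifying over `Φ` transports `D` and `D₂` together, and both are needed to carry an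
  -- induction hypothesis across a symmetry.
  _⊑_ : Theta → Theta → Set₁
  Θ ⊑ Θ′ = ∀ {Φ} → ClosedΦ Φ → Cov Φ Θ → Cov Φ Θ′

  -- Thetas of equal size are compared by the pairs that lie in a common visited clique.
  data _≺_ (Θ Θ′ : Theta) : Set where
    smaller  : (∀ {v} → D Θ v → D Θ′ v) → size Θ′ < size Θ → Θ ≺ Θ′
    richer   : (∀ {u v} → D₂ Θ u v → D₂ Θ′ u v) → size Θ′ ≤ size Θ → ∀ u v → D₂ Θ′ u v → ¬ D₂ Θ u v → Θ ≺ Θ′

  IH : Theta → Set
  IH Θ = ∀ Θ′ → Θ ≺ Θ′ → Goal Θ′

  ≺⇒D : ∀ {Θ Θ′} → Θ ≺ Θ′ → ∀ {v} → D Θ v → D Θ′ v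
  ≺⇒D (smaller f _) = f
  ≺⇒D {Θ} {Θ′} (richer f _ _ _ _ _) d = cov-map proj₁ Θ′ (f (cov-map (λ k → k , k) Θ d))

  goal-mono : ∀ {Θ Θ′} → (∀ {v} → D Θ v → D Θ′ v) → Goal Θ′ → Goal Θ
  goal-mono f (C , g) = C , g ∘ f

  improve : ∀ {Θ Θ′} → IH Θ → Θ ≺ Θ′ → Goal Θ
  improve {Θ} {Θ′} ih lt = goal-mono {Θ} {Θ′} (≺⇒D lt) (ih Θ′ lt)

  K-move : ∀ {p q r s v} → p ~ q → K p q r → K p q s → K p q v → K r s v
  K-move e kr ks kv = nd e kv kr , nd e kv ks

  K-closed : ∀ {v} → ClosedΦ (λ p q → K p q v)
  K-closed e kr ks kv = K-move e kr ks kv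

  K₂-closed : ∀ {u v} → ClosedΦ (K₂ u v)
  K₂-closed e kr ks (ku , kv) = K-move e kr ks ku , K-move e kr ks kv

  Kₗ : ∀ {p q} → p ~ q → K p q p
  Kₗ e = inj₁ refl , inj₂ e

  Kᵣ : ∀ {p q} → p ~ q → K p q q
  Kᵣ e = inj₂ (~-sym e) , inj₁ refl

  K₃ : ∀ {p q r} → r ~ p → r ~ q → K p q r
  K₃ e f = inj₂ e , inj₂ f

  transport-IH : ∀ {Θ Θ′} → Θ ⊑ Θ′ → size Θ′ ≤ size Θ → IH Θ → IH Θ′
  transport-IH f le ih Θ″ (smaller g lt) = ih Θ″ (smaller (g ∘ f K-closed) (≤-trans lt le))
  transport-IH f le ih Θ″ (richer g le′ u v d ¬d) = ih Θ″ (richer (g ∘ f K₂-closed) (≤-trans le′ le) u v d (¬d ∘ f K₂-closed))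

  sw₁₂ : Theta → Theta
  sw₁₂ (θ {A = A} {B} {C} p q r (x , y , z) (x′ , y′ , z′) u) =
    θ q p r (~-sym x , z , y) (~-sym x′ , z′ , y′) (unique-↭ (solve 3 (λ a b c → a ⊕ (b ⊕ c) ⊜ b ⊕ (a ⊕ c)) ↭-refl A B C) u)

  sw₂₃ : Theta → Theta
  sw₂₃ (θ {A = A} {B} {C} p q r (x , y , z) (x′ , y′ , z′) u) =
    θ p r q (z , ~-sym y , x) (z′ , ~-sym y′ , x′) (unique-↭ (solve 3 (λ a b c → a ⊕ (b ⊕ c) ⊜ a ⊕ (c ⊕ b)) ↭-refl A B C) u)

  flip : Theta → Theta
  flip (θ {A = A} {B} {C} p q r t t′ u) =
    θ (rev p) (rev q) (rev r) t′ t (unique-↭ (↭-sym (++⁺ (↭-reverse A) (++⁺ (↭-reverse B) (↭-reverse C)))) u)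

  sw₁₂-⊑ : ∀ Θ → Θ ⊑ sw₁₂ Θ
  sw₁₂-⊑ (θ _ _ _ _ _ _) cl (onA x) = onB x
  sw₁₂-⊑ (θ _ _ _ _ _ _) cl (onB x) = onA x
  sw₁₂-⊑ (θ _ _ _ _ _ _) cl (onC x) = onC x
  sw₁₂-⊑ (θ _ _ _ (e , _) _ _) cl (onX x) = onX (cl e (Kᵣ e) (Kₗ e) x)
  sw₁₂-⊑ (θ _ _ _ _ (e , _) _) cl (onY x) = onY (cl e (Kᵣ e) (Kₗ e) x)

  sw₂₃-⊑ : ∀ Θ → Θ ⊑ sw₂₃ Θ
  sw₂₃-⊑ (θ _ _ _ _ _ _) cl (onA x) = onA x
  sw₂₃-⊑ (θ _ _ _ _ _ _) cl (onB x) = onC x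
  sw₂₃-⊑ (θ _ _ _ _ _ _) cl (onC x) = onB x
  sw₂₃-⊑ (θ _ _ _ (e , f , g) _ _) cl (onX x) = onX (cl e (Kₗ e) (K₃ (~-sym g) (~-sym f)) x)
  sw₂₃-⊑ (θ _ _ _ _ (e , f , g) _) cl (onY x) = onY (cl e (Kₗ e) (K₃ (~-sym g) (~-sym f)) x)

  -- `any-reverse` asks for symmetry at all pairs, while `ClosedΦ` gives it at edges only; reversal
  -- is therefore treated apart from `_⊑_`.
  flip-cov : ∀ {Φ} → (∀ {p q} → Φ p q → Φ q p) → ∀ Θ → Cov Φ Θ → Cov Φ (flip Θ)
  flip-cov σ (θ p _ _ _ _ _) (onA x) = onA (any-reverse σ p x)
  flip-cov σ (θ _ q _ _ _ _) (onB x) = onB (any-reverse σ q x)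
  flip-cov σ (θ _ _ r _ _ _) (onC x) = onC (any-reverse σ r x)
  flip-cov σ (θ _ _ _ _ _ _) (onX x) = onY x
  flip-cov σ (θ _ _ _ _ _ _) (onY x) = onX x

  flip-D : ∀ Θ {v} → D Θ v → D (flip Θ) v
  flip-D Θ = flip-cov K-swap Θ

  flip-D₂ : ∀ Θ {u v} → D₂ Θ u v → D₂ (flip Θ) u v
  flip-D₂ Θ = flip-cov (λ (k , k′) → K-swap k , K-swap k′) Θ

  onθ : ∀ Θ {v} → v ∈ vertices Θ → D Θ v
  onθ (θ {A = A} {B} p q r (x , y , z) _ _) v∈ with ∈-++⁻ A v∈
  ... | inj₁ i = [ (λ { refl → onX (Kₗ x) }) , onA ]′ (on-path p i)
  ... | inj₂ v∈′ with ∈-++⁻ B v∈′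
  ...   | inj₁ i = [ (λ { refl → onX (Kᵣ x) }) , onB ]′ (on-path q i)
  ...   | inj₂ i = [ (λ { refl → onX (K₃ (~-sym z) (~-sym y)) }) , onC ]′ (on-path r i)

  closed-walk : ∀ Θ {s L t} → Path s L t → t ~ s → Unique L → (∀ {v} → D Θ v → Vis L v) → Goal Θ
  closed-walk Θ p c u full with absorb nd p u
  ... | _ , p′ , u′ , g = cycle p′ c u′ , g ∘ full

  -- The path a₁ … b₁ b₃ … a₃ a₂ … b₂ uses every path and both triangles.
  module Route {a₁ a₂ a₃ b₁ b₂ b₃ A B C} (p : Path a₁ A b₁) (q : Path a₂ B b₂) (r : Path a₃ C b₃)
    (tri : Triangle a₁ a₂ a₃) (tri′ : Triangle b₁ b₂ b₃) (u : Unique (A ++ B ++ C)) where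

    private
      Θ : Theta
      Θ = θ p q r tri tri′ u

    route : Path a₁ (A ++ reverse C ++ B) b₂
    route = join p (proj₂ (proj₂ tri′)) (join (rev r) (~-sym (proj₁ (proj₂ tri))) q)

    route-↭ : A ++ reverse C ++ B ↭ A ++ B ++ C
    route-↭ = ↭-trans (++⁺ˡ A (++⁺ʳ B (↭-reverse C))) (solve 3 (λ a b c → a ⊕ (c ⊕ b) ⊜ a ⊕ (b ⊕ c)) ↭-refl A B C)

    route-vis : ∀ {v} → D Θ v → Vis (A ++ reverse C ++ B) v
    route-vis (onA x) = any-++ˡ _ x
    route-vis (onB x) = any-++ʳ A (any-++ʳ (reverse C) x)
    route-vis (onC x) = any-++ʳ A (any-++ˡ B (any-reverse K-swap r x))
    route-vis (onX x) = any-++ʳ A (any-join (rev r) q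
      (K-move (proj₁ tri) (K₃ (~-sym (proj₂ (proj₂ tri))) (~-sym (proj₁ (proj₂ tri)))) (Kᵣ (proj₁ tri)) x))
    route-vis (onY x) = any-join p (join (rev r) (~-sym (proj₁ (proj₂ tri))) q)
      (K-move (proj₁ tri′) (Kₗ (proj₁ tri′)) (K₃ (~-sym (proj₂ (proj₂ tri′))) (~-sym (proj₁ (proj₂ tri′)))) x)

    route-close : b₂ ~ a₁ → Goal Θ
    route-close e = closed-walk Θ route e (unique-↭ (↭-sym route-↭) u) route-vis

    route-ore : Ore a₁ b₂ → Goal Θ
    route-ore big with absorb nd route (unique-↭ (↭-sym route-↭) u)
    ... | L , p′ , u′ , g with Degrees.ore F a₁ b₂ p′ u′ big
    ...   | C , h = C , h ∘ g ∘ route-vis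

  -- Pendant candidates at a triangle

  -- The start of a path that cannot be shortened: a single edge whose clique has a vertex m visited by
  -- nothing else, or a chordless beginning.  In both cases there is a candidate for a pendant vertex of a net.
  data Front (X Rest : V → Set) {a b : V} : {A : List V} → Path a A b → Set where
    short : ∀ {e : a ~ b} {m} → K a b m → ¬ Rest m → Front X Rest (e ∷ one)
    long  : ∀ {a′ a″ R} {e : a ~ a′} {e′ : a′ ~ a″} {p : Path a″ R b} →
            ¬ X a′ → ¬ a ~ a″ → Front X Rest (e ∷ (e′ ∷ p))

  front-map : ∀ {X Rest X′ Rest′ : V → Set} → (∀ {v} → X′ v → X v) → (∀ {v} → Rest′ v → Rest v) →
              ∀ {a b A} {p : Path a A b} → Front X Rest p → Front X′ Rest′ p
  front-map f g (short k ¬r) = short k (¬r ∘ g)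
  front-map f g (long ¬x ¬e) = long (¬x ∘ f) ¬e

  tail : ∀ {X Rest a b A} {p : Path a A b} → Front X Rest p → V
  tail (short {m = m} _ _)  = m
  tail (long {a′ = a′} _ _) = a′

  Rest : (a₁ a₂ b₁ b₂ : V) → List V → List V → V → Set
  Rest a₁ a₂ b₁ b₂ L M v = Vis L v ⊎ Vis M v ⊎ K a₁ a₂ v ⊎ K b₁ b₂ v

  Rest? : ∀ a₁ a₂ b₁ b₂ L M v → Dec (Rest a₁ a₂ b₁ b₂ L M v)
  Rest? a₁ a₂ b₁ b₂ L M v =
    anyEdge? (λ p q → K? p q v) L ⊎-dec (anyEdge? (λ p q → K? p q v) M ⊎-dec (K? a₁ a₂ v ⊎-dec K? b₁ b₂ v))

  front : ∀ {a₁ a₂ a₃ b₁ b₂ b₃ A B C} (p : Path a₁ A b₁) (q : Path a₂ B b₂) (r : Path a₃ C b₃)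
    (tri : Triangle a₁ a₂ a₃) (tri′ : Triangle b₁ b₂ b₃) (u : Unique (A ++ B ++ C)) →
    IH (θ p q r tri tri′ u) → Goal (θ p q r tri tri′ u) ⊎ Front (K a₁ a₂) (Rest a₁ a₂ b₁ b₂ B C) p
  front {A = A} {B} {C} one q r (e , f , g) (e′ , f′ , g′) u ih =
    inj₁ (closed-walk Θ (join q f′ (join (rev r) (~-sym g) one)) e (unique-↭ (↭-sym π) u) full)
    where
    Θ : Theta
    Θ = θ one q r (e , f , g) (e′ , f′ , g′) u
    π : B ++ reverse C ++ _ ∷ [] ↭ A ++ B ++ C
    π = ↭-trans (++⁺ˡ B (++⁺ʳ _ (↭-reverse C))) (solve 3 (λ a b c → b ⊕ (c ⊕ a) ⊜ a ⊕ (b ⊕ c)) ↭-refl A B C)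
    full : ∀ {v} → D Θ v → Vis (B ++ reverse C ++ _ ∷ []) v
    full (onA (tl ()))
    full (onB x) = any-++ˡ _ x
    full (onC x) = any-++ʳ B (any-++ˡ _ (any-reverse K-swap r x))
    full (onX x) = any-++ʳ B (any-join (rev r) one (K-move e (K₃ (~-sym g) (~-sym f)) (Kₗ e) x))
    full (onY x) = any-join q (join (rev r) (~-sym g) one) (K-move e′ (Kᵣ e′) (K₃ (~-sym g′) (~-sym f′)) x)
  front {a₁} {a₂} {a₃} {b₁} {b₂} {b₃} {B = B} {C} (d ∷ one) q r (e , f , g) (e′ , f′ , g′) u ih
    with anyFin? (λ m → K? a₁ b₁ m ×-dec ¬? (Rest? a₁ a₂ b₁ b₂ B C m))
  ... | yes (m , k , ¬r) = inj₂ (short k ¬r)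
  ... | no none = inj₁ (closed-walk Θ (e ∷ join q (~-sym e′) (g′ ∷ rev r)) (~-sym g) (unique-↭ (↭-sym π) u) full)
    where
    Θ : Theta
    Θ = θ (d ∷ one) q r (e , f , g) (e′ , f′ , g′) u
    L = a₁ ∷ B ++ b₁ ∷ reverse C
    π : a₁ ∷ B ++ b₁ ∷ reverse C ↭ a₁ ∷ b₁ ∷ B ++ C
    π = prep a₁ (↭-trans (++⁺ˡ B (prep b₁ (↭-reverse C))) (solve 3 (λ a b c → b ⊕ (a ⊕ c) ⊜ a ⊕ (b ⊕ c)) ↭-refl (b₁ ∷ []) B C))
    rest : ∀ {v} → Rest a₁ a₂ b₁ b₂ B C v → Vis L v
    rest (inj₁ x) = tl (any-++ˡ _ x)
    rest (inj₂ (inj₁ x)) = tl (any-++ʳ B (tl (any-reverse K-swap r x)))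
    rest (inj₂ (inj₂ (inj₁ x))) = any-∷ (join q (~-sym e′) (g′ ∷ rev r)) x
    rest (inj₂ (inj₂ (inj₂ x))) = tl (any-join q (g′ ∷ rev r) (K-swap x))
    full : ∀ {v} → D Θ v → Vis L v
    full {v} (onA (hd k)) = by (Rest? a₁ a₂ b₁ b₂ B C v)
      where
      by : Dec (Rest a₁ a₂ b₁ b₂ B C v) → Vis L v
      by (yes x) = rest x
      by (no ¬x) = contradiction (v , k , ¬x) none
    full (onA (tl (tl ())))
    full (onB x) = rest (inj₁ x)
    full (onC x) = rest (inj₂ (inj₁ x))
    full (onX x) = rest (inj₂ (inj₂ (inj₁ x)))
    full (onY x) = rest (inj₂ (inj₂ (inj₂ x)))
  front {a₁} {a₂} {a₃} {A = A} {B} {C} (_∷_ {w = a′} d (_∷_ {w = a″} d′ p)) q r (e , f , g) tri′ u ih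
    with K? a₁ a₂ a′ | a₁ ~? a″
  ... | no ¬x | no ¬e = inj₂ (long ¬x ¬e)
  ... | yes x | _ = inj₁ (improve {Θ} {Θ′} ih (smaller ⊆ ≤-refl))
    where
    a′∈ : a′ ∈ A
    a′∈ = there (here refl)
    a′~a₂ : a′ ~ a₂
    a′~a₂ = ≃⇒~ (disjoint A u a′∈ (∈-++⁺ˡ (start∈ q))) (proj₂ x)
    a′~a₃ : a′ ~ a₃
    a′~a₃ = ≃⇒~ (disjoint A u a′∈ (∈-++⁺ʳ B (start∈ r))) (nd e x (K₃ (~-sym g) (~-sym f)))
    Θ Θ′ : Theta
    Θ = θ (d ∷ (d′ ∷ p)) q r (e , f , g) tri′ u
    Θ′ = θ (d′ ∷ p) q r (a′~a₂ , f , a′~a₃) tri′ (unique-++ʳ (a₁ ∷ []) u)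
    ⊆ : ∀ {v} → D Θ v → D Θ′ v
    ⊆ (onA (hd k)) = onX (K-move d (Kᵣ d) (K₃ (~-sym e) (~-sym a′~a₂)) k)
    ⊆ (onA (tl k)) = onA k
    ⊆ (onB k) = onB k
    ⊆ (onC k) = onC k
    ⊆ (onX k) = onX (K-move e x (Kᵣ e) k)
    ⊆ (onY k) = onY k
  ... | no _ | yes d″ = inj₁ (improve {Θ} {Θ′} ih (smaller ⊆ ≤-refl))
    where
    Θ Θ′ : Theta
    Θ = θ (d ∷ (d′ ∷ p)) q r (e , f , g) tri′ u
    Θ′ = θ (d″ ∷ p) q r (e , f , g) tri′ (unique-++ʳ (a′ ∷ []) (unique-↭ (solve 3 (λ a b c → a ⊕ (b ⊕ c) ⊜ b ⊕ (a ⊕ c)) ↭-refl (a₁ ∷ []) (a′ ∷ []) _) u))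
    ⊆ : ∀ {v} → D Θ v → D Θ′ v
    ⊆ (onA (hd k)) = onA (any-∷ p (K-move d (Kₗ d) (K₃ (~-sym d″) (~-sym d′)) k))
    ⊆ (onA (tl k)) with any-∷⁻ p k
    ... | inj₁ k′ = onA (any-∷ p (K-move d′ (K₃ d d″) (Kᵣ d′) k′))
    ... | inj₂ k′ = onA (tl k′)
    ⊆ (onB k) = onB k
    ⊆ (onC k) = onC k
    ⊆ (onX k) = onX k
    ⊆ (onY k) = onY k

  -- Moving the centre when two pendant candidates are adjacent

  record CrossData : Set where
    field
      {a₁ a₁′ a₁″ a₂ a₂′ a₂″ a₃ b₁ b₂ b₃} : V
      {R₁ R₂ C} : List V
      d₁   : a₁ ~ a₁′
      d₁′  : a₁′ ~ a₁″
      p₁   : Path a₁″ R₁ b₁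
      d₂   : a₂ ~ a₂′
      d₂′  : a₂′ ~ a₂″
      p₂   : Path a₂″ R₂ b₂
      r    : Path a₃ C b₃
      e    : a₁ ~ a₂
      f    : a₂ ~ a₃
      g    : a₁ ~ a₃
      tri′ : Triangle b₁ b₂ b₃
      u    : Unique ((a₁ ∷ a₁′ ∷ R₁) ++ (a₂ ∷ a₂′ ∷ R₂) ++ C)
      ih   : IH (θ (d₁ ∷ (d₁′ ∷ p₁)) (d₂ ∷ (d₂′ ∷ p₂)) r (e , f , g) tri′ u)
      ¬X₁  : ¬ K a₁ a₂ a₁′
      ¬s₁  : ¬ a₁ ~ a₁″
      ¬X₂  : ¬ K a₁ a₂ a₂′
      ¬s₂  : ¬ a₂ ~ a₂″
      c    : a₁′ ~ a₂′

  module Cross (cd : CrossData) where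

    open CrossData cd

    private
      A B : List V
      A = a₁ ∷ a₁′ ∷ R₁
      B = a₂ ∷ a₂′ ∷ R₂

    Θ : Theta
    Θ = θ (d₁ ∷ (d₁′ ∷ p₁)) (d₂ ∷ (d₂′ ∷ p₂)) r (e , f , g) tri′ u

    dis₁₂ : ∀ {x y} → x ∈ A → y ∈ B → x ≢ y
    dis₁₂ x∈ y∈ = disjoint A u x∈ (∈-++⁺ˡ y∈)
    dis₂₃ : ∀ {x y} → x ∈ B → y ∈ C → x ≢ y
    dis₂₃ = disjoint B (unique-++ʳ A u)

    a₁≢a₁″ : a₁ ≢ a₁″
    a₁≢a₁″ = head≢ (unique-++ˡ A u) (there (start∈ p₁))
    a₂≢a₂″ : a₂ ≢ a₂″
    a₂≢a₂″ = head≢ (unique-++ˡ B (unique-++ʳ A u)) (there (start∈ p₂))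

    a₁≄a₂′ : ¬ a₁ ≃ a₂′
    a₁≄a₂′ h = ¬X₂ (≃-sym h , inj₂ (~-sym d₂))
    a₂≄a₁′ : ¬ a₂ ≃ a₁′
    a₂≄a₁′ h = ¬X₁ (inj₂ (~-sym d₁) , ≃-sym h)

    -- Claw-freeness at `a₁′` with leaf `a₁`. Together with `j₂` and `j₃` it puts the second and
    -- third vertices of both paths into one clique, the place for a new triangle.
    j₁ : a₁″ ~ a₂′
    j₁ with nc (~-sym d₁) d₁′ c
    ... | inj₁ h        = contradiction (≃⇒~ a₁≢a₁″ h) ¬s₁
    ... | inj₂ (inj₁ h) = ≃⇒~ (dis₁₂ (there (there (start∈ p₁))) (there (here refl))) h
    ... | inj₂ (inj₂ h) = contradiction h a₁≄a₂′

    j₂ : a₂″ ~ a₁′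
    j₂ with nc (~-sym d₂) d₂′ (~-sym c)
    ... | inj₁ h        = contradiction (≃⇒~ a₂≢a₂″ h) ¬s₂
    ... | inj₂ (inj₁ h) = ≃⇒~ (dis₁₂ (there (here refl)) (there (there (start∈ p₂))) ∘ ≡-sym) h
    ... | inj₂ (inj₂ h) = contradiction h a₂≄a₁′

    j₃ : a₁″ ~ a₂″
    j₃ = ≃⇒~ (dis₁₂ (there (there (start∈ p₁))) (there (there (start∈ p₂)))) (nd c (K₃ (~-sym d₁′) j₁) (K₃ j₂ (~-sym d₂′)))

    π₂ : a₂ ∷ a₂′ ∷ (R₁ ++ R₂ ++ (a₁′ ∷ a₁ ∷ C)) ↭ A ++ B ++ C
    π₂ = solve 7 (λ x x′ r y y′ s c → y ⊕ (y′ ⊕ (r ⊕ (s ⊕ (x′ ⊕ (x ⊕ c))))) ⊜ (x ⊕ (x′ ⊕ r)) ⊕ ((y ⊕ (y′ ⊕ s)) ⊕ c)) ↭-refl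
           (a₁ ∷ []) (a₁′ ∷ []) R₁ (a₂ ∷ []) (a₂′ ∷ []) R₂ C

    -- The triangle moves to `a₁″`, `a₂″`, `a₁′`; the third path takes over `a₁′` and `a₁`, and
    -- `a₂`, `a₂′` are dropped.
    Θ₂ : Theta
    Θ₂ = θ p₁ p₂ (~-sym d₁ ∷ (g ∷ r)) (j₃ , j₂ , ~-sym d₁′) tri′ (unique-++ʳ (a₂ ∷ a₂′ ∷ []) (unique-↭ (↭-sym π₂) u))

    -- Moving the centre loses nothing but the clique of a₂a₂′.
    cover : ∀ {Φ} → ClosedΦ Φ → Cov Φ Θ → Cov Φ Θ₂ ⊎ Φ a₂ a₂′
    cover cl (onA (hd φ)) = inj₁ (onC (hd (cl d₁ (Kᵣ d₁) (Kₗ d₁) φ)))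
    cover cl (onA (tl x)) with any-∷⁻ p₁ x
    ... | inj₁ φ = inj₁ (onX (cl d₁′ (Kᵣ d₁′) (K₃ j₂ (~-sym j₃)) φ))
    ... | inj₂ y = inj₁ (onA y)
    cover cl (onB (hd φ)) = inj₂ φ
    cover cl (onB (tl x)) with any-∷⁻ p₂ x
    ... | inj₁ φ = inj₁ (onX (cl d₂′ (K₃ j₁ j₃) (Kᵣ d₂′) φ))
    ... | inj₂ y = inj₁ (onB y)
    cover cl (onC x) = inj₁ (onC (tl (tl x)))
    cover cl (onX φ) = inj₁ (onC (tl (any-∷ r (cl e (Kₗ e) (K₃ (~-sym g) (~-sym f)) φ))))
    cover cl (onY φ) = inj₁ (onY φ)

    -- If moving the centre loses a vertex `m`, then `m` replaces `a₂′` as pendant vertex at `a₂`.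
    -- The old theta visits `m` only through the clique of `a₂` and `a₂′`, which keeps `m` away from
    -- the other candidates.
    record Extra : Set where
      field
        {m}   : V
        k     : K a₂ a₂′ m
        a₂~m  : a₂ ~ m
        ¬Xm   : ¬ K a₁ a₂ m
        ¬a₁′  : ¬ m ≃ a₁′
        ¬C    : ¬ Vis C m
        fresh : m ∉ vertices Θ
        only  : ∀ {v} → D₂ Θ m v → K a₂ a₂′ v

    extra : Goal Θ ⊎ Extra
    extra with anyFin? (λ m → K? a₂ a₂′ m ×-dec ¬? (D? Θ₂ m))
    ... | no none = inj₁ (improve {Θ} {Θ₂} ih (smaller ⊆ lt))
      where
      ⊆ : ∀ {v} → D Θ v → D Θ₂ v
      ⊆ {v} d with cover K-closed d
      ... | inj₁ d′ = d′
      ... | inj₂ k with D? Θ₂ v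
      ...   | yes d′ = d′
      ...   | no ¬d  = contradiction (v , k , ¬d) none
      lt : size Θ₂ < size Θ
      lt = ≤-trans (n≤1+n _) (≤-reflexive (↭-length π₂))
    ... | yes (m , k , ¬d) = inj₂ (record
      { k = k ; a₂~m = ~-sym (≃⇒~ (λ { refl → a₂-cov ¬d }) (proj₁ k)) ; ¬Xm = ¬Xm
      ; ¬a₁′ = λ h → ¬d (onX (K-move c (K₃ (~-sym d₁′) j₁) (K₃ j₂ (~-sym d₂′)) (h , proj₂ k)))
      ; ¬C = λ x → ¬d (onC (tl (tl x)))
      ; fresh = λ m∈ → fresh (∈-resp-↭ (↭-sym π₂) m∈)
      ; only = λ h → [ (λ d′ → contradiction (cov-map proj₁ Θ₂ d′) ¬d) , proj₂ ]′ (cover K₂-closed h) })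
      where
      ¬Xm : ¬ K a₁ a₂ m
      ¬Xm x = ¬d (onC (tl (any-∷ r (K-move e (Kₗ e) (K₃ (~-sym g) (~-sym f)) x))))
      a₂-cov : ¬ D Θ₂ a₂ → ⊥
      a₂-cov ¬d = ¬d (onC (tl (any-∷ r (K₃ (~-sym e) f))))
      fresh : m ∈ a₂ ∷ a₂′ ∷ vertices Θ₂ → ⊥
      fresh (here refl) = a₂-cov ¬d
      fresh (there (here refl)) = ¬d (onX (K₃ (~-sym j₁) d₂′))
      fresh (there (there m∈)) = ¬d (onθ Θ₂ m∈)

  -- Claw-freeness at `a′`: since `a` and `a″` are not adjacent, `t` sees one of them and so lies in
  -- the clique of an edge at `a′`.
  near : ∀ {a a′ a″ b R t} (d : a ~ a′) (d′ : a′ ~ a″) (p : Path a″ R b) → a ≢ a″ → ¬ a ~ a″ → a′ ~ t → Vis (a ∷ a′ ∷ R) t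
  near d d′ p ne ¬e h with nc (~-sym d) d′ h
  ... | inj₁ z        = contradiction (≃⇒~ ne z) ¬e
  ... | inj₂ (inj₁ z) = tl (any-∷ p (inj₂ (~-sym h) , ≃-sym z))
  ... | inj₂ (inj₂ z) = hd (≃-sym z , inj₂ (~-sym h))

  module CrossShort {a₁ a₁′ a₁″ a₂ a₂′ a₂″ a₃ b₁ b₂ b₃ R₁ R₂}
    (d₁ : a₁ ~ a₁′) (d₁′ : a₁′ ~ a₁″) (p₁ : Path a₁″ R₁ b₁)
    (d₂ : a₂ ~ a₂′) (d₂′ : a₂′ ~ a₂″) (p₂ : Path a₂″ R₂ b₂)
    (d₃ : a₃ ~ b₃) (e : a₁ ~ a₂) (f : a₂ ~ a₃) (g : a₁ ~ a₃) (e′ : b₁ ~ b₂) (f′ : b₂ ~ b₃) (g′ : b₁ ~ b₃)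
    (u : Unique ((a₁ ∷ a₁′ ∷ R₁) ++ (a₂ ∷ a₂′ ∷ R₂) ++ (a₃ ∷ b₃ ∷ [])))
    (ih : IH (θ (d₁ ∷ (d₁′ ∷ p₁)) (d₂ ∷ (d₂′ ∷ p₂)) (d₃ ∷ one) (e , f , g) (e′ , f′ , g′) u))
    (¬X₁ : ¬ K a₁ a₂ a₁′) (¬s₁ : ¬ a₁ ~ a₁″) (¬X₂ : ¬ K a₁ a₂ a₂′) (¬s₂ : ¬ a₂ ~ a₂″) (c : a₁′ ~ a₂′)
    {m₃ : V} (k₃ : K a₃ b₃ m₃) (¬r₃ : ¬ Rest a₁ a₂ b₁ b₂ (a₁ ∷ a₁′ ∷ R₁) (a₂ ∷ a₂′ ∷ R₂) m₃) where

    private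
      cd : CrossData
      cd = record { d₁ = d₁ ; d₁′ = d₁′ ; p₁ = p₁ ; d₂ = d₂ ; d₂′ = d₂′ ; p₂ = p₂ ; r = d₃ ∷ one ; e = e ; f = f ; g = g
                  ; tri′ = e′ , f′ , g′ ; u = u ; ih = ih ; ¬X₁ = ¬X₁ ; ¬s₁ = ¬s₁ ; ¬X₂ = ¬X₂ ; ¬s₂ = ¬s₂ ; c = c }

    open Cross cd

    private
      ¬A : ¬ Vis (a₁ ∷ a₁′ ∷ R₁) m₃
      ¬A = ¬r₃ ∘ inj₁
      ¬B : ¬ Vis (a₂ ∷ a₂′ ∷ R₂) m₃
      ¬B = ¬r₃ ∘ inj₂ ∘ inj₁
      ¬X : ¬ K a₁ a₂ m₃
      ¬X = ¬r₃ ∘ inj₂ ∘ inj₂ ∘ inj₁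
      ¬Y : ¬ K b₁ b₂ m₃
      ¬Y = ¬r₃ ∘ inj₂ ∘ inj₂ ∘ inj₂
      a₃~m₃ : a₃ ~ m₃
      a₃~m₃ = ~-sym (≃⇒~ (λ { refl → ¬X (K₃ (~-sym g) (~-sym f)) }) (proj₁ k₃))
      m₃~b₃ : m₃ ~ b₃
      m₃~b₃ = ≃⇒~ (λ { refl → ¬Y (K₃ (~-sym g′) (~-sym f′)) }) (proj₂ k₃)

      module _ (E : Extra) (h : Extra.m E ~ m₃) where
        open Extra E
        π : m ∷ m₃ ∷ vertices Θ ↭ a₂′ ∷ a₃ ∷ (R₁ ++ R₂ ++ (a₁′ ∷ a₁ ∷ a₂ ∷ m ∷ m₃ ∷ b₃ ∷ []))
        π = solve 10 (λ x x′ r y y′ s z b m m′ →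
              m ⊕ (m′ ⊕ ((x ⊕ (x′ ⊕ r)) ⊕ ((y ⊕ (y′ ⊕ s)) ⊕ (z ⊕ b)))) ⊜ y′ ⊕ (z ⊕ (r ⊕ (s ⊕ (x′ ⊕ (x ⊕ (y ⊕ (m ⊕ (m′ ⊕ b)))))))))
              ↭-refl (a₁ ∷ []) (a₁′ ∷ []) R₁ (a₂ ∷ []) (a₂′ ∷ []) R₂ (a₃ ∷ []) (b₃ ∷ []) (m ∷ []) (m₃ ∷ [])
        m₃∉ : m₃ ∉ vertices Θ
        m₃∉ m∈ with onθ Θ m∈
        ... | onA x = ¬A x
        ... | onB x = ¬B x
        ... | onX x = ¬X x
        ... | onY x = ¬Y x
        ... | onC _ with ∈-++⁻ (a₁ ∷ a₁′ ∷ R₁) m∈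
        ...   | inj₁ i with on-path (d₁ ∷ (d₁′ ∷ p₁)) i
        ...     | inj₁ refl = ¬X (Kₗ e)
        ...     | inj₂ x    = ¬A x
        m₃∉ m∈ | onC _ | inj₂ i with ∈-++⁻ (a₂ ∷ a₂′ ∷ R₂) i
        ... | inj₂ (here refl) = ~⇒≢ a₃~m₃ refl
        ... | inj₂ (there (here refl)) = ~⇒≢ m₃~b₃ refl
        ... | inj₁ i′ with on-path (d₂ ∷ (d₂′ ∷ p₂)) i′
        ...   | inj₁ refl = ¬X (Kᵣ e)
        ...   | inj₂ x    = ¬B x
        uniq : Unique (m ∷ m₃ ∷ vertices Θ)
        uniq = unique-∷ (λ { (here eq) → ~⇒≢ h eq ; (there i) → fresh i }) (unique-∷ m₃∉ u)
        Θ′ : Theta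
        -- The third path detours through `m` and `m₃`; in exchange `a₂′` and `a₃` are given up, so
        -- the size stays the same.
        Θ′ = θ p₁ p₂ (~-sym d₁ ∷ (e ∷ (a₂~m ∷ (h ∷ (m₃~b₃ ∷ one))))) (j₃ , j₂ , ~-sym d₁′) (e′ , f′ , g′)
               (unique-++ʳ (a₂′ ∷ a₃ ∷ []) (unique-↭ π uniq))
        ⊆ : ∀ {Φ} → ClosedΦ Φ → Cov Φ Θ → Cov Φ Θ′
        ⊆ cl (onA (hd φ)) = onC (hd (cl d₁ (Kᵣ d₁) (Kₗ d₁) φ))
        ⊆ cl (onA (tl x)) with any-∷⁻ p₁ x
        ... | inj₁ φ = onX (cl d₁′ (Kᵣ d₁′) (K₃ j₂ (~-sym j₃)) φ)
        ... | inj₂ y = onA y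
        ⊆ cl (onB (hd φ)) = onC (tl (tl (hd (cl d₂ (Kₗ d₂) k φ))))
        ⊆ cl (onB (tl x)) with any-∷⁻ p₂ x
        ... | inj₁ φ = onX (cl d₂′ (K₃ j₁ j₃) (Kᵣ d₂′) φ)
        ... | inj₂ y = onB y
        ⊆ cl (onC (hd φ)) = onC (tl (tl (tl (tl (hd (cl d₃ k₃ (Kᵣ d₃) φ))))))
        ⊆ cl (onC (tl (tl ())))
        ⊆ cl (onX φ) = onC (tl (hd φ))
        ⊆ cl (onY φ) = onY φ
        ¬both : ¬ D₂ Θ m m₃
        ¬both d with only d
        ... | k′ = ¬B (hd k′)

        -- The clique of m m₃ is visited by Θ′ but not by Θ.
        richer-short : Goal Θ
        richer-short = improve {Θ} {Θ′} ih (richer (⊆ K₂-closed) (≤-reflexive (suc-injective (suc-injective (≡-sym (↭-length π))))) m m₃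
          (onC (tl (tl (tl (hd (Kₗ h , Kᵣ h)))))) ¬both)

    crossShort : Goal Θ ⊎ Tails a₁ a₂ a₃
    crossShort with extra
    ... | inj₁ goal = inj₁ goal
    ... | inj₂ E with Extra.m E ~? m₃
    ...   | yes h = inj₁ (richer-short E h)
    ...   | no ¬h = inj₂ (tails d₁ (Extra.a₂~m E) a₃~m₃ ¬X₁ (Extra.¬Xm E) ¬X (Extra.¬a₁′ E ∘ ≃-sym ∘ inj₂)
              (¬A ∘ near d₁ d₁′ p₁ a₁≢a₁″ ¬s₁) ¬h)

  module CrossLong {a₁ a₁′ a₁″ a₂ a₂′ a₂″ a₃ a₃′ a₃″ b₁ b₂ b₃ R₁ R₂ R₃}
    (d₁ : a₁ ~ a₁′) (d₁′ : a₁′ ~ a₁″) (p₁ : Path a₁″ R₁ b₁)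
    (d₂ : a₂ ~ a₂′) (d₂′ : a₂′ ~ a₂″) (p₂ : Path a₂″ R₂ b₂)
    (d₃ : a₃ ~ a₃′) (d₃′ : a₃′ ~ a₃″) (p₃ : Path a₃″ R₃ b₃)
    (e : a₁ ~ a₂) (f : a₂ ~ a₃) (g : a₁ ~ a₃) (tri′ : Triangle b₁ b₂ b₃)
    (u : Unique ((a₁ ∷ a₁′ ∷ R₁) ++ (a₂ ∷ a₂′ ∷ R₂) ++ (a₃ ∷ a₃′ ∷ R₃)))
    (ih : IH (θ (d₁ ∷ (d₁′ ∷ p₁)) (d₂ ∷ (d₂′ ∷ p₂)) (d₃ ∷ (d₃′ ∷ p₃)) (e , f , g) tri′ u))
    (¬X₁ : ¬ K a₁ a₂ a₁′) (¬s₁ : ¬ a₁ ~ a₁″) (¬X₂ : ¬ K a₁ a₂ a₂′) (¬s₂ : ¬ a₂ ~ a₂″)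
    (¬X₃ : ¬ K a₁ a₂ a₃′) (¬s₃ : ¬ a₃ ~ a₃″) (c : a₁′ ~ a₂′) where

    private
      cd : CrossData
      cd = record { d₁ = d₁ ; d₁′ = d₁′ ; p₁ = p₁ ; d₂ = d₂ ; d₂′ = d₂′ ; p₂ = p₂ ; r = d₃ ∷ (d₃′ ∷ p₃) ; e = e ; f = f ; g = g
                  ; tri′ = tri′ ; u = u ; ih = ih ; ¬X₁ = ¬X₁ ; ¬s₁ = ¬s₁ ; ¬X₂ = ¬X₂ ; ¬s₂ = ¬s₂ ; c = c }

    open Cross cd

    private
      A B C : List V
      A = a₁ ∷ a₁′ ∷ R₁
      B = a₂ ∷ a₂′ ∷ R₂
      C = a₃ ∷ a₃′ ∷ R₃

      a₃∈X : K a₁ a₂ a₃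
      a₃∈X = K₃ (~-sym g) (~-sym f)

      X⇒X₃ : ∀ {v} → K a₁ a₂ v → K a₁ a₃ v
      X⇒X₃ = K-move e (Kₗ e) a₃∈X

      X₃⇒X : ∀ {v} → K a₁ a₃ v → K a₁ a₂ v
      X₃⇒X = K-move g (Kₗ g) (K₃ (~-sym e) f)

      a₃≢a₃″ : a₃ ≢ a₃″
      a₃≢a₃″ = head≢ (unique-++ʳ B (unique-++ʳ A u)) (there (start∈ p₃))

      πσ : A ++ B ++ C ↭ A ++ C ++ B
      πσ = solve 3 (λ a b c → a ⊕ (b ⊕ c) ⊜ a ⊕ (c ⊕ b)) ↭-refl A B C

      module _ (c₃ : a₁′ ~ a₃′) where

        cdσ : CrossData
        cdσ = record { d₁ = d₁ ; d₁′ = d₁′ ; p₁ = p₁ ; d₂ = d₃ ; d₂′ = d₃′ ; p₂ = p₃ ; r = d₂ ∷ (d₂′ ∷ p₂) ; e = g ; f = ~-sym f ; g = e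
                     ; tri′ = proj₂ (proj₂ tri′) , ~-sym (proj₁ (proj₂ tri′)) , proj₁ tri′ ; u = unique-↭ πσ u
                     ; ih = transport-IH {Θ} (sw₂₃-⊑ Θ) (≤-reflexive (≡-sym (↭-length πσ))) ih
                     ; ¬X₁ = ¬X₁ ∘ X₃⇒X ; ¬s₁ = ¬s₁ ; ¬X₂ = ¬X₃ ∘ X₃⇒X ; ¬s₂ = ¬s₃ ; c = c₃ }

        σj₁ : a₁″ ~ a₃′
        σj₁ = Cross.j₁ cdσ
        σj₂ : a₃″ ~ a₁′
        σj₂ = Cross.j₂ cdσ

        -- Claw-freeness at `a₁′` with leaf `a₁` merges the cliques of the two crossings into one.
        a₂′~a₃′ : a₂′ ~ a₃′
        a₂′~a₃′ with nc (~-sym d₁) c c₃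
        ... | inj₁ h        = contradiction h a₁≄a₂′
        ... | inj₂ (inj₁ h) = ≃⇒~ (dis₂₃ (there (here refl)) (there (here refl))) h
        ... | inj₂ (inj₂ h) = contradiction h (Cross.a₁≄a₂′ cdσ)

        k₂″ : K a₁′ a₂′ a₂″
        k₂″ = K₃ j₂ (~-sym d₂′)
        k₃′ : K a₁′ a₂′ a₃′
        k₃′ = K₃ (~-sym c₃) (~-sym a₂′~a₃′)
        k₃″ : K a₁′ a₂′ a₃″
        k₃″ = inj₂ σj₂ , nd c₃ (K₃ σj₂ (~-sym d₃′)) (K₃ (~-sym c) a₂′~a₃′)

        a₂″~a₃″ : a₂″ ~ a₃″
        a₂″~a₃″ = ≃⇒~ (dis₂₃ (there (there (start∈ p₂))) (there (there (start∈ p₃)))) (nd c k₂″ k₃″)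

        module _ (E : Extra) (E₃ : Cross.Extra cdσ) (h : Extra.m E ~ Cross.Extra.m E₃) where
          open Extra E
          open Cross.Extra E₃ using () renaming (m to m₃; k to k₃; a₂~m to a₃~m₃; ¬Xm to ¬Xm₃; fresh to fresh₃)
          m₃∉ : m₃ ∉ vertices Θ
          m₃∉ = fresh₃ ∘ ∈-resp-↭ πσ
          m₃~a₃′ : m₃ ~ a₃′
          m₃~a₃′ = ≃⇒~ (λ eq → m₃∉ (∈-++⁺ʳ A (∈-++⁺ʳ B (there (here eq))))) (proj₂ k₃)
          π : m ∷ m₃ ∷ vertices Θ ↭ a₂′ ∷ a₃ ∷ ((a₁′ ∷ a₁ ∷ a₂ ∷ m ∷ m₃ ∷ a₃′ ∷ R₁) ++ R₂ ++ R₃)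
          π = solve 11 (λ x x′ r y y′ s z z′ t m m′ →
                m ⊕ (m′ ⊕ ((x ⊕ (x′ ⊕ r)) ⊕ ((y ⊕ (y′ ⊕ s)) ⊕ (z ⊕ (z′ ⊕ t)))))
                ⊜ y′ ⊕ (z ⊕ ((x′ ⊕ (x ⊕ (y ⊕ (m ⊕ (m′ ⊕ (z′ ⊕ r)))))) ⊕ (s ⊕ t))))
                ↭-refl (a₁ ∷ []) (a₁′ ∷ []) R₁ (a₂ ∷ []) (a₂′ ∷ []) R₂ (a₃ ∷ []) (a₃′ ∷ []) R₃ (m ∷ []) (m₃ ∷ [])
          Θ′ : Theta
          -- The triangle moves into the common clique of the crossings, and the first path collects
          -- all three former cliques of aᵢaᵢ′ on its way; `m`, `m₃` replace `a₂′`, `a₃`, so the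
          -- size is unchanged.
          Θ′ = θ (~-sym d₁ ∷ (e ∷ (a₂~m ∷ (h ∷ (m₃~a₃′ ∷ (~-sym σj₁ ∷ p₁)))))) p₂ p₃
                 (~-sym j₂ , a₂″~a₃″ , ~-sym σj₂) tri′
                 (unique-++ʳ (a₂′ ∷ a₃ ∷ []) (unique-↭ π (unique-∷ (λ { (here eq) → ~⇒≢ h eq ; (there i) → fresh i }) (unique-∷ m₃∉ u))))
          ⊆ : ∀ {Φ} → ClosedΦ Φ → Cov Φ Θ → Cov Φ Θ′
          ⊆ cl (onA (hd φ)) = onA (hd (cl d₁ (Kᵣ d₁) (Kₗ d₁) φ))
          ⊆ cl (onA (tl x)) with any-∷⁻ p₁ x
          ... | inj₁ φ = onA (tl (tl (tl (tl (tl (any-∷ p₁ (cl d₁′ (K₃ (~-sym c₃) (~-sym σj₁)) (Kᵣ d₁′) φ)))))))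
          ... | inj₂ y = onA (tl (tl (tl (tl (tl (tl y))))))
          ⊆ cl (onB (hd φ)) = onA (tl (tl (hd (cl d₂ (Kₗ d₂) k φ))))
          ⊆ cl (onB (tl x)) with any-∷⁻ p₂ x
          ... | inj₁ φ = onX (cl d₂′ (K₃ c (~-sym j₂)) (Kᵣ d₂′) φ)
          ... | inj₂ y = onB y
          ⊆ cl (onC (hd φ)) = onA (tl (tl (tl (tl (hd (cl d₃ k₃ (Kᵣ d₃) φ))))))
          ⊆ cl (onC (tl x)) with any-∷⁻ p₃ x
          ... | inj₁ φ = onX (cl d₃′ (K₃ c₃ (~-sym σj₂)) (nd c k₂″ k₃′ , inj₂ a₂″~a₃″) φ)
          ... | inj₂ y = onC y
          ⊆ cl (onX φ) = onA (tl (hd φ))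
          ⊆ cl (onY φ) = onY φ
          ¬both : ¬ D₂ Θ m m₃
          ¬both d = ¬Xm₃ (K-move f (K₃ e g) (Kᵣ f) (proj₁ (only d) , inj₂ (~-sym a₃~m₃)))

          richer-long : Goal Θ
          richer-long = improve {Θ} {Θ′} ih (richer (⊆ K₂-closed) (≤-reflexive (suc-injective (suc-injective (≡-sym (↭-length π))))) m m₃
            (onA (tl (tl (tl (hd (Kₗ h , Kᵣ h)))))) ¬both)

    -- If `a₁′` and `a₃′` are not adjacent, `a₃′` can stay: by `near`, adjacency to `m` would make
    -- the third path visit `m`. If they are adjacent, the crossing with the third path yields a
    -- substitute for `a₃′` as well.
    crossLong : Goal Θ ⊎ Tails a₁ a₂ a₃
    crossLong with extra
    ... | inj₁ goal = inj₁ goal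
    ... | inj₂ E with a₁′ ~? a₃′
    ...   | no ¬h = inj₂ (tails d₁ (Extra.a₂~m E) d₃ ¬X₁ (Extra.¬Xm E) ¬X₃ (Extra.¬a₁′ E ∘ ≃-sym ∘ inj₂) ¬h
              (Extra.¬C E ∘ near d₃ d₃′ p₃ a₃≢a₃″ ¬s₃ ∘ ~-sym))
    ...   | yes c₃ with Cross.extra (cdσ c₃)
    ...     | inj₁ goal = inj₁ (goal-mono {Θ} {sw₂₃ Θ} (sw₂₃-⊑ Θ K-closed) goal)
    ...     | inj₂ E₃ with Extra.m E ~? Cross.Extra.m E₃
    ...       | yes h = inj₁ (richer-long c₃ E E₃ h)
    ...       | no ¬h = inj₂ (tails d₁ (Extra.a₂~m E) (Cross.Extra.a₂~m E₃) ¬X₁ (Extra.¬Xm E) (Cross.Extra.¬Xm E₃ ∘ X⇒X₃)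
                (Extra.¬a₁′ E ∘ ≃-sym ∘ inj₂) (Cross.Extra.¬a₁′ E₃ ∘ ≃-sym ∘ inj₂) ¬h)

  sw₁₂-size : ∀ Θ → size (sw₁₂ Θ) ≤ size Θ
  sw₁₂-size (θ {A = A} {B} {C} _ _ _ _ _ _) = ≤-reflexive (↭-length (solve 3 (λ a b c → b ⊕ (a ⊕ c) ⊜ a ⊕ (b ⊕ c)) ↭-refl A B C))

  sw₂₃-size : ∀ Θ → size (sw₂₃ Θ) ≤ size Θ
  sw₂₃-size (θ {A = A} {B} {C} _ _ _ _ _ _) = ≤-reflexive (↭-length (solve 3 (λ a b c → a ⊕ (c ⊕ b) ⊜ a ⊕ (b ⊕ c)) ↭-refl A B C))

  sw₁₂-IH : ∀ Θ → IH Θ → IH (sw₁₂ Θ)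
  sw₁₂-IH Θ = transport-IH {Θ} (sw₁₂-⊑ Θ) (sw₁₂-size Θ)

  sw₂₃-IH : ∀ Θ → IH Θ → IH (sw₂₃ Θ)
  sw₂₃-IH Θ = transport-IH {Θ} (sw₂₃-⊑ Θ) (sw₂₃-size Θ)

  sw₁₂-goal : ∀ Θ → Goal (sw₁₂ Θ) → Goal Θ
  sw₁₂-goal Θ = goal-mono {Θ} {sw₁₂ Θ} (sw₁₂-⊑ Θ K-closed)

  sw₂₃-goal : ∀ Θ → Goal (sw₂₃ Θ) → Goal Θ
  sw₂₃-goal Θ = goal-mono {Θ} {sw₂₃ Θ} (sw₂₃-⊑ Θ K-closed)

  -- Two adjacent private vertices open a closed walk that omits only `b₁` and `a₂` yet visits every
  -- clique. A private vertex cannot be adjacent to the second vertex of a long path, by `near`. Two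
  -- long paths lead to a move of the centre.
  pair₁₂ : ∀ {a₁ a₂ a₃ b₁ b₂ b₃ A B C} (p : Path a₁ A b₁) (q : Path a₂ B b₂) (r : Path a₃ C b₃)
    (tri : Triangle a₁ a₂ a₃) (tri′ : Triangle b₁ b₂ b₃) (u : Unique (A ++ B ++ C)) → IH (θ p q r tri tri′ u) →
    (f₁ : Front (K a₁ a₂) (Rest a₁ a₂ b₁ b₂ B C) p) (f₂ : Front (K a₁ a₂) (Rest a₁ a₂ b₁ b₂ A C) q)
    (f₃ : Front (K a₁ a₂) (Rest a₁ a₂ b₁ b₂ A B) r) → tail f₁ ~ tail f₂ →
    Goal (θ p q r tri tri′ u) ⊎ Tails a₁ a₂ a₃
  pair₁₂ {a₁} {a₂} {a₃} {b₁} {b₂} {b₃} {C = C} (d₁ ∷ one) (d₂ ∷ one) r (e , f , g) (e′ , f′ , g′) u ih (short {m = m₁} k₁ ¬r₁) (short {m = m₂} k₂ ¬r₂) _ h =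
    inj₁ (closed-walk Θ (m₁~a₁ ∷ (g ∷ join r (~-sym f′) (b₂~m₂ ∷ one))) (~-sym h) (unique-++ʳ (b₁ ∷ a₂ ∷ []) (unique-↭ π uniq)) full)
    where
    Θ : Theta
    Θ = θ (d₁ ∷ one) (d₂ ∷ one) r (e , f , g) (e′ , f′ , g′) u
    m₁~a₁ : m₁ ~ a₁
    m₁~a₁ = ≃⇒~ (λ { refl → ¬r₁ (inj₂ (inj₂ (inj₁ (Kₗ e)))) }) (proj₁ k₁)
    b₂~m₂ : b₂ ~ m₂
    b₂~m₂ = ~-sym (≃⇒~ (λ { refl → ¬r₂ (inj₂ (inj₂ (inj₂ (Kᵣ e′)))) }) (proj₂ k₂))
    outside : ∀ {m} → ¬ Vis C m → ¬ K a₁ a₂ m → ¬ K b₁ b₂ m → m ∉ vertices Θ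
    outside ¬C ¬X ¬Y (here refl)                         = ¬X (Kₗ e)
    outside ¬C ¬X ¬Y (there (here refl))                 = ¬Y (Kₗ e′)
    outside ¬C ¬X ¬Y (there (there (here refl)))         = ¬X (Kᵣ e)
    outside ¬C ¬X ¬Y (there (there (there (here refl)))) = ¬Y (Kᵣ e′)
    outside ¬C ¬X ¬Y (there (there (there (there i)))) with on-path r i
    ... | inj₁ refl = ¬X (K₃ (~-sym g) (~-sym f))
    ... | inj₂ x    = ¬C x
    m₁∉ : m₁ ∉ vertices Θ
    m₁∉ = outside (¬r₁ ∘ inj₂ ∘ inj₁) (¬r₁ ∘ inj₂ ∘ inj₂ ∘ inj₁) (¬r₁ ∘ inj₂ ∘ inj₂ ∘ inj₂)
    m₂∉ : m₂ ∉ vertices Θ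
    m₂∉ = outside (¬r₂ ∘ inj₂ ∘ inj₁) (¬r₂ ∘ inj₂ ∘ inj₂ ∘ inj₁) (¬r₂ ∘ inj₂ ∘ inj₂ ∘ inj₂)
    uniq : Unique (m₁ ∷ m₂ ∷ vertices Θ)
    uniq = unique-∷ (λ { (here eq) → ~⇒≢ h eq ; (there i) → m₁∉ i }) (unique-∷ m₂∉ u)
    L : List V
    L = m₁ ∷ a₁ ∷ C ++ b₂ ∷ m₂ ∷ []
    π : m₁ ∷ m₂ ∷ vertices Θ ↭ b₁ ∷ a₂ ∷ L
    π = solve 7 (λ m m′ a b a′ b′ c → m ⊕ (m′ ⊕ (a ⊕ (b ⊕ (a′ ⊕ (b′ ⊕ c))))) ⊜ b ⊕ (a′ ⊕ (m ⊕ (a ⊕ (c ⊕ (b′ ⊕ m′)))))) ↭-refl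
          (m₁ ∷ []) (m₂ ∷ []) (a₁ ∷ []) (b₁ ∷ []) (a₂ ∷ []) (b₂ ∷ []) C
    full : ∀ {v} → D Θ v → Vis L v
    full (onA (hd k)) = hd (K-move d₁ k₁ (Kₗ d₁) k)
    full (onA (tl (tl ())))
    full (onB (hd k)) = tl (tl (any-++ʳ C (hd (K-move d₂ (Kᵣ d₂) k₂ k))))
    full (onB (tl (tl ())))
    full (onC x) = tl (tl (any-++ˡ _ x))
    full (onX x) = tl (any-∷ (join r (~-sym f′) (b₂~m₂ ∷ one)) (K-move e (Kₗ e) (K₃ (~-sym g) (~-sym f)) x))
    full (onY x) = tl (tl (any-join r (b₂~m₂ ∷ one) (K-move e′ (K₃ (~-sym g′) (~-sym f′)) (Kᵣ e′) x)))
  pair₁₂ {A = A} _ (d₂ ∷ (d₂′ ∷ q)) r tri tri′ u ih (short k₁ ¬r₁) (long _ ¬s₂) _ h =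
    contradiction (inj₁ (near d₂ d₂′ q (head≢ (unique-++ˡ _ (unique-++ʳ A u)) (there (start∈ q))) ¬s₂ (~-sym h))) ¬r₁
  pair₁₂ (d₁ ∷ (d₁′ ∷ p)) _ r tri tri′ u ih (long _ ¬s₁) (short k₂ ¬r₂) _ h =
    contradiction (inj₁ (near d₁ d₁′ p (head≢ (unique-++ˡ _ u) (there (start∈ p))) ¬s₁ h)) ¬r₂
  pair₁₂ (d₁ ∷ (d₁′ ∷ p)) (d₂ ∷ (d₂′ ∷ q)) (d₃ ∷ one) (e , f , g) (e′ , f′ , g′) u ih (long ¬X₁ ¬s₁) (long ¬X₂ ¬s₂) (short k₃ ¬r₃) h =
    CrossShort.crossShort d₁ d₁′ p d₂ d₂′ q d₃ e f g e′ f′ g′ u ih ¬X₁ ¬s₁ ¬X₂ ¬s₂ h k₃ ¬r₃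
  pair₁₂ (d₁ ∷ (d₁′ ∷ p)) (d₂ ∷ (d₂′ ∷ q)) (d₃ ∷ (d₃′ ∷ r)) (e , f , g) tri′ u ih (long ¬X₁ ¬s₁) (long ¬X₂ ¬s₂) (long ¬X₃ ¬s₃) h =
    CrossLong.crossLong d₁ d₁′ p d₂ d₂′ q d₃ d₃′ r e f g tri′ u ih ¬X₁ ¬s₁ ¬X₂ ¬s₂ ¬X₃ ¬s₃ h

  front-edge : ∀ {a₁ a₂ b₁ b₂ L M a b A} {p : Path a A b} → K a₁ a₂ a →
               (f : Front (K a₁ a₂) (Rest a₁ a₂ b₁ b₂ L M) p) → a ~ tail f
  front-edge k (short k₁ ¬r) = ~-sym (≃⇒~ (λ { refl → ¬r (inj₂ (inj₂ (inj₁ k))) }) (proj₁ k₁))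
  front-edge k (long {e = e} _ _) = e

  front-out : ∀ {a₁ a₂ b₁ b₂ L M a b A} {p : Path a A b} →
              (f : Front (K a₁ a₂) (Rest a₁ a₂ b₁ b₂ L M) p) → ¬ K a₁ a₂ (tail f)
  front-out (short _ ¬r) = ¬r ∘ inj₂ ∘ inj₂ ∘ inj₁
  front-out (long ¬x _)  = ¬x

  tail-map : ∀ {X Rest X′ Rest′ : V → Set} (i : ∀ {v} → X′ v → X v) (j : ∀ {v} → Rest′ v → Rest v) →
             ∀ {a b A} {p : Path a A b} (f : Front X Rest p) → tail (front-map {X} {Rest} {X′} {Rest′} i j f) ≡ tail f
  tail-map i j (short _ _) = refl
  tail-map i j (long _ _)  = refl

  rest-map : ∀ {a₁ a₂ b₁ b₂ a₁′ a₂′ b₁′ b₂′ L M} → (∀ {v} → K a₁ a₂ v → K a₁′ a₂′ v) → (∀ {v} → K b₁ b₂ v → K b₁′ b₂′ v) →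
             ∀ {v} → Rest a₁ a₂ b₁ b₂ L M v → Rest a₁′ a₂′ b₁′ b₂′ L M v
  rest-map i j (inj₁ x)               = inj₁ x
  rest-map i j (inj₂ (inj₁ x))        = inj₂ (inj₁ x)
  rest-map i j (inj₂ (inj₂ (inj₁ x))) = inj₂ (inj₂ (inj₁ (i x)))
  rest-map i j (inj₂ (inj₂ (inj₂ x))) = inj₂ (inj₂ (inj₂ (j x)))

  rest-swap : ∀ {a₁ a₂ b₁ b₂ L M v} → Rest a₁ a₂ b₁ b₂ L M v → Rest a₁ a₂ b₁ b₂ M L v
  rest-swap (inj₁ x)        = inj₂ (inj₁ x)
  rest-swap (inj₂ (inj₁ x)) = inj₁ x
  rest-swap (inj₂ (inj₂ x)) = inj₂ (inj₂ x)

  find-tails : ∀ {a₁ a₂ a₃ b₁ b₂ b₃ A B C} (p : Path a₁ A b₁) (q : Path a₂ B b₂) (r : Path a₃ C b₃)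
    (tri : Triangle a₁ a₂ a₃) (tri′ : Triangle b₁ b₂ b₃) (u : Unique (A ++ B ++ C)) → IH (θ p q r tri tri′ u) →
    Goal (θ p q r tri tri′ u) ⊎ Tails a₁ a₂ a₃
  find-tails {a₁} {a₂} {a₃} {b₁} {b₂} {b₃} {A} {B} {C} p q r tri@(e , f , g) tri′@(e′ , f′ , g′) u ih
    with front p q r tri tri′ u ih
       | front q p r (~-sym e , g , f) (~-sym e′ , g′ , f′) _ (sw₁₂-IH Θ ih)
       | front r p q (~-sym g , e , ~-sym f) (~-sym g′ , e′ , ~-sym f′) _ (sw₁₂-IH (sw₂₃ Θ) (sw₂₃-IH Θ ih))
    where
    Θ : Theta
    Θ = θ p q r tri tri′ u
  ... | inj₁ goal | _ | _ = inj₁ goal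
  ... | inj₂ _ | inj₁ goal | _ = inj₁ (sw₁₂-goal (θ p q r tri tri′ u) goal)
  ... | inj₂ _ | inj₂ _ | inj₁ goal = inj₁ (sw₂₃-goal (θ p q r tri tri′ u) (sw₁₂-goal (sw₂₃ (θ p q r tri tri′ u)) goal))
  ... | inj₂ f₁ | inj₂ f₂′ | inj₂ f₃′ = by (tail f₁ ~? tail f₂) (tail f₁ ~? tail f₃) (tail f₂ ~? tail f₃)
    where
    Θ : Theta
    Θ = θ p q r tri tri′ u
    x₁ : K a₁ a₂ a₁
    x₁ = Kₗ e
    x₂ : K a₁ a₂ a₂
    x₂ = Kᵣ e
    x₃ : K a₁ a₂ a₃
    x₃ = K₃ (~-sym g) (~-sym f)
    y₁ : K b₁ b₂ b₁
    y₁ = Kₗ e′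
    y₃ : K b₁ b₂ b₃
    y₃ = K₃ (~-sym g′) (~-sym f′)
    f₂ : Front (K a₁ a₂) (Rest a₁ a₂ b₁ b₂ A C) q
    f₂ = front-map K-swap (rest-map K-swap K-swap) f₂′
    f₃ : Front (K a₁ a₂) (Rest a₁ a₂ b₁ b₂ A B) r
    f₃ = front-map (K-move e x₃ x₁) (rest-map (K-move e x₃ x₁) (K-move e′ y₃ y₁)) f₃′
    by : Dec (tail f₁ ~ tail f₂) → Dec (tail f₁ ~ tail f₃) → Dec (tail f₂ ~ tail f₃) → Goal Θ ⊎ Tails a₁ a₂ a₃
    by (yes h) _ _ = pair₁₂ p q r tri tri′ u ih f₁ f₂ f₃ h
    by (no _) (yes h) _ with pair₁₂ p r q (g , ~-sym f , e) (g′ , ~-sym f′ , e′) _ (sw₂₃-IH Θ ih)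
          (front-map X′ (rest-swap ∘ rest-map X′ Y′) f₁)
          (front-map X′ (rest-map X′ Y′) f₃)
          (front-map X′ (rest-map X′ Y′) f₂)
          (subst₂ _~_ (≡-sym (tail-map X′ _ f₁)) (≡-sym (tail-map X′ _ f₃)) h)
      where
      X′ : ∀ {v} → K a₁ a₃ v → K a₁ a₂ v
      X′ = K-move g (Kₗ g) (K₃ (~-sym e) f)
      Y′ : ∀ {v} → K b₁ b₃ v → K b₁ b₂ v
      Y′ = K-move g′ (Kₗ g′) (K₃ (~-sym e′) f′)
    ... | inj₁ goal = inj₁ (sw₂₃-goal Θ goal)
    ... | inj₂ (tails t₁ t₃ t₂ o₁ o₃ o₂ n₁₃ n₁₂ n₃₂) = inj₂ (tails t₁ t₂ t₃ (o₁ ∘ X) (o₂ ∘ X) (o₃ ∘ X) n₁₂ n₁₃ (n₃₂ ∘ ~-sym))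
      where
      X : ∀ {v} → K a₁ a₂ v → K a₁ a₃ v
      X = K-move e x₁ x₃
    by (no _) (no _) (yes h) with pair₁₂ q r p (f , ~-sym g , ~-sym e) (f′ , ~-sym g′ , ~-sym e′) _ (sw₂₃-IH (sw₁₂ Θ) (sw₁₂-IH Θ ih))
          (front-map X′ (rest-swap ∘ rest-map X′ Y′) f₂)
          (front-map X′ (rest-swap ∘ rest-map X′ Y′) f₃)
          (front-map X′ (rest-map X′ Y′) f₁)
          (subst₂ _~_ (≡-sym (tail-map X′ _ f₂)) (≡-sym (tail-map X′ _ f₃)) h)
      where
      X′ : ∀ {v} → K a₂ a₃ v → K a₁ a₂ v
      X′ = K-move f (K₃ e g) (Kₗ f)
      Y′ : ∀ {v} → K b₂ b₃ v → K b₁ b₂ v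
      Y′ = K-move f′ (K₃ e′ g′) (Kₗ f′)
    ... | inj₁ goal = inj₁ (sw₁₂-goal Θ (sw₂₃-goal (sw₁₂ Θ) goal))
    ... | inj₂ (tails t₂ t₃ t₁ o₂ o₃ o₁ n₂₃ n₂₁ n₃₁) = inj₂ (tails t₁ t₂ t₃ (o₁ ∘ X) (o₂ ∘ X) (o₃ ∘ X) (n₂₁ ∘ ~-sym) (n₃₁ ∘ ~-sym) n₂₃)
      where
      X : ∀ {v} → K a₁ a₂ v → K a₂ a₃ v
      X = K-move e x₂ x₃
    by (no n₁₂) (no n₁₃) (no n₂₃) =
      inj₂ (tails (front-edge x₁ f₁) (front-edge x₂ f₂) (front-edge x₃ f₃) (front-out f₁) (front-out f₂) (front-out f₃) n₁₂ n₁₃ n₂₃)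

  -- Triangles of q-heavy type

  vertices-unique : ∀ Θ → Unique (vertices Θ)
  vertices-unique (θ _ _ _ _ _ u) = u

  heavy-sum : ∀ {u v} → Heavy F u → Heavy F v → Ore u v
  heavy-sum {u} {v} h h′ with ≤-total (deg F u) (deg F v)
  ... | inj₁ le = ≤-trans h (+-monoʳ-≤ (deg F u) (≤-trans (≤-reflexive (+-identityʳ _)) le))
  ... | inj₂ le = ≤-trans h′ (+-mono-≤ le (≤-reflexive (+-identityʳ _)))

  -- Non-adjacent heavy vertices have two common neighbours. If these are adjacent, both heavy
  -- vertices lie in the clique of that edge and are adjacent after all.
  heavy-adjacent : ∀ {u v} → u ≢ v → Heavy F u → Heavy F v →
                   (∀ {x y} → u ~ x → u ~ y → v ~ x → v ~ y → x ≃ y) → u ~ v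
  heavy-adjacent {u} {v} u≢v hu hv common with u ~? v
  ... | yes e = e
  ... | no ¬e with Degrees.two-common F u≢v ¬e (heavy-sum hu hv)
  ...   | x , y , x≢y , (xu , xv) , (yu , yv) =
    ≃⇒~ u≢v (nd (≃⇒~ x≢y (common (~-sym xu) (~-sym yu) (~-sym xv) (~-sym yv))) (K₃ (~-sym xu) (~-sym yu)) (K₃ (~-sym xv) (~-sym yv)))

  nc-skip : ∀ {c w x y} → c ~ w → c ~ x → c ~ y → ¬ w ≃ x → ¬ w ≃ y → x ≃ y
  nc-skip cw cx cy ¬x ¬y with nc cw cx cy
  ... | inj₁ h        = contradiction h ¬x
  ... | inj₂ (inj₁ h) = h
  ... | inj₂ (inj₂ h) = contradiction h ¬y

  -- The heavy vertices a₁, σ, σ′ share a clique, where the centre can be moved.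
  module Special {a₁ a₁′ a₂ a₂′ a₂″ a₃ a₃′ a₃″ b₁ b₂ b₃ R₁ R₂ R₃}
    (d₁ : a₁ ~ a₁′) (p₁ : Path a₁′ R₁ b₁)
    (d₂ : a₂ ~ a₂′) (d₂′ : a₂′ ~ a₂″) (p₂ : Path a₂″ R₂ b₂)
    (d₃ : a₃ ~ a₃′) (d₃′ : a₃′ ~ a₃″) (p₃ : Path a₃″ R₃ b₃)
    (e : a₁ ~ a₂) (f : a₂ ~ a₃) (g : a₁ ~ a₃) (tri′ : Triangle b₁ b₂ b₃)
    (u : Unique ((a₁ ∷ R₁) ++ (a₂ ∷ a₂′ ∷ R₂) ++ (a₃ ∷ a₃′ ∷ R₃)))
    (ih : IH (θ (d₁ ∷ p₁) (d₂ ∷ (d₂′ ∷ p₂)) (d₃ ∷ (d₃′ ∷ p₃)) (e , f , g) tri′ u))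
    (Q : QType a₁ a₂ a₃) where

    open QType Q

    private
      A B C : List V
      A = a₁ ∷ R₁
      B = a₂ ∷ a₂′ ∷ R₂
      C = a₃ ∷ a₃′ ∷ R₃

      Θ : Theta
      Θ = θ (d₁ ∷ p₁) (d₂ ∷ (d₂′ ∷ p₂)) (d₃ ∷ (d₃′ ∷ p₃)) (e , f , g) tri′ u

      dis₁₂ : ∀ {x y} → x ∈ A → y ∈ B → x ≢ y
      dis₁₂ x∈ y∈ = disjoint A u x∈ (∈-++⁺ˡ y∈)
      dis₁₃ : ∀ {x y} → x ∈ A → y ∈ C → x ≢ y
      dis₁₃ x∈ y∈ = disjoint A u x∈ (∈-++⁺ʳ B y∈)
      dis₂₃ : ∀ {x y} → x ∈ B → y ∈ C → x ≢ y
      dis₂₃ = disjoint B (unique-++ʳ A u)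

      a₂′≡τ : a₂′ ≡ τ
      a₂′≡τ with N-b d₂
      ... | inj₁ h        = contradiction (≡-sym h) (dis₁₂ (here refl) (there (here refl)))
      ... | inj₂ (inj₁ h) = contradiction h (dis₂₃ (there (here refl)) (here refl))
      ... | inj₂ (inj₂ h) = h

      a₃′≡τ′ : a₃′ ≡ τ′
      a₃′≡τ′ with N-c d₃
      ... | inj₁ h        = contradiction (≡-sym h) (dis₁₃ (here refl) (there (here refl)))
      ... | inj₂ (inj₁ h) = contradiction (≡-sym h) (dis₂₃ (here refl) (there (here refl)))
      ... | inj₂ (inj₂ h) = h

      a₂″≡σ : a₂″ ≡ σ
      a₂″≡σ with N-τ (subst (_~ a₂″) a₂′≡τ d₂′)
      ... | inj₁ h = contradiction (≡-sym h) (head≢ (unique-++ˡ B (unique-++ʳ A u)) (there (start∈ p₂)))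
      ... | inj₂ h = h

      a₃″≡σ′ : a₃″ ≡ σ′
      a₃″≡σ′ with N-τ′ (subst (_~ a₃″) a₃′≡τ′ d₃′)
      ... | inj₁ h = contradiction (≡-sym h) (head≢ (unique-++ʳ B (unique-++ʳ A u)) (there (start∈ p₃)))
      ... | inj₂ h = h

      N₂ : ∀ {v} → a₂ ~ v → v ≡ a₁ ⊎ v ≡ a₃ ⊎ v ≡ a₂′
      N₂ h = subst (λ z → _ ≡ a₁ ⊎ _ ≡ a₃ ⊎ _ ≡ z) (≡-sym a₂′≡τ) (N-b h)
      N₃ : ∀ {v} → a₃ ~ v → v ≡ a₁ ⊎ v ≡ a₂ ⊎ v ≡ a₃′
      N₃ h = subst (λ z → _ ≡ a₁ ⊎ _ ≡ a₂ ⊎ _ ≡ z) (≡-sym a₃′≡τ′) (N-c h)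
      N₂′ : ∀ {v} → a₂′ ~ v → v ≡ a₂ ⊎ v ≡ a₂″
      N₂′ {v} h = subst (λ z → v ≡ a₂ ⊎ v ≡ z) (≡-sym a₂″≡σ) (N-τ (subst (_~ v) a₂′≡τ h))
      N₃′ : ∀ {v} → a₃′ ~ v → v ≡ a₃ ⊎ v ≡ a₃″
      N₃′ {v} h = subst (λ z → v ≡ a₃ ⊎ v ≡ z) (≡-sym a₃″≡σ′) (N-τ′ (subst (_~ v) a₃′≡τ′ h))

      R₂⊆ : ∀ {v} → v ∈ R₂ → v ∈ B
      R₂⊆ = there ∘ there
      R₃⊆ : ∀ {v} → v ∈ R₃ → v ∈ C
      R₃⊆ = there ∘ there

      a₂≄R₂ : ∀ {v} → v ∈ R₂ → ¬ a₂ ≃ v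
      a₂≄R₂ v∈ (inj₁ refl) = head∉ (unique-++ˡ B (unique-++ʳ A u)) (there v∈)
      a₂≄R₂ v∈ (inj₂ h) with N₂ h
      ... | inj₁ refl        = dis₁₂ (here refl) (R₂⊆ v∈) refl
      ... | inj₂ (inj₁ refl) = dis₂₃ (R₂⊆ v∈) (here refl) refl
      ... | inj₂ (inj₂ refl) = head∉ (unique-++ʳ (a₂ ∷ []) (unique-++ˡ B (unique-++ʳ A u))) v∈

      a₂≄R₃ : ∀ {v} → v ∈ R₃ → ¬ a₂ ≃ v
      a₂≄R₃ v∈ (inj₁ refl) = dis₂₃ (here refl) (R₃⊆ v∈) refl
      a₂≄R₃ v∈ (inj₂ h) with N₂ h
      ... | inj₁ refl        = dis₁₃ (here refl) (R₃⊆ v∈) refl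
      ... | inj₂ (inj₁ refl) = head∉ (unique-++ʳ B (unique-++ʳ A u)) (there v∈)
      ... | inj₂ (inj₂ refl) = dis₂₃ (there (here refl)) (R₃⊆ v∈) refl

      a₂≄R₁ : ∀ {v} → v ∈ R₁ → ¬ a₂ ≃ v
      a₂≄R₁ v∈ (inj₁ refl) = dis₁₂ (there v∈) (here refl) refl
      a₂≄R₁ v∈ (inj₂ h) with N₂ h
      ... | inj₁ refl        = head∉ (unique-++ˡ A u) v∈
      ... | inj₂ (inj₁ refl) = dis₁₃ (there v∈) (here refl) refl
      ... | inj₂ (inj₂ refl) = dis₁₂ (there v∈) (there (here refl)) refl

      a₃≁R₂ : ∀ {v} → v ∈ R₂ → ¬ a₃ ~ v
      a₃≁R₂ v∈ h with N₃ h
      ... | inj₁ refl        = dis₁₂ (here refl) (R₂⊆ v∈) refl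
      ... | inj₂ (inj₁ refl) = head∉ (unique-++ˡ B (unique-++ʳ A u)) (there v∈)
      ... | inj₂ (inj₂ refl) = dis₂₃ (R₂⊆ v∈) (there (here refl)) refl

      a₂′≁a₁ : ¬ a₂′ ~ a₁
      a₂′≁a₁ h with N₂′ h
      ... | inj₁ eq = dis₁₂ (here refl) (here refl) eq
      ... | inj₂ eq = dis₁₂ (here refl) (R₂⊆ (start∈ p₂)) eq

      a₃′≁a₁ : ¬ a₃′ ~ a₁
      a₃′≁a₁ h with N₃′ h
      ... | inj₁ eq = dis₁₃ (here refl) (here refl) eq
      ... | inj₂ eq = dis₁₃ (here refl) (R₃⊆ (start∈ p₃)) eq

      a₂≄-common₂ : ∀ {v} → a₁ ~ v → a₂″ ~ v → ¬ a₂ ≃ v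
      a₂≄-common₂ av a″v (inj₁ refl) = a₂≄R₂ (start∈ p₂) (inj₂ (~-sym a″v))
      a₂≄-common₂ av a″v (inj₂ h) with N₂ h
      ... | inj₁ refl        = ~⇒≢ av refl
      ... | inj₂ (inj₁ refl) = a₃≁R₂ (start∈ p₂) (~-sym a″v)
      ... | inj₂ (inj₂ refl) = a₂′≁a₁ (~-sym av)

      a₃≁R₃ : ∀ {v} → v ∈ R₃ → ¬ a₃ ~ v
      a₃≁R₃ v∈ h with N₃ h
      ... | inj₁ refl        = dis₁₃ (here refl) (R₃⊆ v∈) refl
      ... | inj₂ (inj₁ refl) = dis₂₃ (here refl) (R₃⊆ v∈) refl
      ... | inj₂ (inj₂ refl) = head∉ (unique-++ʳ (a₃ ∷ []) (unique-++ʳ B (unique-++ʳ A u))) v∈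

      a₂≄-common₃ : ∀ {v} → a₁ ~ v → a₃″ ~ v → ¬ a₂ ≃ v
      a₂≄-common₃ av a″v (inj₁ refl) = a₂≄R₃ (start∈ p₃) (inj₂ (~-sym a″v))
      a₂≄-common₃ av a″v (inj₂ h) with N₂ h
      ... | inj₁ refl        = ~⇒≢ av refl
      ... | inj₂ (inj₁ refl) = a₃≁R₃ (start∈ p₃) (~-sym a″v)
      ... | inj₂ (inj₂ refl) = a₂′≁a₁ (~-sym av)

    -- A common neighbour of `a₁` and `a₂″` does not see `a₂`; claw-freeness at `a₁` with leaf `a₂`
    -- makes any two of them equal or adjacent, as `heavy-adjacent` asks.
    a₁~a₂″ : a₁ ~ a₂″
    a₁~a₂″ = heavy-adjacent (dis₁₂ (here refl) (R₂⊆ (start∈ p₂))) heavy-a (subst (Heavy F) (≡-sym a₂″≡σ) heavy-σ)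
               (λ ax ay sx sy → nc-skip e ax ay (a₂≄-common₂ ax sx) (a₂≄-common₂ ay sy))

    a₁~a₃″ : a₁ ~ a₃″
    a₁~a₃″ = heavy-adjacent (dis₁₃ (here refl) (R₃⊆ (start∈ p₃))) heavy-a (subst (Heavy F) (≡-sym a₃″≡σ′) heavy-σ′)
               (λ ax ay sx sy → nc-skip e ax ay (a₂≄-common₃ ax sx) (a₂≄-common₃ ay sy))

    module _ {a₂‴ a₃‴ S₂ S₃} (c₂ : a₂″ ~ a₂‴) (q₂ : Path a₂‴ S₂ b₂) (c₃ : a₃″ ~ a₃‴) (q₃ : Path a₃‴ S₃ b₃)
      (eq₂ : R₂ ≡ a₂″ ∷ S₂) (eq₃ : R₃ ≡ a₃″ ∷ S₃) where

      private
        ∈₂ : ∀ {v} → v ∈ a₂″ ∷ S₂ → v ∈ R₂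
        ∈₂ = subst (_ ∈_) (≡-sym eq₂)
        ∈₃ : ∀ {v} → v ∈ a₃″ ∷ S₃ → v ∈ R₃
        ∈₃ = subst (_ ∈_) (≡-sym eq₃)

        B-unique : Unique (a₂ ∷ a₂′ ∷ a₂″ ∷ S₂)
        B-unique = subst (λ R → Unique (a₂ ∷ a₂′ ∷ R)) eq₂ (unique-++ˡ B (unique-++ʳ A u))
        C-unique : Unique (a₃ ∷ a₃′ ∷ a₃″ ∷ S₃)
        C-unique = subst (λ R → Unique (a₃ ∷ a₃′ ∷ R)) eq₃ (unique-++ʳ B (unique-++ʳ A u))

        a₁~a₂‴ : a₁ ~ a₂‴
        a₁~a₂‴ = ≃⇒~ (dis₁₂ (here refl) (R₂⊆ (∈₂ (there (start∈ q₂)))))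
          (≃-sym (nc-skip (~-sym d₂′) c₂ (~-sym a₁~a₂″) no‴ (λ { (inj₁ h) → dis₁₂ (here refl) (there (here refl)) (≡-sym h) ; (inj₂ h) → a₂′≁a₁ h })))
          where
          no‴ : ¬ a₂′ ≃ a₂‴
          no‴ (inj₁ h) = head≢ (unique-++ʳ (a₂ ∷ []) B-unique) (there (start∈ q₂)) h
          no‴ (inj₂ h) with N₂′ h
          ... | inj₁ h′ = head≢ B-unique (there (there (start∈ q₂))) (≡-sym h′)
          ... | inj₂ h′ = ~⇒≢ c₂ (≡-sym h′)

        a₁~a₃‴ : a₁ ~ a₃‴
        a₁~a₃‴ = ≃⇒~ (dis₁₃ (here refl) (R₃⊆ (∈₃ (there (start∈ q₃)))))
          (≃-sym (nc-skip (~-sym d₃′) c₃ (~-sym a₁~a₃″) no‴ (λ { (inj₁ h) → dis₁₃ (here refl) (there (here refl)) (≡-sym h) ; (inj₂ h) → a₃′≁a₁ h })))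
          where
          no‴ : ¬ a₃′ ≃ a₃‴
          no‴ (inj₁ h) = head≢ (unique-++ʳ (a₃ ∷ []) C-unique) (there (start∈ q₃)) h
          no‴ (inj₂ h) with N₃′ h
          ... | inj₁ h′ = head≢ C-unique (there (there (start∈ q₃))) (≡-sym h′)
          ... | inj₂ h′ = ~⇒≢ c₃ (≡-sym h′)

        R₂R₃ : ∀ {x y} → a₁ ~ x → a₁ ~ y → x ∈ R₂ → y ∈ R₃ → x ~ y
        R₂R₃ ax ay x∈ y∈ = ≃⇒~ (dis₂₃ (R₂⊆ x∈) (R₃⊆ y∈)) (nc-skip e ax ay (a₂≄R₂ x∈) (a₂≄R₃ y∈))

        a₁′~a₃″ : a₁′ ~ a₃″
        a₁′~a₃″ = ≃⇒~ (dis₁₃ (there (start∈ p₁)) (R₃⊆ (start∈ p₃))) (nc-skip e d₁ a₁~a₃″ (a₂≄R₁ (start∈ p₁)) (a₂≄R₃ (start∈ p₃)))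

        a₂″~a₃‴ : a₂″ ~ a₃‴
        a₂″~a₃‴ = R₂R₃ a₁~a₂″ a₁~a₃‴ (start∈ p₂) (∈₃ (there (start∈ q₃)))

        a₂‴~a₃‴ : a₂‴ ~ a₃‴
        a₂‴~a₃‴ = R₂R₃ a₁~a₂‴ a₁~a₃‴ (∈₂ (there (start∈ q₂))) (∈₃ (there (start∈ q₃)))

        π : vertices Θ ↭ a₁ ∷ ((a₂″ ∷ a₂′ ∷ a₂ ∷ a₃ ∷ a₃′ ∷ a₃″ ∷ R₁) ++ S₂ ++ S₃)
        π rewrite eq₂ | eq₃ = solve 10 (λ x r y y′ y″ s z z′ z″ t →
              (x ⊕ r) ⊕ ((y ⊕ (y′ ⊕ (y″ ⊕ s))) ⊕ (z ⊕ (z′ ⊕ (z″ ⊕ t)))) ⊜ x ⊕ ((y″ ⊕ (y′ ⊕ (y ⊕ (z ⊕ (z′ ⊕ (z″ ⊕ r)))))) ⊕ (s ⊕ t)))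
              ↭-refl (a₁ ∷ []) R₁ (a₂ ∷ []) (a₂′ ∷ []) (a₂″ ∷ []) S₂ (a₃ ∷ []) (a₃′ ∷ []) (a₃″ ∷ []) S₃

        -- Only `a₁` is dropped. The first path now begins with `a₂″`, `a₂′`, `a₂`, `a₃`, `a₃′`,
        -- `a₃″`, visiting the old triangle by its edge from `a₂` to `a₃`, and the new triangle lies
        -- in the clique that `a₁` shares with `a₂″` and `a₃″`.
        Θ′ : Theta
        Θ′ = θ (~-sym d₂′ ∷ (~-sym d₂ ∷ (f ∷ (d₃ ∷ (d₃′ ∷ (~-sym a₁′~a₃″ ∷ p₁)))))) q₂ q₃ (c₂ , a₂‴~a₃‴ , a₂″~a₃‴) tri′
               (unique-++ʳ (a₁ ∷ []) (unique-↭ π u))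

        on₂ : ∀ {v} → Vis R₂ v → K a₂″ a₂‴ v ⊎ Vis S₂ v
        on₂ x = any-∷⁻ q₂ (subst (λ R → Vis R _) eq₂ x)
        on₃ : ∀ {v} → Vis R₃ v → K a₃″ a₃‴ v ⊎ Vis S₃ v
        on₃ x = any-∷⁻ q₃ (subst (λ R → Vis R _) eq₃ x)

        ⊆ : ∀ {v} → D Θ v → D Θ′ v
        ⊆ (onA x) with any-∷⁻ p₁ x
        ... | inj₁ k = onA (tl (tl (tl (tl (tl (any-∷ p₁ (K-move d₁ (K₃ (~-sym a₁~a₃″) (~-sym a₁′~a₃″)) (Kᵣ d₁) k)))))))
        ... | inj₂ y = onA (tl (tl (tl (tl (tl (tl y))))))
        ⊆ (onB (hd k)) = onA (tl (hd (K-swap k)))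
        ⊆ (onB (tl x)) with any-∷⁻ p₂ x
        ... | inj₁ k = onA (hd (K-swap k))
        ... | inj₂ y = [ onX , onB ]′ (on₂ y)
        ⊆ (onC (hd k)) = onA (tl (tl (tl (hd k))))
        ⊆ (onC (tl x)) with any-∷⁻ p₃ x
        ... | inj₁ k = onA (tl (tl (tl (tl (hd k)))))
        ... | inj₂ y with on₃ y
        ...   | inj₁ k = onX (K-move c₃ (K₃ (R₂R₃ a₁~a₂″ a₁~a₃″ (start∈ p₂) (start∈ p₃)) a₂″~a₃‴)
                               (K₃ (R₂R₃ a₁~a₂‴ a₁~a₃″ (∈₂ (there (start∈ q₂))) (start∈ p₃)) a₂‴~a₃‴) k)
        ...   | inj₂ z = onC z
        ⊆ (onX k) = onA (tl (tl (hd (K-move e (Kᵣ e) (K₃ (~-sym g) (~-sym f)) k))))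
        ⊆ (onY k) = onY k

      shorter : Goal Θ
      shorter = improve {Θ} {Θ′} ih (smaller ⊆ (≤-reflexive (≡-sym (↭-length π))))

  -- The cases are the lengths of the paths from the two light corners. Length one is impossible,
  -- since an end with two more neighbours in the other triangle has degree above two; at length two
  -- the heavy vertex is the end `b₂` or `b₃`, and its edge to `a₁` closes a route; beyond that the
  -- theta shrinks.
  qtype : ∀ {a₁ a₂ a₃ b₁ b₂ b₃ A B C} (p : Path a₁ A b₁) (q : Path a₂ B b₂) (r : Path a₃ C b₃)
    (tri : Triangle a₁ a₂ a₃) (tri′ : Triangle b₁ b₂ b₃) (u : Unique (A ++ B ++ C)) → IH (θ p q r tri tri′ u) →
    QType a₁ a₂ a₃ → Goal (θ p q r tri tri′ u)
  qtype one q r tri tri′ u ih Q with front one q r tri tri′ u ih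
  ... | inj₁ goal = goal
  qtype p@(_ ∷ _) one r tri@(e , f , g) tri′@(e′ , f′ , g′) u ih Q
    with front one p r (~-sym e , g , f) (~-sym e′ , g′ , f′) _ (sw₁₂-IH (θ p one r tri tri′ u) ih)
  ... | inj₁ goal = sw₁₂-goal (θ p one r tri tri′ u) goal
  qtype {A = A} {B} {C} p@(_ ∷ _) q@(d₂ ∷ one) r (e , f , g) (e′ , f′ , g′) u ih Q = ⊥-elim (~⇒≢ g′ (trans (≡σ e′′ b₁≢) (≡-sym (≡σ f′ b₃≢))))
    where
    open QType Q
    e′′ = ~-sym e′
    dis₁₂ : ∀ {x y} → x ∈ A → y ∈ B → x ≢ y
    dis₁₂ x∈ y∈ = disjoint A u x∈ (∈-++⁺ˡ y∈)
    b₁≢ = dis₁₂ (end∈ p) (here refl)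
    b₃≢ = λ h → disjoint B (unique-++ʳ A u) (here refl) (end∈ r) (≡-sym h)
    ≡τ : _ ≡ τ
    ≡τ with N-b d₂
    ... | inj₁ h        = contradiction (≡-sym h) (dis₁₂ (start∈ p) (there (here refl)))
    ... | inj₂ (inj₁ h) = contradiction h (disjoint B (unique-++ʳ A u) (there (here refl)) (start∈ r))
    ... | inj₂ (inj₂ h) = h
    ≡σ : ∀ {v} → _ ~ v → v ≢ _ → v ≡ σ
    ≡σ {v} h ne with N-τ (subst (_~ v) ≡τ h)
    ... | inj₁ h′ = contradiction h′ ne
    ... | inj₂ h′ = h′
  qtype p@(_ ∷ _) q@(_ ∷ (_ ∷ _)) one tri@(e , f , g) tri′@(e′ , f′ , g′) u ih Q
    with front one p q (~-sym g , e , ~-sym f) (~-sym g′ , e′ , ~-sym f′) _ (sw₁₂-IH (sw₂₃ (θ p q one tri tri′ u)) (sw₂₃-IH (θ p q one tri tri′ u) ih))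
  ... | inj₁ goal = sw₂₃-goal (θ p q one tri tri′ u) (sw₁₂-goal (sw₂₃ (θ p q one tri tri′ u)) goal)
  qtype {A = A} {B} {C} p@(_ ∷ _) q@(_ ∷ (_ ∷ _)) r@(d₃ ∷ one) (e , f , g) (e′ , f′ , g′) u ih Q = ⊥-elim (~⇒≢ e′ (trans (≡σ (~-sym g′) b₁≢) (≡-sym (≡σ (~-sym f′) b₂≢))))
    where
    open QType Q
    dis₁₃ : ∀ {x y} → x ∈ A → y ∈ C → x ≢ y
    dis₁₃ x∈ y∈ = disjoint A u x∈ (∈-++⁺ʳ B y∈)
    b₁≢ = dis₁₃ (end∈ p) (here refl)
    b₂≢ = disjoint B (unique-++ʳ A u) (end∈ q) (here refl)
    ≡τ : _ ≡ τ′
    ≡τ with N-c d₃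
    ... | inj₁ h        = contradiction (≡-sym h) (dis₁₃ (start∈ p) (there (here refl)))
    ... | inj₂ (inj₁ h) = contradiction (≡-sym h) (disjoint B (unique-++ʳ A u) (start∈ q) (there (here refl)))
    ... | inj₂ (inj₂ h) = h
    ≡σ : ∀ {v} → _ ~ v → v ≢ _ → v ≡ σ′
    ≡σ {v} h ne with N-τ′ (subst (_~ v) ≡τ h)
    ... | inj₁ h′ = contradiction h′ ne
    ... | inj₂ h′ = h′
  qtype (d₁ ∷ p) (d₂ ∷ (d₂′ ∷ one)) (d₃ ∷ (d₃′ ∷ r)) (e , f , g) tri′ u ih Q =
    Route.route-close (d₁ ∷ p) (d₂ ∷ (d₂′ ∷ one)) (d₃ ∷ (d₃′ ∷ r)) (e , f , g) tri′ u
      (~-sym (Special.a₁~a₂″ d₁ p d₂ d₂′ one d₃ d₃′ r e f g tri′ u ih Q))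
  qtype (d₁ ∷ p) (d₂ ∷ (d₂′ ∷ (d₂″ ∷ q))) (d₃ ∷ (d₃′ ∷ one)) tri@(e , f , g) tri′@(e′ , f′ , g′) u ih Q =
    sw₂₃-goal Θ (Route.route-close (d₁ ∷ p) (d₃ ∷ (d₃′ ∷ one)) (d₂ ∷ (d₂′ ∷ (d₂″ ∷ q))) (g , ~-sym f , e) (g′ , ~-sym f′ , e′) (vertices-unique (sw₂₃ Θ))
      (~-sym (Special.a₁~a₃″ d₁ p d₂ d₂′ (d₂″ ∷ q) d₃ d₃′ one e f g tri′ u ih Q)))
    where
    Θ = θ (d₁ ∷ p) (d₂ ∷ (d₂′ ∷ (d₂″ ∷ q))) (d₃ ∷ (d₃′ ∷ one)) tri tri′ u
  qtype (d₁ ∷ p) (d₂ ∷ (d₂′ ∷ (d₂″ ∷ q))) (d₃ ∷ (d₃′ ∷ (d₃″ ∷ r))) (e , f , g) tri′ u ih Q =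
    Special.shorter d₁ p d₂ d₂′ (d₂″ ∷ q) d₃ d₃′ (d₃″ ∷ r) e f g tri′ u ih Q d₂″ q d₃″ r refl refl

  -- Two p-heavy triangles, and the induction over thetas

  left : ∀ {a₁ a₂ a₃ b₁ b₂ b₃ A B C} (p : Path a₁ A b₁) (q : Path a₂ B b₂) (r : Path a₃ C b₃)
    (tri : Triangle a₁ a₂ a₃) (tri′ : Triangle b₁ b₂ b₃) (u : Unique (A ++ B ++ C)) → IH (θ p q r tri tri′ u) →
    Goal (θ p q r tri tri′ u) ⊎ OrePair a₁ a₂ a₃
  left p q r tri@(e , f , g) tri′@(e′ , f′ , g′) u ih with find-tails p q r tri tri′ u ih
  ... | inj₁ goal = inj₁ goal
  ... | inj₂ ts with nets tri ts
  ...   | inj₁ ore = inj₂ ore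
  ...   | inj₂ (inj₁ Q) = inj₁ (qtype p q r tri tri′ u ih Q)
  ...   | inj₂ (inj₂ (inj₁ Q)) = inj₁ (sw₁₂-goal Θ (qtype q p r (~-sym e , g , f) (~-sym e′ , g′ , f′) _ (sw₁₂-IH Θ ih) Q))
    where Θ = θ p q r tri tri′ u
  ...   | inj₂ (inj₂ (inj₂ Q)) = inj₁ (sw₂₃-goal Θ (sw₁₂-goal (sw₂₃ Θ)
            (qtype r p q (~-sym g , e , ~-sym f) (~-sym g′ , e′ , ~-sym f′) _ (sw₁₂-IH (sw₂₃ Θ) (sw₂₃-IH Θ ih)) Q)))
    where Θ = θ p q r tri tri′ u

  -- The larger of `b` and `d` is substituted for the smaller one in the sum that contains it.
  exchange : ∀ {a b c d} → n ≤ a + b → n ≤ c + d → n ≤ a + d ⊎ n ≤ b + c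
  exchange {a} {b} {c} {d} h h′ with ≤-total b d
  ... | inj₁ le = inj₁ (≤-trans h (+-monoʳ-≤ a le))
  ... | inj₂ le = inj₂ (≤-trans h′ (≤-trans (+-monoʳ-≤ c le) (≤-reflexive (+-comm c b))))

  routes : ∀ {a₁ a₂ a₃ b₁ b₂ b₃ A B C} (p : Path a₁ A b₁) (q : Path a₂ B b₂) (r : Path a₃ C b₃)
    (tri : Triangle a₁ a₂ a₃) (tri′ : Triangle b₁ b₂ b₃) (u : Unique (A ++ B ++ C)) →
    OrePair a₁ a₂ a₃ → OrePair b₁ b₂ b₃ → Goal (θ p q r tri tri′ u)
  routes {a₁} {a₂} {a₃} {b₁} {b₂} {b₃} p q r tri@(e , f , g) tri′@(e′ , f′ , g′) u = go
    where
    Θ : Theta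
    Θ = θ p q r tri tri′ u
    r₁₂ : Ore a₁ b₂ → Goal Θ
    r₁₂ = Route.route-ore p q r tri tri′ u
    r₁₃ : Ore a₁ b₃ → Goal Θ
    r₁₃ h = sw₂₃-goal Θ (Route.route-ore p r q (g , ~-sym f , e) (g′ , ~-sym f′ , e′) (vertices-unique (sw₂₃ Θ)) h)
    r₂₁ : Ore a₂ b₁ → Goal Θ
    r₂₁ h = sw₁₂-goal Θ (Route.route-ore q p r (~-sym e , g , f) (~-sym e′ , g′ , f′) (vertices-unique (sw₁₂ Θ)) h)
    r₂₃ : Ore a₂ b₃ → Goal Θ
    r₂₃ h = sw₁₂-goal Θ (sw₂₃-goal (sw₁₂ Θ) (Route.route-ore q r p (f , ~-sym g , ~-sym e) (f′ , ~-sym g′ , ~-sym e′) (vertices-unique (sw₂₃ (sw₁₂ Θ))) h))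
    r₃₁ : Ore a₃ b₁ → Goal Θ
    r₃₁ h = sw₂₃-goal Θ (sw₁₂-goal (sw₂₃ Θ) (Route.route-ore r p q (~-sym g , e , ~-sym f) (~-sym g′ , e′ , ~-sym f′) (vertices-unique (sw₁₂ (sw₂₃ Θ))) h))
    r₃₂ : Ore a₃ b₂ → Goal Θ
    r₃₂ h = sw₂₃-goal Θ (sw₁₂-goal (sw₂₃ Θ) (sw₂₃-goal (sw₁₂ (sw₂₃ Θ))
              (Route.route-ore r q p (~-sym f , ~-sym e , ~-sym g) (~-sym f′ , ~-sym e′ , ~-sym g′) (vertices-unique (sw₂₃ (sw₁₂ (sw₂₃ Θ)))) h)))
    flop : ∀ x y {m} → m ≤ deg F x + deg F y → m ≤ deg F y + deg F x
    flop x y h = ≤-trans h (≤-reflexive (+-comm (deg F x) (deg F y)))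
    pick : ∀ s t x y → Ore s t → Ore x y → Ore s y ⊎ Ore t x
    pick s t x y h h′ = exchange {deg F s} {deg F t} {deg F x} {deg F y} h h′
    -- In every case the pair at the second triangle is ordered so that both outcomes of `pick` have
    -- different indices, as a route requires.
    go : OrePair a₁ a₂ a₃ → OrePair b₁ b₂ b₃ → Goal Θ
    go (inj₁ h) (inj₁ k) = [ r₁₂ , r₂₁ ]′ (pick a₁ a₂ b₁ b₂ h k)
    go (inj₁ h) (inj₂ (inj₁ k)) = [ r₁₃ , r₂₁ ]′ (pick a₁ a₂ b₁ b₃ h k)
    go (inj₁ h) (inj₂ (inj₂ k)) = [ r₁₂ , r₂₃ ]′ (pick a₁ a₂ b₃ b₂ h (flop b₂ b₃ k))
    go (inj₂ (inj₁ h)) (inj₁ k) = [ r₁₂ , r₃₁ ]′ (pick a₁ a₃ b₁ b₂ h k)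
    go (inj₂ (inj₁ h)) (inj₂ (inj₁ k)) = [ r₁₃ , r₃₁ ]′ (pick a₁ a₃ b₁ b₃ h k)
    go (inj₂ (inj₁ h)) (inj₂ (inj₂ k)) = [ r₁₃ , r₃₂ ]′ (pick a₁ a₃ b₂ b₃ h k)
    go (inj₂ (inj₂ h)) (inj₁ k) = [ r₂₁ , r₃₂ ]′ (pick a₂ a₃ b₂ b₁ h (flop b₁ b₂ k))
    go (inj₂ (inj₂ h)) (inj₂ (inj₁ k)) = [ r₂₃ , r₃₁ ]′ (pick a₂ a₃ b₁ b₃ h k)
    go (inj₂ (inj₂ h)) (inj₂ (inj₂ k)) = [ r₂₃ , r₃₂ ]′ (pick a₂ a₃ b₂ b₃ h k)

  flip-size : ∀ Θ → size (flip Θ) ≤ size Θ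
  flip-size (θ {A = A} {B} {C} _ _ _ _ _ _) = ≤-reflexive (↭-length (++⁺ (↭-reverse A) (++⁺ (↭-reverse B) (↭-reverse C))))

  flip-IH : ∀ Θ → IH Θ → IH (flip Θ)
  flip-IH Θ ih Θ′ (smaller f lt) = ih Θ′ (smaller (f ∘ flip-D Θ) (≤-trans lt (flip-size Θ)))
  flip-IH Θ ih Θ′ (richer f le x y d ¬d) = ih Θ′ (richer (f ∘ flip-D₂ Θ) (≤-trans le (flip-size Θ)) x y d (¬d ∘ flip-D₂ Θ))

  goal-step : ∀ Θ → IH Θ → Goal Θ
  goal-step Θ@(θ p q r tri tri′ u) ih with left p q r tri tri′ u ih
  ... | inj₁ goal = goal
  ... | inj₂ oreA with left (rev p) (rev q) (rev r) tri′ tri _ (flip-IH Θ ih)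
  ...   | inj₁ goal = goal-mono {Θ} {flip Θ} (flip-D Θ) goal
  ...   | inj₂ oreB = routes p q r tri tri′ u oreA oreB

  private
    covered : Theta → ℕ
    covered Θ = length (filter (λ (u , v) → D₂? Θ u v) (pairs n))

    defect : Theta → ℕ
    defect Θ = length (pairs n) ∸ covered Θ

    defect-< : ∀ Θ Θ′ {u v} → (∀ {u v} → D₂ Θ u v → D₂ Θ′ u v) → D₂ Θ′ u v → ¬ D₂ Θ u v → defect Θ′ < defect Θ
    defect-< Θ Θ′ {u} {v} sub d ¬d =
      ∸-monoʳ-< (count-< (λ (u , v) → D₂? Θ u v) (λ (u , v) → D₂? Θ′ u v) sub (∈-pairs u v) d ¬d) (length-filter _ (pairs n))

    -- Lexicographic descent: `outer` serves every theta of smaller size, and at equal size `richer`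
    -- lowers the number of pairs not yet in a common visited clique.
    inner : ∀ {s} → (∀ Θ → size Θ < s → Goal Θ) → ∀ Θ → size Θ ≡ s → Acc _<_ (defect Θ) → Goal Θ
    inner {s} outer Θ eq (acc rd) = goal-step Θ ih
      where
      ih : IH Θ
      ih Θ′ (smaller _ lt) = outer Θ′ (subst (size Θ′ <_) eq lt)
      ih Θ′ (richer sub le u v d ¬d) with m≤n⇒m<n∨m≡n le
      ... | inj₁ lt  = outer Θ′ (subst (size Θ′ <_) eq lt)
      ... | inj₂ eq′ = inner outer Θ′ (trans eq′ eq) (rd (defect-< Θ Θ′ sub d ¬d))

    outer : ∀ {s} → Acc _<_ s → ∀ Θ → size Θ ≡ s → Goal Θ
    outer (acc rs) Θ eq = inner (λ Θ′ lt → outer (rs lt) Θ′ refl) Θ eq (<-wellFounded _)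

  theta-goal : ∀ Θ → Goal Θ
  theta-goal Θ = outer (<-wellFounded _) Θ refl

  -- Ears and the extension of cycles

  exit : ∀ {ok u v L} → Reach F ok u v → u ∈ L → v ∉ L → Σ[ x ∈ V ] Σ[ p ∈ V ] (x ∈ L × p ∉ L × x ~ p)
  exit (here _) u∈ v∉ = contradiction u∈ v∉
  exit {u = u} {L = L} (step {w = w} _ e r) u∈ v∉ with w ∈? L
  ... | yes w∈ = exit r w∈ v∉
  ... | no w∉  = u , w , u∈ , w∉ , e

  record Ear (x : V) (L : List V) (p : V) : Set where
    field
      {q y} : V
      {P}   : List V
      path  : Path p P q
      uniq  : Unique P
      out   : ∀ {v} → v ∈ P → v ∉ L
      q~y   : q ~ y
      y∈    : y ∈ L
      y≢x   : y ≢ x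

  -- The walk is stopped at its first vertex in `L`, which differs from `x` because the walk avoids
  -- `x`. If `p` recurs on the ear found from its successor, the loop is cut out.
  ear : ∀ {x L p v} → Reach F (_≢ x) p v → p ∉ L → v ∈ L → Ear x L p
  ear (here _) p∉ v∈ = contradiction v∈ p∉
  ear {x} {L} {p} (step {w = w} _ e r) p∉ v∈ with w ∈? L
  ... | yes w∈ = record { path = one ; uniq = [] ∷ [] ; out = λ { (here refl) → p∉ } ; q~y = e ; y∈ = w∈ ; y≢x = source r }
    where
    source : ∀ {u v} → Reach F (_≢ x) u v → u ≢ x
    source (here o)     = o
    source (step o _ _) = o
  ... | no w∉ with ear r w∉ v∈
  ...   | E with p ∈? Ear.P E
  ...     | no p∉P = record { path = e ∷ Ear.path E ; uniq = unique-∷ p∉P (Ear.uniq E)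
                            ; out = λ { (here refl) → p∉ ; (there v∈) → Ear.out E v∈ } ; q~y = Ear.q~y E ; y∈ = Ear.y∈ E ; y≢x = Ear.y≢x E }
  ...     | yes p∈P with Ear.path E | Ear.uniq E | Ear.out E
  ...       | path | uniq | out with split path p∈P
  ...         | at {α} _ ε = record { path = one ; uniq = [] ∷ [] ; out = λ { (here refl) → p∉ } ; q~y = Ear.q~y E ; y∈ = Ear.y∈ E ; y≢x = Ear.y≢x E }
  ...         | at {α} _ (seg d s) = record { path = d ∷ s ; uniq = unique-++ʳ α uniq ; out = out ∘ ∈-++⁺ʳ α
                                     ; q~y = Ear.q~y E ; y∈ = Ear.y∈ E ; y≢x = Ear.y≢x E }

  Longer : Cycle → Set
  Longer C = Σ[ C′ ∈ Cycle ] (length (Cycle.vs C) < length (Cycle.vs C′))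

  longer : ∀ (C : Cycle) {p s L t} → p ∉ Cycle.vs C → Path s L t → t ~ s → Unique L → (∀ {v} → v ∈ p ∷ Cycle.vs C → v ∈ L) → Longer C
  longer C p∉ P c u sub = cycle P c u , ⊆⇒length≤ (unique-∷ p∉ (Cycle.uniq C)) sub

  module _ (conn : Connected F) (conn₂ : ∀ x → ConnectedWithout F x) where

    -- If `x` and `y` are consecutive, the whole ear fits between them. If an end of the ear sees a
    -- cycle neighbour of its attachment, that one vertex is inserted. Otherwise claws at `x` and
    -- `y` supply the third edges of two triangles, and the cycle for the theta contains `p` and all
    -- of `C`.
    grow : ∀ (C : Cycle) {v} → v ∉ Cycle.vs C → Longer C
    grow C {v} v∉ with exit (conn (Cycle.s C) v) (start∈ (Cycle.path C)) v∉
    ... | x , p , x∈ , p∉ , x~p with rotate C x∈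
    ...   | L , u , w , x~u , path , w~x , π
        with ear (conn₂ x p u (λ { refl → p∉ x∈ }) (~⇒≢ x~u ∘ ≡-sym)) p∉ (∈-resp-↭ π (there (start∈ path)))
    ...     | E = by (split path y∈L)
      where
      open Ear E renaming (path to ep; uniq to eu; P to P; out to eo)
      y∈L : y ∈ L
      y∈L with ∈-resp-↭ (↭-sym π) y∈
      ... | here eq = contradiction eq y≢x
      ... | there i = i
      uxL : Unique (x ∷ L)
      uxL = unique-↭ (↭-sym π) (Cycle.uniq C)
      uPxL : Unique (P ++ x ∷ L)
      uPxL = Unique-++⁺ eu uxL (λ (i , j) → eo i (∈-resp-↭ π j))
      p∉xL : p ∉ x ∷ L
      p∉xL = p∉ ∘ ∈-resp-↭ π
      q∉xL : q ∉ x ∷ L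
      q∉xL = eo (end∈ ep) ∘ ∈-resp-↭ π
      whole : ∀ {M} → P ++ x ∷ L ↭ M → ∀ {v} → v ∈ p ∷ Cycle.vs C → v ∈ M
      whole ρ (here refl) = ∈-resp-↭ ρ (∈-++⁺ˡ (start∈ ep))
      whole ρ (there i)   = ∈-resp-↭ ρ (∈-++⁺ʳ P (∈-resp-↭ (↭-sym π) i))
      insert : ∀ {z s M t} → z ∉ x ∷ L → Path s M t → t ~ s → z ∷ x ∷ L ↭ M → Longer C
      insert {z} z∉ path′ c ρ = longer C (z∉ ∘ ∈-resp-↭ (↭-sym π)) path′ c (unique-↭ ρ (unique-∷ z∉ uxL))
        (λ { (here refl) → ∈-resp-↭ ρ (here refl) ; (there i) → ∈-resp-↭ ρ (there (∈-resp-↭ (↭-sym π) i)) })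
      by : Split y u w L → Longer C
      by (at ε post) = longer C p∉ (x~p ∷ join ep q~y path) w~x (unique-↭ ρ uPxL) (whole ρ)
        where
        ρ : P ++ x ∷ L ↭ x ∷ P ++ L
        ρ = solve 3 (λ a b c → a ⊕ (b ⊕ c) ⊜ b ⊕ (a ⊕ c)) ↭-refl P (x ∷ []) L
      by (at (seg _ _) ε) = longer C p∉ (x~u ∷ join path (~-sym q~y) (rev ep)) (~-sym x~p) (unique-↭ ρ uPxL) (whole ρ)
        where
        ρ : P ++ x ∷ L ↭ x ∷ L ++ reverse P
        ρ = ↭-trans (solve 3 (λ a b c → a ⊕ (b ⊕ c) ⊜ b ⊕ (c ⊕ a)) ↭-refl P (x ∷ []) L) (++⁺ˡ (x ∷ L) (↭-sym (↭-reverse P)))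
      by (at {α} {β} (seg {q = y⁻} pα dα) (seg {q = y⁺} dβ pβ)) with p ~? u | p ~? w | q ~? y⁻ | q ~? y⁺
      ... | yes d | _ | _ | _ = insert p∉xL (x~p ∷ (d ∷ path)) w~x (solve 3 (λ a b c → a ⊕ (b ⊕ c) ⊜ b ⊕ (a ⊕ c)) ↭-refl (p ∷ []) (x ∷ []) L)
      ... | no _ | yes d | _ | _ = insert p∉xL (x~u ∷ join path (~-sym d) one) (~-sym x~p) (solve 3 (λ a b c → a ⊕ (b ⊕ c) ⊜ b ⊕ (c ⊕ a)) ↭-refl (p ∷ []) (x ∷ []) L)
      ... | no _ | no _ | yes d | _ = insert q∉xL (x~u ∷ join pα (~-sym d) (q~y ∷ (dβ ∷ pβ))) w~x
              (solve 5 (λ q x a y b → q ⊕ (x ⊕ (a ⊕ (y ⊕ b))) ⊜ x ⊕ (a ⊕ (q ⊕ (y ⊕ b)))) ↭-refl (q ∷ []) (x ∷ []) α (y ∷ []) β)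
      ... | no _ | no _ | no _ | yes d = insert q∉xL (x~u ∷ join pα dα (~-sym q~y ∷ (d ∷ pβ))) w~x
              (solve 5 (λ q x a y b → q ⊕ (x ⊕ (a ⊕ (y ⊕ b))) ⊜ x ⊕ (a ⊕ (y ⊕ (q ⊕ b)))) ↭-refl (q ∷ []) (x ∷ []) α (y ∷ []) β)
      ... | no n₁ | no n₂ | no n₃ | no n₄ =
              longer C p∉ (Cycle.path C′) (Cycle.close C′) (Cycle.uniq C′) (proj₂ (theta-goal Θ) ∘ onθ Θ ∘ whole ρ)
        where
        u~w : u ~ w
        u~w = ≃⇒~ (disjoint α (unique-++ʳ (x ∷ []) uxL) (start∈ pα) (there (end∈ pβ)))
                (nc-skip x~p x~u (~-sym w~x)
                  (n₁ ∘ ≃⇒~ (λ { refl → p∉xL (there (start∈ path)) })) (n₂ ∘ ≃⇒~ (λ { refl → p∉xL (there (end∈ path)) })))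
        y⁻~y⁺ : y⁻ ~ y⁺
        y⁻~y⁺ = ≃⇒~ (disjoint α (unique-++ʳ (x ∷ []) uxL) (end∈ pα) (there (start∈ pβ)))
                (nc-skip (~-sym q~y) (~-sym dα) dβ
                  (n₃ ∘ ≃⇒~ (λ { refl → q∉xL (there (∈-++⁺ˡ (end∈ pα))) })) (n₄ ∘ ≃⇒~ (λ { refl → q∉xL (there (∈-++⁺ʳ α (there (start∈ pβ)))) })))
        ρ : P ++ x ∷ α ++ y ∷ β ↭ (x ∷ P ++ y ∷ []) ++ α ++ reverse β
        ρ = ↭-trans (solve 5 (λ q x a y b → q ⊕ (x ⊕ (a ⊕ (y ⊕ b))) ⊜ (x ⊕ (q ⊕ y)) ⊕ (a ⊕ b)) ↭-refl P (x ∷ []) α (y ∷ []) β)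
              (++⁺ˡ (x ∷ P ++ y ∷ []) (++⁺ˡ α (↭-sym (↭-reverse β))))
        Θ : Theta
        Θ = θ (x~p ∷ join ep q~y one) pα (rev pβ) (x~u , u~w , ~-sym w~x) (~-sym dα , y⁻~y⁺ , dβ) (unique-↭ ρ uPxL)
        C′ : Cycle
        C′ = proj₁ (theta-goal Θ)

    private
      extend : ∀ (C : Cycle) → Acc _<_ (n ∸ length (Cycle.vs C)) → HamCycle
      extend C (acc rs) with anyFin? (λ v → ¬? (v ∈? Cycle.vs C))
      ... | no none = C , λ v → decidable-stable (v ∈? Cycle.vs C) (λ v∉ → none (v , v∉))
      ... | yes (v , v∉) with grow C v∉
      ...   | C′ , lt = extend C′ (rs (∸-monoʳ-< lt (length≤n (Cycle.uniq C′))))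

    hamCycle : ∀ {u v : V} → u ≢ v → HamCycle
    hamCycle {u} {v} u≢v with conn u v
    ... | here _     = contradiction refl u≢v
    -- The start is a two-vertex cycle on the first edge of a walk from `u` to `v`.
    ... | step _ e _ = extend (cycle (e ∷ one) (~-sym e) ((~⇒≢ e ∷ []) ∷ [] ∷ [])) (<-wellFounded _)

-- From a spanning cycle to a cyclic enumeration

module _ {n : ℕ} (G : Graph n) where

  open Basics G

  private
    lookup-next : ∀ {s L t} → Path s L t → ∀ i j → toℕ j ≡ suc (toℕ i) → lookup L i ~ lookup L j
    lookup-next one zero zero ()
    lookup-next (e ∷ one) zero 1F _ = e
    lookup-next (e ∷ (_ ∷ _)) zero 1F _ = e
    lookup-next (_ ∷ p) (suc i) (suc j) eq = lookup-next p i j (suc-injective eq)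

    lookup-first : ∀ {s L t} → Path s L t → ∀ i → toℕ i ≡ 0 → lookup L i ≡ s
    lookup-first one zero _ = refl
    lookup-first (_ ∷ _) zero _ = refl

    lookup-last : ∀ {s L t} → Path s L t → ∀ i → suc (toℕ i) ≡ length L → lookup L i ≡ t
    lookup-last one zero _ = refl
    lookup-last (_ ∷ one) zero ()
    lookup-last (_ ∷ (_ ∷ _)) zero ()
    lookup-last (_ ∷ p) (suc i) eq = lookup-last p i (suc-injective eq)

    lookup-inj : ∀ {L : List V} → Unique L → ∀ {i j} → lookup L i ≡ lookup L j → i ≡ j
    lookup-inj {_ ∷ L} u {zero} {zero} _ = refl
    lookup-inj {_ ∷ L} u {zero} {suc j} eq = contradiction eq (head≢ u (∈-lookup j))
    lookup-inj {_ ∷ L} u {suc i} {zero} eq = contradiction (≡-sym eq) (head≢ u (∈-lookup i))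
    lookup-inj {_ ∷ L} (_ ∷ u) {suc i} {suc j} eq = cong suc (lookup-inj u eq)

    toℕ-cnext : ∀ {m} (i : Fin m) → toℕ (cnext i) ≡ suc (toℕ i) ⊎ (suc (toℕ i) ≡ m × toℕ (cnext i) ≡ 0)
    toℕ-cnext {suc m} i with suc (toℕ i) <? suc m
    ... | yes lt = inj₁ (toℕ-fromℕ< lt)
    ... | no ¬lt = inj₂ (≤-antisym (toℕ<n i) (≮⇒≥ ¬lt) , refl)

  hamCycle⇒hamiltonian : 3 ≤ n → HamCycle → Hamiltonian G
  hamCycle⇒hamiltonian 3≤n (cycle {L} p close u , sp) = 3≤n , c , c-inj , c-adj
    where
    len : n ≡ length L
    len = ≤-antisym (≤-trans (≤-reflexive (≡-sym (length-tabulate {n = n} (λ x → x)))) (⊆⇒length≤ (allFin⁺ n) (λ {v} _ → sp v))) (length≤n u)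
    c : V → V
    c i = lookup L (cast len i)
    c-inj : ∀ {i j} → c i ≡ c j → i ≡ j
    c-inj {i} {j} eq = toℕ-injective (trans (≡-sym (toℕ-cast len i)) (trans (cong toℕ (lookup-inj u eq)) (toℕ-cast len j)))
    c-adj : ∀ i → c i ~ c (cnext i)
    c-adj i with toℕ-cnext i
    ... | inj₁ eq = lookup-next p _ _ (trans (toℕ-cast len (cnext i)) (trans eq (cong suc (≡-sym (toℕ-cast len i)))))
    ... | inj₂ (eq , eq₀)
        rewrite lookup-last p (cast len i) (trans (cong suc (toℕ-cast len i)) (trans eq len))
              | lookup-first p (cast len (cnext i)) (trans (toℕ-cast len (cnext i)) eq₀) = close

-- Closure

data Closure {n : ℕ} (G : Graph n) : Graph n → Set where
  base : Closure G G
  next : ∀ {H x} → Closure G H → Eligible H x → Closure G (complete H x)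

module _ {n : ℕ} where

  infix 4 _⊆ᴱ_

  _⊆ᴱ_ : Graph n → Graph n → Set
  G ⊆ᴱ H = ∀ {u v} → Adj G u v → Adj H u v

  closure-⊆ : ∀ {G F : Graph n} → Closure G F → G ⊆ᴱ F
  closure-⊆ base e = e
  closure-⊆ (next {H} {x} c _) e = Completion.old H x (closure-⊆ c e)

  closure-noClaw : ∀ {G F : Graph n} → Closure G F → Basics.NoClaw G → Basics.NoClaw F
  closure-noClaw base nc = nc
  closure-noClaw (next {H} {x} c _) nc = Completion.noClaw-complete H x (closure-noClaw c nc)

  closure-ham : ∀ {G F : Graph n} → Closure G F → Basics.NoClaw G → Basics.HamCycle F → Basics.HamCycle G
  closure-ham base nc h = h
  closure-ham (next {H} {x} c el) nc h = closure-ham c nc (Uncomplete.uncomplete H x (closure-noClaw c nc) el h)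

  module _ (H : Graph n) where

    open Basics H
    open Visits H

    eligible? : Dec (Σ[ x ∈ V ] Eligible H x)
    eligible? with anyFin? (λ x → anyFin? (λ u → anyFin? (λ w → anyFin? (λ z →
                     ((x ~? u) ×-dec ((x ~? w) ×-dec (x ~? z))) ×-dec ((u ~? w) ×-dec ((w ~? z) ×-dec ¬? (u ≃? z)))))))
    ... | yes (x , u , w , z , (xu , xw , xz) , uw , wz , ¬uz) =
      yes (x , record { xu = xu ; xw = xw ; xz = xz ; uw = uw ; wz = wz ; u≄z = ¬uz })
    ... | no none = no λ { (x , el) → let open Eligible el in none (x , u , w , z , (xu , xw , xz) , uw , wz , u≄z) }

    -- In an induced diamond on the edge `pq` with tips `x` and `y`, the vertex `p` is eligible
    -- through `x`, `q`, `y`.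
    ¬eligible⇒noDiamond : ¬ (Σ[ x ∈ V ] Eligible H x) → NoDiamond
    ¬eligible⇒noDiamond ¬el e (inj₁ refl , _) (yp , _) = ≃-sym yp
    ¬eligible⇒noDiamond ¬el e (inj₂ _ , inj₁ refl) (_ , yq) = ≃-sym yq
    ¬eligible⇒noDiamond ¬el e (xp , inj₂ _) (inj₁ refl , _) = xp
    ¬eligible⇒noDiamond ¬el e (_ , xq) (inj₂ _ , inj₁ refl) = xq
    ¬eligible⇒noDiamond ¬el {x = x} {y} e (inj₂ xp , inj₂ xq) (inj₂ yp , inj₂ yq) with x ≃? y
    ... | yes h = h
    ... | no ¬h = contradiction (_ , record { xu = ~-sym xp ; xw = e ; xz = ~-sym yp ; uw = xq ; wz = ~-sym yq ; u≄z = ¬h }) ¬el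

    edges : ℕ
    edges = length (filter (λ (u , v) → u ~? v) (pairs n))

  edges-< : ∀ H x → Eligible H x → edges H < edges (complete H x)
  edges-< H x el = count-< (λ (u , v) → u ~? v) (λ (u , v) → u H′.~? v) (Completion.old H x) (∈-pairs u z)
      (Completion.new H x xu xz (u≄z ∘ inj₁)) (u≄z ∘ inj₂)
    where
    open Basics H
    module H′ = Basics (complete H x)
    open Eligible el

  private
    close-from : ∀ {G} H → Acc _<_ (length (pairs n) ∸ edges H) → Closure G H → Σ[ F ∈ Graph n ] (Closure G F × Visits.NoDiamond F)
    close-from H (acc rs) c with eligible? H
    ... | no ¬el       = H , c , ¬eligible⇒noDiamond H ¬el
    ... | yes (x , el) = close-from (complete H x) (rs (∸-monoʳ-< (edges-< H x el) (length-filter _ (pairs n)))) (next c el)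

  close : ∀ G → Σ[ F ∈ Graph n ] (Closure G F × Visits.NoDiamond F)
  close G = close-from G (<-wellFounded _) base

-- Connectedness of `G` inside the cliques of `F`

module _ {n : ℕ} {G : Graph n} where

  open Basics G

  reach-map : ∀ {H ok ok′} → G ⊆ᴱ H → (∀ {v} → ok v → ok′ v) → ∀ {u v} → Reach G ok u v → Reach H ok′ u v
  reach-map f g (here o)     = here (g o)
  reach-map f g (step o e r) = step (g o) (f e) (reach-map f g r)

  reach-source : ∀ {ok u v} → Reach G ok u v → ok u
  reach-source (here o)     = o
  reach-source (step o _ _) = o

  reach-trans : ∀ {ok u v w} → Reach G ok u v → Reach G ok v w → Reach G ok u w
  reach-trans (here _)     s = s
  reach-trans (step o e r) s = step o e (reach-trans r s)

  reach-sym : ∀ {ok u v} → Reach G ok u v → Reach G ok v u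
  reach-sym (here o)     = here o
  reach-sym (step o e r) = reach-trans (reach-sym r) (step (reach-source r) (~-sym e) (here o))

module _ {n : ℕ} {G F : Graph n} (ncG : Basics.NoClaw G) (nd : Visits.NoDiamond F) where

  open Visits F
  private module F = Basics F

  -- Induction over the completions. For a new edge, `w₀` is a hub: claw-freeness at `x` puts each
  -- neighbour of `x` into the closed neighbourhood of `u₀` or `z₀`, and both see `w₀`. These steps
  -- are older edges, and their `F`-cliques coincide with that of `u` and `v`.
  clique-connected : ∀ {H} → Closure G H → H ⊆ᴱ F → ∀ {u v} → Adj H u v → Reach G (K u v) u v
  clique-connected base sub e =
    step (inj₁ refl , inj₂ (sub e)) e (here (inj₂ (F.~-sym (sub e)) , inj₁ refl))
  clique-connected (next {H} {x} c el) sub {u} {v} e with Completion.inv H x e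
  ... | inj₁ d = clique-connected c (sub ∘ Completion.old H x) d
  ... | inj₂ (xu , xv) = reach-trans (to-w xu) (reach-sym (to-w xv))
    where
    open Basics H
    open Eligible el renaming (u to u₀; w to w₀; z to z₀; xu to xu₀; xw to xw₀; xz to xz₀)
    clique : ∀ {a b} → x ~ a → x ~ b → a F.≃ b
    clique xa xb with Completion.nbhd-clique H x (inj₂ xa) (inj₂ xb)
    ... | inj₁ eq = inj₁ eq
    ... | inj₂ d  = inj₂ (sub d)
    hop : ∀ {a b} → x ~ a → x ~ b → a ~ b → Reach G (K u v) a b
    hop xa xb d = reach-map (λ z → z) (λ k → nd d′ k (clique xu xa , clique xu xb) , nd d′ k (clique xv xa , clique xv xb))
                    (clique-connected c (sub ∘ Completion.old H x) d)
      where d′ = sub (Completion.old H x d)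
    to-w : ∀ {a} → x ~ a → Reach G (K u v) a w₀
    to-w {a} xa = by (closure-noClaw c ncG xa xu₀ xz₀)
      where
      by : a ≃ u₀ ⊎ u₀ ≃ z₀ ⊎ a ≃ z₀ → Reach G (K u v) a w₀
      by (inj₁ (inj₁ refl))        = hop xu₀ xw₀ uw
      by (inj₁ (inj₂ d))           = reach-trans (hop xa xu₀ d) (hop xu₀ xw₀ uw)
      by (inj₂ (inj₁ h))           = contradiction h u≄z
      by (inj₂ (inj₂ (inj₁ refl))) = hop xz₀ xw₀ (~-sym wz)
      by (inj₂ (inj₂ (inj₂ d)))    = reach-trans (hop xa xz₀ d) (hop xz₀ xw₀ (~-sym wz))

-- Pendant paths of a q-heavy net under completion

record Pendant {n : ℕ} (a b c τ σ : Fin n) (H : Graph n) : Set where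
  field
    N-b : ∀ {v} → Adj H b v → v ≡ a ⊎ v ≡ c ⊎ v ≡ τ
    N-τ : ∀ {v} → Adj H τ v → v ≡ b ⊎ v ≡ σ

reverse-eligible : ∀ {n} {H : Graph n} {x} → Eligible H x → Eligible H x
reverse-eligible {H = H} el = record { xu = xz ; xw = xw ; xz = xu ; uw = ~-sym wz ; wz = ~-sym uw ; u≄z = u≄z ∘ ≃-sym }
  where
  open Basics H
  open Eligible el

module PendantStep {n : ℕ} {a b c τ σ τ′ σ′ : Fin n} (H : Graph n) (nc : Basics.NoClaw H)
  (a≢b : a ≢ b) (a≢c : a ≢ c) (b≢c : b ≢ c) (a≢σ : a ≢ σ) (a≢σ′ : a ≢ σ′) (b≢σ′ : b ≢ σ′) (c≢σ : c ≢ σ)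
  (P : Pendant a b c τ σ H) (P′ : Pendant a c b τ′ σ′ H) where

  open Basics H
  open Pendant P
  open Pendant P′ renaming (N-b to N-c; N-τ to N-τ′)

  private
    τ≁a : ¬ τ ~ a
    τ≁a e = [ a≢b , a≢σ ]′ (N-τ e)
    τ≁c : ¬ τ ~ c
    τ≁c e = [ b≢c ∘ ≡-sym , c≢σ ]′ (N-τ e)
    τ′≁a : ¬ τ′ ~ a
    τ′≁a e = [ a≢c , a≢σ′ ]′ (N-τ′ e)

    hub : ∀ {x v} (el : Eligible H x) → x ~ v → Σ[ el ∈ Eligible H x ] v ≃ Eligible.u el
    hub el xv with nc xv (Eligible.xu el) (Eligible.xz el)
    ... | inj₁ h        = el , h
    ... | inj₂ (inj₁ h) = contradiction h (Eligible.u≄z el)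
    ... | inj₂ (inj₂ h) = reverse-eligible el , h

    ¬τ : ∀ {x} → Eligible H x → x ≢ τ
    ¬τ el refl = by (N-τ xu) (N-τ xw) (N-τ xz)
      where
      open Eligible el
      by : u ≡ b ⊎ u ≡ σ → w ≡ b ⊎ w ≡ σ → z ≡ b ⊎ z ≡ σ → ⊥
      by (inj₁ p) (inj₁ q) _ = ~⇒≢ uw (trans p (≡-sym q))
      by (inj₂ p) (inj₂ q) _ = ~⇒≢ uw (trans p (≡-sym q))
      by _ (inj₁ p) (inj₁ q) = ~⇒≢ wz (trans p (≡-sym q))
      by _ (inj₂ p) (inj₂ q) = ~⇒≢ wz (trans p (≡-sym q))
      by (inj₁ p) (inj₂ _) (inj₁ q) = u≄z (inj₁ (trans p (≡-sym q)))
      by (inj₂ p) (inj₁ _) (inj₂ q) = u≄z (inj₁ (trans p (≡-sym q)))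

    -- Eligibility needs a path on three distinct vertices in the neighbourhood, and among `a`, `c`,
    -- `τ` the vertex `τ` sees neither of the others.
    ¬b : ∀ {x} → Eligible H x → x ≢ b
    ¬b el refl = by (N-b xu) (N-b xw) (N-b xz)
      where
      open Eligible el
      by : u ≡ a ⊎ u ≡ c ⊎ u ≡ τ → w ≡ a ⊎ w ≡ c ⊎ w ≡ τ → z ≡ a ⊎ z ≡ c ⊎ z ≡ τ → ⊥
      by (inj₁ refl) (inj₁ refl) _ = ~⇒≢ uw refl
      by (inj₁ refl) (inj₂ (inj₂ refl)) _ = τ≁a (~-sym uw)
      by (inj₁ refl) (inj₂ (inj₁ refl)) (inj₁ refl) = u≄z (inj₁ refl)
      by (inj₁ refl) (inj₂ (inj₁ refl)) (inj₂ (inj₁ refl)) = ~⇒≢ wz refl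
      by (inj₁ refl) (inj₂ (inj₁ refl)) (inj₂ (inj₂ refl)) = τ≁c (~-sym wz)
      by (inj₂ (inj₁ refl)) (inj₂ (inj₁ refl)) _ = ~⇒≢ uw refl
      by (inj₂ (inj₁ refl)) (inj₂ (inj₂ refl)) _ = τ≁c (~-sym uw)
      by (inj₂ (inj₁ refl)) (inj₁ refl) (inj₁ refl) = ~⇒≢ wz refl
      by (inj₂ (inj₁ refl)) (inj₁ refl) (inj₂ (inj₁ refl)) = u≄z (inj₁ refl)
      by (inj₂ (inj₁ refl)) (inj₁ refl) (inj₂ (inj₂ refl)) = τ≁a (~-sym wz)
      by (inj₂ (inj₂ refl)) (inj₁ refl) _ = τ≁a uw
      by (inj₂ (inj₂ refl)) (inj₂ (inj₁ refl)) _ = τ≁c uw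
      by (inj₂ (inj₂ refl)) (inj₂ (inj₂ refl)) _ = ~⇒≢ uw refl

    common-ab : ∀ {v} → a ~ v → b ~ v → v ≡ c
    common-ab av bv with N-b bv
    ... | inj₁ refl        = contradiction refl (~⇒≢ av)
    ... | inj₂ (inj₁ h)    = h
    ... | inj₂ (inj₂ refl) = contradiction (~-sym av) τ≁a

    common-ac : ∀ {v} → a ~ v → c ~ v → v ≡ b
    common-ac av cv with N-c cv
    ... | inj₁ refl        = contradiction refl (~⇒≢ av)
    ... | inj₂ (inj₁ h)    = h
    ... | inj₂ (inj₂ refl) = contradiction (~-sym av) τ′≁a

    -- In the neighbourhood of `a`, the vertices `b` and `c` have no neighbours except possibly each
    -- other, whereas `hub` ties `b` to a path on three vertices.
    ¬a : ∀ {x} → Eligible H x → x ~ b → x ≢ a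
    ¬a el xb refl with hub el xb
    ... | el′ , inj₁ refl with common-ab (Eligible.xw el′) (Eligible.uw el′)
    ...   | refl = Eligible.u≄z el′ (inj₁ (≡-sym (common-ac (Eligible.xz el′) (Eligible.wz el′))))
    ¬a el xb refl | el′ , inj₂ bu with common-ab (Eligible.xu el′) bu
    ...   | refl with common-ac (Eligible.xw el′) (Eligible.uw el′)
    ...     | refl = Eligible.u≄z el′ (inj₁ (≡-sym (common-ab (Eligible.xz el′) (Eligible.wz el′))))

    ¬σ : ∀ {x} → Eligible H x → x ~ τ → x ≢ σ
    ¬σ el xτ refl with hub el xτ
    ... | el′ , inj₁ refl = no-common (Eligible.xw el′) (Eligible.uw el′)
      where
      no-common : ∀ {v} → σ ~ v → ¬ τ ~ v
      no-common sv τv with N-τ τv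
      ... | inj₂ refl = ~⇒≢ sv refl
      ... | inj₁ refl with N-b (~-sym sv)
      ...   | inj₁ h        = a≢σ (≡-sym h)
      ...   | inj₂ (inj₁ h) = c≢σ (≡-sym h)
      ...   | inj₂ (inj₂ h) = ~⇒≢ xτ h
    ¬σ el xτ refl | el′ , inj₂ τu with N-τ τu
    ... | inj₂ h = ~⇒≢ (Eligible.xu el′) (≡-sym h)
    ... | inj₁ refl with N-b (~-sym (Eligible.xu el′))
    ...   | inj₁ h        = a≢σ (≡-sym h)
    ...   | inj₂ (inj₁ h) = c≢σ (≡-sym h)
    ...   | inj₂ (inj₂ h) = ~⇒≢ xτ h

  -- That `c` is not eligible is assumed, because it is `b-not-eligible` of the instance with `b`
  -- and `c` exchanged.
  b-untouched : (¬ (Eligible H c)) → ∀ {x} → Eligible H x → ¬ x ~ b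
  b-untouched ¬c {x} el xb with N-b (~-sym xb)
  ... | inj₁ h           = ¬a el xb h
  ... | inj₂ (inj₁ refl) = ¬c el
  ... | inj₂ (inj₂ h)    = ¬τ el h

  τ-untouched : ∀ {x} → Eligible H x → ¬ x ~ τ
  τ-untouched el xτ with N-τ (~-sym xτ)
  ... | inj₁ h = ¬b el h
  ... | inj₂ h = ¬σ el xτ h

  b-not-eligible : ¬ Eligible H b
  b-not-eligible el = ¬b el refl

module _ {n : ℕ} {a b c τ σ τ′ σ′ : Fin n}
  (a≢b : a ≢ b) (a≢c : a ≢ c) (b≢c : b ≢ c) (a≢σ : a ≢ σ) (a≢σ′ : a ≢ σ′) (b≢σ′ : b ≢ σ′) (c≢σ : c ≢ σ) where

  pendant-closure : ∀ {G F : Graph n} → Basics.NoClaw G → Closure G F →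
    Pendant a b c τ σ G × Pendant a c b τ′ σ′ G → Pendant a b c τ σ F × Pendant a c b τ′ σ′ F
  pendant-closure nc base P = P
  pendant-closure nc (next {H} {x} cl el) P with pendant-closure nc cl P
  ... | Q , Q′ = record { N-b = Pendant.N-b Q ∘ same (S.b-untouched S′.b-not-eligible el) ; N-τ = Pendant.N-τ Q ∘ same (S.τ-untouched el) }
               , record { N-b = Pendant.N-b Q′ ∘ same (S′.b-untouched S.b-not-eligible el) ; N-τ = Pendant.N-τ Q′ ∘ same (S′.τ-untouched el) }
    where
    module S  = PendantStep H (closure-noClaw cl nc) a≢b a≢c b≢c a≢σ a≢σ′ b≢σ′ c≢σ Q Q′
    module S′ = PendantStep H (closure-noClaw cl nc) a≢c a≢b (b≢c ∘ ≡-sym) a≢σ′ a≢σ c≢σ b≢σ′ Q′ Q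
    same : ∀ {u v} → ¬ Adj H x u → Adj (complete H x) u v → Adj H u v
    same ¬xu e = [ (λ d → d) , (λ (xu , _) → contradiction xu ¬xu) ]′ (Completion.inv H x e)

-- Induced nets and chord-restricted walks

module _ {n : ℕ} (G : Graph n) where

  open Basics G

  record NetIn (c₁ c₂ c₃ τ₁ τ₂ τ₃ : V) : Set where
    field
      c₁₂ : c₁ ~ c₂
      c₂₃ : c₂ ~ c₃
      c₁₃ : c₁ ~ c₃
      d₁  : c₁ ~ τ₁
      d₂  : c₂ ~ τ₂
      d₃  : c₃ ~ τ₃
      n₁₂ : ¬ c₁ ≃ τ₂
      n₁₃ : ¬ c₁ ≃ τ₃
      n₂₁ : ¬ c₂ ≃ τ₁
      n₂₃ : ¬ c₂ ≃ τ₃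
      n₃₁ : ¬ c₃ ≃ τ₁
      n₃₂ : ¬ c₃ ≃ τ₂
      t₁₂ : ¬ τ₁ ≃ τ₂
      t₁₃ : ¬ τ₁ ≃ τ₃
      t₂₃ : ¬ τ₂ ≃ τ₃

    private
      f : Fin 6 → V
      f 0F                               = c₁
      f 1F                         = c₂
      f 2F                   = c₃
      f 3F             = τ₁
      f 4F       = τ₂
      f 5F = τ₃

      off : ∀ {u v} → ¬ u ≃ v → adj G u v ≡ false
      off h = ¬~⇒false (h ∘ inj₂)

      off′ : ∀ {u v} → ¬ u ≃ v → adj G v u ≡ false
      off′ h = ¬~⇒false (h ∘ inj₂ ∘ ~-sym)

      f-adj : ∀ i j → adj G (f i) (f j) ≡ netAdj i j
      f-adj 0F 0F = irrefl G c₁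
      f-adj 0F 1F = c₁₂
      f-adj 0F 2F = c₁₃
      f-adj 0F 3F = d₁
      f-adj 0F 4F = off n₁₂
      f-adj 0F 5F = off n₁₃
      f-adj 1F 0F = ~-sym c₁₂
      f-adj 1F 1F = irrefl G c₂
      f-adj 1F 2F = c₂₃
      f-adj 1F 3F = off n₂₁
      f-adj 1F 4F = d₂
      f-adj 1F 5F = off n₂₃
      f-adj 2F 0F = ~-sym c₁₃
      f-adj 2F 1F = ~-sym c₂₃
      f-adj 2F 2F = irrefl G c₃
      f-adj 2F 3F = off n₃₁
      f-adj 2F 4F = off n₃₂
      f-adj 2F 5F = d₃
      f-adj 3F 0F = ~-sym d₁
      f-adj 3F 1F = off′ n₂₁
      f-adj 3F 2F = off′ n₃₁
      f-adj 3F 3F = irrefl G τ₁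
      f-adj 3F 4F = off t₁₂
      f-adj 3F 5F = off t₁₃
      f-adj 4F 0F = off′ n₁₂
      f-adj 4F 1F = ~-sym d₂
      f-adj 4F 2F = off′ n₃₂
      f-adj 4F 3F = off′ t₁₂
      f-adj 4F 4F = irrefl G τ₂
      f-adj 4F 5F = off t₂₃
      f-adj 5F 0F = off′ n₁₃
      f-adj 5F 1F = off′ n₂₃
      f-adj 5F 2F = ~-sym d₃
      f-adj 5F 3F = off′ t₁₃
      f-adj 5F 4F = off′ t₂₃
      f-adj 5F 5F = irrefl G τ₃
      -- No two vertices of the net have the same neighbourhood, so injectivity of the embedding
      -- follows from its adjacency table.
      rows-distinct : ∀ i j → (∀ k → netAdj i k ≡ netAdj j k) → i ≡ j
      rows-distinct = from-yes (all? λ i → all? λ j → all? (λ k → netAdj i k Bool.≟ netAdj j k) →-dec (i ≟ j))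

    net : InducedNet G
    net = record
      { emb     = f
      ; emb-inj = λ {i} {j} eq → rows-distinct i j (λ k → trans (≡-sym (f-adj i k)) (trans (cong (λ v → adj G v (f k)) eq) (f-adj j k)))
      ; emb-adj = f-adj
      }

  -- Walks of which no three or four consecutive vertices have a chord

  data Far (x : V) : ∀ {s L t} → Path s L t → Set where
    far₁ : ∀ {s} → Far x (one {s})
    far₂ : ∀ {s y L t} {d : s ~ y} {p : Path y L t} → ¬ x ≃ y → Far x (d ∷ p)

  -- Four consecutive vertices will serve as two corners of a net between their pendant vertices;
  -- these are the non-edges that this takes.
  data Taut : ∀ {s L t} → Path s L t → Set where
    taut₁ : ∀ {s} → Taut (one {s})
    taut₂ : ∀ {s t} {d : s ~ t} → Taut (d ∷ one)
    taut₃ : ∀ {x y z L t} {d : x ~ y} {e : y ~ z} {p : Path z L t} → ¬ x ≃ z → Far x p → Taut (e ∷ p) → Taut (d ∷ (e ∷ p))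

  taut-tail : ∀ {x y L t} {d : x ~ y} {p : Path y L t} → Taut (d ∷ p) → Taut p
  taut-tail taut₂         = taut₁
  taut-tail (taut₃ _ _ h) = h

  record Tight (x t : V) (L : List V) : Set where
    constructor tight
    field
      {L′} : List V
      path : Path x L′ t
      taut : Taut path
      sub  : ∀ {v} → v ∈ L′ → v ∈ L

  private
    weaken : ∀ {x t y L} → Tight x t L → Tight x t (y ∷ L)
    weaken (tight p h s) = tight p h (there ∘ s)

    weaken₁ : ∀ {x t y L} → Tight x t (x ∷ L) → Tight x t (x ∷ y ∷ L)
    weaken₁ (tight p h s) = tight p h (λ v∈ → skip (s v∈))
      where
      skip : ∀ {v x y : V} {L} → v ∈ x ∷ L → v ∈ x ∷ y ∷ L
      skip (here e)  = here e
      skip (there i) = there (there i)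

    -- A chord from `x` is used as a shortcut and the check is repeated on the shorter walk; if `x`
    -- itself recurs, the loop is dropped.
    push : ∀ {x y L t} → x ~ y → (p : Path y L t) → Taut p → Tight x t (x ∷ L)
    push e one _ = tight (e ∷ one) taut₂ (λ v∈ → v∈)
    push {x} e (_∷_ {w = z} d p) h with x ≃? z
    ... | yes (inj₁ refl) = weaken (weaken (tight p (taut-tail h) (λ v∈ → v∈)))
    ... | yes (inj₂ e′)   = weaken₁ (push e′ p (taut-tail h))
    push {x} e (d ∷ one) h | no ¬xz = tight (e ∷ (d ∷ one)) (taut₃ ¬xz far₁ h) (λ v∈ → v∈)
    push {x} e (d ∷ (_∷_ {w = z′} d′ p)) h | no ¬xz with x ≃? z′
    ... | yes (inj₁ refl) = weaken (weaken (weaken (tight p (taut-tail (taut-tail h)) (λ v∈ → v∈))))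
    ... | yes (inj₂ e′)   = weaken₁ (weaken₁ (push e′ p (taut-tail (taut-tail h))))
    ... | no ¬xz′         = tight (e ∷ (d ∷ (d′ ∷ p))) (taut₃ ¬xz (far₂ ¬xz′) h) (λ v∈ → v∈)

  tighten : ∀ {s L t} → Path s L t → Tight s t L
  tighten one = tight one taut₁ (λ v∈ → v∈)
  tighten (e ∷ p) with tighten p
  ... | tight q h s with push e q h
  ...   | tight q′ h′ s′ = tight q′ h′ (λ v∈ → lift (s′ v∈))
    where
    lift : ∀ {v} → v ∈ _ ∷ _ → v ∈ _ ∷ _
    lift (here e)  = here e
    lift (there i) = there (s i)

  taut-interior : ∀ {s L t v} {p : Path s L t} → Taut p → v ∈ L → v ≢ s → v ≢ t → Σ[ x ∈ V ] Σ[ z ∈ V ] (x ∈ L × z ∈ L × v ~ x × v ~ z × ¬ x ≃ z)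
  taut-interior taut₁ (here e) v≢s _ = contradiction e v≢s
  taut-interior taut₂ (here e) v≢s _ = contradiction e v≢s
  taut-interior taut₂ (there (here e)) _ v≢t = contradiction e v≢t
  taut-interior (taut₃ _ _ _) (here e) v≢s _ = contradiction e v≢s
  taut-interior {v = v} (taut₃ {x} {y} {z} {d = d} {e = e} {p = p} ¬xz _ h) (there v∈) v≢s v≢t with v ≟ y
  ... | yes refl = x , z , here refl , there (there (start∈ p)) , ~-sym d , e , ¬xz
  ... | no v≢y with taut-interior h v∈ v≢y v≢t
  ...   | x′ , z′ , i , j , e₁ , e₂ , ¬e = x′ , z′ , there i , there j , e₁ , e₂ , ¬e

  reach-path : ∀ {ok u v} → Reach G ok u v → Σ[ L ∈ List V ] (Path u L v × (∀ {w} → w ∈ L → ok w))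
  reach-path (here o) = _ , one , λ { (here refl) → o }
  reach-path (step o e r) with reach-path r
  ... | L , p , f = _ , e ∷ p , λ { (here refl) → o ; (there i) → f i }

  exit-nbhd : ∀ {ok a s t} → Reach G ok s t → a ≃ s → ¬ a ≃ t →
              Σ[ p ∈ V ] Σ[ q ∈ V ] (a ≃ p × ¬ a ≃ q × p ~ q × ok p × ok q)
  exit-nbhd (here _) as ¬at = contradiction as ¬at
  exit-nbhd {a = a} (step {u = u} {w = w} o e r) as ¬at with a ≃? w
  ... | yes aw = exit-nbhd r aw ¬at
  ... | no ¬aw = u , w , as , ¬aw , e , o , reach-source r

-- Small degrees as neighbourhoods, and comparison of degrees

module _ {n : ℕ} (G : Graph n) where

  open Basics G
  open Degrees G

  degree-≥ : ∀ {v L} → Unique L → (∀ {w} → w ∈ L → v ~ w) → length L ≤ deg G v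
  degree-≥ {v} {L} u f with complement u
  ... | M , π = ≤-trans (≤-trans (all-nbrs L f) (m≤m+n _ _)) (≤-reflexive (≡-sym (Σᶠ-split (ind v) {L} {M} π)))
    where
    all-nbrs : ∀ L → (∀ {w} → w ∈ L → v ~ w) → length L ≤ sum (map (ind v) L)
    all-nbrs [] f = z≤n
    all-nbrs (w ∷ L) f rewrite ind-yes (f (here refl)) = s≤s (all-nbrs L (f ∘ there))

  degree-≤ : ∀ {v L} → Unique L → (∀ {w} → w ∉ L → ¬ v ~ w) → deg G v ≤ length L
  degree-≤ {v} {L} u f with complement u
  ... | M , π = ≤-trans (≤-reflexive (Σᶠ-split (ind v) {L} {M} π))
                  (≤-trans (+-mono-≤ (sum-≤length (ind v) L (λ _ → ind≤1 v _)) (none M (λ w∈ → f (λ w∈L → disjoint L (unique-↭ π (allFin⁺ n)) w∈L w∈ refl))))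
                    (≤-reflexive (+-identityʳ _)))
    where
    none : ∀ M → (∀ {w} → w ∈ M → ¬ v ~ w) → sum (map (ind v) M) ≤ 0
    none [] f = z≤n
    none (w ∷ M) f rewrite ind-no (f (here refl)) = none M (f ∘ there)

  degree-three : ∀ {v x y z} → deg G v ≡ 3 → v ~ x → v ~ y → v ~ z → x ≢ y → x ≢ z → y ≢ z → ∀ {w} → v ~ w → w ≡ x ⊎ w ≡ y ⊎ w ≡ z
  degree-three {x = x} {y} {z} d vx vy vz x≢y x≢z y≢z {w} vw with w ≟ x | w ≟ y | w ≟ z
  ... | yes e | _ | _ = inj₁ e
  ... | no _ | yes e | _ = inj₂ (inj₁ e)
  ... | no _ | no _ | yes e = inj₂ (inj₂ e)
  ... | no w≢x | no w≢y | no w≢z = contradiction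
      (degree-≥ {L = w ∷ x ∷ y ∷ z ∷ []} ((w≢x ∷ w≢y ∷ w≢z ∷ []) ∷ (x≢y ∷ x≢z ∷ []) ∷ (y≢z ∷ []) ∷ [] ∷ [])
        (λ { (here refl) → vw ; (there (here refl)) → vx ; (there (there (here refl))) → vy ; (there (there (there (here refl)))) → vz }))
      (λ le → <-irrefl (≡-sym d) le)

  degree-two : ∀ {v x} → deg G v ≡ 2 → v ~ x → Σ[ y ∈ V ] (v ~ y × y ≢ x × (∀ {w} → v ~ w → w ≡ x ⊎ w ≡ y))
  degree-two {v} {x} d vx with anyFin? (λ y → (v ~? y) ×-dec ¬? (y ≟ x))
  ... | no none = contradiction (degree-≤ {v} {x ∷ []} ([] ∷ []) (λ {w} w∉ vw → none (w , vw , w∉ ∘ here))) (λ le → <-irrefl refl (≤-trans (≤-reflexive (≡-sym d)) le))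
  ... | yes (y , vy , y≢x) = y , vy , y≢x , only
    where
    only : ∀ {w} → v ~ w → w ≡ x ⊎ w ≡ y
    only {w} vw with w ≟ x | w ≟ y
    ... | yes e | _ = inj₁ e
    ... | no _ | yes e = inj₂ e
    ... | no w≢x | no w≢y = contradiction
        (degree-≥ {L = w ∷ x ∷ y ∷ []} ((w≢x ∷ w≢y ∷ []) ∷ ((y≢x ∘ ≡-sym) ∷ []) ∷ [] ∷ [])
          (λ { (here refl) → vw ; (there (here refl)) → vx ; (there (there (here refl))) → vy }))
        (λ le → <-irrefl (≡-sym d) le)

module _ {n : ℕ} {G F : Graph n} (sub : G ⊆ᴱ F) where

  private
    module F = Basics F
    open Basics G
    module dG = Degrees G
    module dF = Degrees F

    ind-mono : ∀ {u v w} → (u ~ w → v F.~ w) → dG.ind u w ≤ dF.ind v w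
    ind-mono {u} {v} {w} f with u ~? w
    ... | yes e rewrite dF.ind-yes (f e) = dG.ind≤1 u w
    ... | no ¬e rewrite dG.ind-no ¬e = z≤n

  degree-mono : ∀ v → deg G v ≤ deg F v
  degree-mono v = sum-mono (dG.ind v) (dF.ind v) (allFin n) (λ _ → ind-mono {v} {v} sub)

  -- If N_G[c] lies in the F-clique of a, then deleting a from one side and c from the other compares the two degrees.
  degree-clique : ∀ {c a} → a F.≃ c → (∀ {w} → c ~ w → a F.≃ w) → deg G c ≤ deg F a
  degree-clique {c} {a} ac f with a ≟ c
  ... | yes refl = degree-mono a
  ... | no a≢c with complement {n} {a ∷ c ∷ []} ((a≢c ∷ []) ∷ [] ∷ [])
  ...   | M , π = begin
    deg G c                                                   ≡⟨ Σᶠ-split (dG.ind c) {a ∷ c ∷ []} {M} π ⟩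
    dG.ind c a + (dG.ind c c + 0) + sum (map (dG.ind c) M)    ≤⟨ +-mono-≤ (+-mono-≤ (dG.ind≤1 c a) (≤-reflexive (cong (_+ 0) (dG.ind-self c)))) (sum-mono (dG.ind c) (dF.ind a) M (λ w∈ → ind-mono (λ cw → F.≃⇒~ (λ eq → disjoint (a ∷ c ∷ []) uM (here refl) w∈ eq) (f cw)))) ⟩
    1 + 0 + sum (map (dF.ind a) M)                            ≡⟨ cong (_+ sum (map (dF.ind a) M)) (≡-sym two) ⟩
    dF.ind a a + (dF.ind a c + 0) + sum (map (dF.ind a) M)    ≡⟨ ≡-sym (Σᶠ-split (dF.ind a) {a ∷ c ∷ []} {M} π) ⟩
    deg F a                                                   ∎
    where
    open ≤-Reasoning
    uM : Unique ((a ∷ c ∷ []) ++ M)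
    uM = unique-↭ π (allFin⁺ n)
    two : dF.ind a a + (dF.ind a c + 0) ≡ 1
    two rewrite dF.ind-self a | dF.ind-yes (F.≃⇒~ a≢c ac) = refl

-- Nets of F yield nets of G

module Extraction {n : ℕ} {G F : Graph n} (nc : Basics.NoClaw G) (sub : G ⊆ᴱ F) (nd : Visits.NoDiamond F)
  (conn : ∀ {u v} → Adj F u v → Reach G (Visits.K F u v) u v) where

  open Basics G
  open Visits F using (K)
  open NetCentres F using (Tails)
  private module F = Basics F

  ≃-sub : ∀ {u v} → u ≃ v → u F.≃ v
  ≃-sub (inj₁ e) = inj₁ e
  ≃-sub (inj₂ e) = inj₂ (sub e)

  -- A pendant candidate at `a` in `G`, taken from the `F`-clique of `a` and `t`. The alternative in
  -- `stub` is what keeps two legs apart.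
  record Leg (a t : V) : Set where
    field
      {m}  : V
      a~m  : a ~ m
      k    : K a t m
      stub : m ≡ t ⊎ (∀ {r} → m ~ r → K a t r)

  -- If a is not joined to t in G, the last vertex of N_G[a] on a walk inside the F-clique of at
  -- has two non-adjacent G-neighbours in the clique, so claw-freeness keeps its neighbourhood inside.
  leg : ∀ {a t} → a F.~ t → Leg a t
  leg {a} {t} a~t with a ~? t
  ... | yes e = record { a~m = e ; k = inj₂ (F.~-sym a~t) , inj₁ refl ; stub = inj₁ refl }
  ... | no ¬e with exit-nbhd G (conn a~t) (inj₁ refl) (λ { (inj₁ eq) → F.~⇒≢ a~t eq ; (inj₂ e) → ¬e e })
  ...   | p , q , ap , ¬aq , pq , kp , kq = record { a~m = a~p ; k = kp ; stub = inj₂ inside }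
    where
    a~p : a ~ p
    a~p = ≃⇒~ (λ { refl → ¬aq (inj₂ pq) }) ap
    ka : K a t a
    ka = inj₁ refl , inj₂ a~t
    kt : K a t t
    kt = inj₂ (F.~-sym a~t) , inj₁ refl
    via : ∀ {r s} → K a t s → p F.~ s → r F.≃ p → r F.≃ s → K a t r
    via ks ps rp rs = nd ps (rp , rs) (nd a~t ka kp , nd a~t ka ks) , nd ps (rp , rs) (nd a~t kt kp , nd a~t kt ks)
    inside : ∀ {r} → p ~ r → K a t r
    inside pr with nc (~-sym a~p) pq pr
    ... | inj₁ h        = contradiction h ¬aq
    ... | inj₂ (inj₁ h) = via kq (sub pq) (inj₂ (sub (~-sym pr))) (F.≃-sym (≃-sub h))
    ... | inj₂ (inj₂ h) = via ka (sub (~-sym a~p)) (inj₂ (sub (~-sym pr))) (F.≃-sym (≃-sub h))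

  module _ {a₁ a₂ a₃ : V} (e : a₁ F.~ a₂) (f : a₂ F.~ a₃) (g : a₁ F.~ a₃) (ts : Tails a₁ a₂ a₃) where

    open Tails ts

    X : V → Set
    X = K a₁ a₂

    x₁ : X a₁
    x₁ = inj₁ refl , inj₂ e
    x₂ : X a₂
    x₂ = inj₂ (F.~-sym e) , inj₁ refl
    x₃ : X a₃
    x₃ = inj₂ (F.~-sym g) , inj₂ (F.~-sym f)

    X-clique : ∀ {u v} → X u → X v → u F.≃ v
    X-clique = nd e

    X-absorb : ∀ {p q v} → X p → X q → p ≢ q → v F.≃ p → v F.≃ q → X v
    X-absorb xp xq p≢q vp vq = nd pq (vp , vq) (X-clique x₁ xp , X-clique x₁ xq) , nd pq (vp , vq) (X-clique x₂ xp , X-clique x₂ xq)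
      where
      pq = F.≃⇒~ p≢q (X-clique xp xq)

    -- The net vertex c stands in for a: it is a itself, or its pendant neighbour τ is still in the clique X.
    Link : V → V → V → Set
    Link c τ a = c ≡ a ⊎ X τ

    record NetInX : Set where
      field
        {c₁ c₂ c₃ τ₁ τ₂ τ₃} : V
        isNet : NetIn G c₁ c₂ c₃ τ₁ τ₂ τ₃
        Xc₁ : X c₁
        Xc₂ : X c₂
        Xc₃ : X c₃
        l₁  : Link c₁ τ₁ a₁
        l₂  : Link c₂ τ₂ a₂
        l₃  : Link c₃ τ₃ a₃

    private
      L₁ : Leg a₁ t₁
      L₁ = leg e₁
      L₂ : Leg a₂ t₂
      L₂ = leg e₂
      L₃ : Leg a₃ t₃
      L₃ = leg e₃
      open Leg L₁ renaming (m to m₁; a~m to a~m₁; k to k₁; stub to stub₁)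
      open Leg L₂ renaming (m to m₂; a~m to a~m₂; k to k₂; stub to stub₂)
      open Leg L₃ renaming (m to m₃; a~m to a~m₃; k to k₃; stub to stub₃)

      leg-out : ∀ {a t} → a F.~ t → X a → ¬ X t → (L : Leg a t) → ¬ X (Leg.m L)
      leg-out a~t xa ¬xt L xm = ¬xt (X-absorb xa xm (~⇒≢ (Leg.a~m L)) (inj₂ (F.~-sym a~t)) (nd a~t (inj₂ (F.~-sym a~t) , inj₁ refl) (Leg.k L)))

      leg-private : ∀ {a t v} → a F.~ t → X a → ¬ X t → (L : Leg a t) → X v → v ≢ a → ¬ Leg.m L F.≃ v
      leg-private a~t xa ¬xt L xv v≢a h = leg-out a~t xa ¬xt L (X-absorb xv xa v≢a h (proj₁ (Leg.k L)))

      priv₁ : ∀ {v} → X v → v ≢ a₁ → ¬ m₁ F.≃ v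
      priv₁ = leg-private e₁ x₁ o₁ L₁
      priv₂ : ∀ {v} → X v → v ≢ a₂ → ¬ m₂ F.≃ v
      priv₂ = leg-private e₂ x₂ o₂ L₂
      priv₃ : ∀ {v} → X v → v ≢ a₃ → ¬ m₃ F.≃ v
      priv₃ = leg-private e₃ x₃ o₃ L₃

      -- If one leg has its neighbourhood confined to its own clique, an edge between the legs would
      -- make the other leg see the wrong corner; otherwise the legs are `t` and `t′` themselves.
      apart : ∀ {a t a′ t′} (L : Leg a t) (L′ : Leg a′ t′) → ¬ Leg.m L F.≃ a′ → ¬ Leg.m L′ F.≃ a → ¬ t F.~ t′ → ¬ Leg.m L ≃ Leg.m L′
      apart L L′ h h′ ¬tt (inj₁ eq) = h (subst (F._≃ _) (≡-sym eq) (proj₁ (Leg.k L′)))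
      apart L L′ h h′ ¬tt (inj₂ d) with Leg.stub L | Leg.stub L′
      ... | inj₂ s    | _         = h′ (proj₁ (s d))
      ... | inj₁ _    | inj₂ s    = h (proj₁ (s (~-sym d)))
      ... | inj₁ refl | inj₁ refl = ¬tt (sub d)

      m₁₂ : ¬ m₁ ≃ m₂
      m₁₂ = apart L₁ L₂ (priv₁ x₂ (F.~⇒≢ e ∘ ≡-sym)) (priv₂ x₁ (F.~⇒≢ e)) n₁₂
      m₁₃ : ¬ m₁ ≃ m₃
      m₁₃ = apart L₁ L₃ (priv₁ x₃ (F.~⇒≢ g ∘ ≡-sym)) (priv₃ x₁ (F.~⇒≢ g)) n₁₃
      m₂₃ : ¬ m₂ ≃ m₃
      m₂₃ = apart L₂ L₃ (priv₂ x₃ (F.~⇒≢ f ∘ ≡-sym)) (priv₃ x₂ (F.~⇒≢ f)) n₂₃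

      spine : Tight G a₁ a₂ _
      spine = tighten G (proj₁ (proj₂ (reach-path G (conn e))))

      L : List V
      L = Tight.L′ spine
      P : Path a₁ L a₂
      P = Tight.path spine

      L⊆X : ∀ {v} → v ∈ L → X v
      L⊆X v∈ = proj₂ (proj₂ (reach-path G (conn e))) (Tight.sub spine v∈)

      -- An interior vertex of the taut walk has two non-adjacent neighbours in the clique; at `a₃`
      -- they would form a claw with `m₃`.
      a₃∉L : a₃ ∉ L
      a₃∉L i with taut-interior G (Tight.taut spine) i (F.~⇒≢ g ∘ ≡-sym) (F.~⇒≢ f ∘ ≡-sym)
      ... | x , z , x∈ , z∈ , ax , az , ¬xz with nc ax az a~m₃
      ...   | inj₁ h        = ¬xz h
      ...   | inj₂ (inj₁ h) = priv₃ (L⊆X z∈) (~⇒≢ az ∘ ≡-sym) (F.≃-sym (≃-sub h))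
      ...   | inj₂ (inj₂ h) = priv₃ (L⊆X x∈) (~⇒≢ ax ∘ ≡-sym) (F.≃-sym (≃-sub h))

      Close : V → Set
      Close v = v ∈ L ⊎ Σ[ u ∈ V ] (u ∈ L × v ~ u)

      close? : ∀ v → Dec (Close v)
      close? v = (v ∈? L) ⊎-dec anyFin? (λ u → (u ∈? L) ×-dec (v ~? u))

      ¬close-m₃ : ¬ Close m₃
      ¬close-m₃ (inj₁ i) = leg-out e₃ x₃ o₃ L₃ (L⊆X i)
      ¬close-m₃ (inj₂ (u , i , d)) = priv₃ (L⊆X i) (λ { refl → a₃∉L i }) (inj₂ (sub d))

      record Touch : Set where
        field
          {w w⁻} : V
          Xw     : X w
          w~w⁻   : w ~ w⁻
          ¬close : ¬ Close w⁻
          touch-w : Close w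
          link   : (w ≡ a₃ × w⁻ ≡ m₃) ⊎ X w⁻

      -- The walk leads from `a₃` to `a₁` inside the clique until it first comes near the spine; the
      -- preceding vertex then serves as pendant vertex of the third corner.
      touch : ∀ {s s⁻} → Reach G X s a₁ → s ~ s⁻ → ¬ Close s⁻ → (s ≡ a₃ × s⁻ ≡ m₃) ⊎ X s⁻ → Touch
      touch {s} r d ¬c l with close? s
      ... | yes c = record { Xw = reach-source r ; w~w⁻ = d ; ¬close = ¬c ; touch-w = c ; link = l }
      touch (here _) d ¬c l | no ¬c′ = contradiction (inj₁ (start∈ P)) ¬c′
      touch (step o d′ r) d ¬c l | no ¬c′ = touch r (~-sym d′) ¬c′ (inj₂ o)

      module AtTouch {w w⁻ : V} (Xw : X w) (w~w⁻ : w ~ w⁻) (¬close : ¬ Close w⁻) (touch-w : Close w)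
        (link : (w ≡ a₃ × w⁻ ≡ m₃) ⊎ X w⁻) where

        w∉L : w ∉ L
        w∉L i = ¬close (inj₂ (w , i , ~-sym w~w⁻))

        w≄m₁ : ¬ w ≃ m₁
        w≄m₁ h = priv₁ Xw (λ { refl → w∉L (start∈ P) }) (F.≃-sym (≃-sub h))

        w≄m₂ : ¬ w ≃ m₂
        w≄m₂ h = priv₂ Xw (λ { refl → w∉L (end∈ P) }) (F.≃-sym (≃-sub h))

        w⁻≄ : ∀ {v} → v ∈ L → ¬ v ≃ w⁻
        w⁻≄ i (inj₁ refl) = ¬close (inj₁ i)
        w⁻≄ i (inj₂ d)    = ¬close (inj₂ (_ , i , ~-sym d))

        w⁻≄m₁ : ¬ m₁ ≃ w⁻
        w⁻≄m₁ h = [ (λ (_ , eq) → m₁₃ (subst (m₁ ≃_) eq h))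
                  , (λ x → priv₁ x (λ { refl → ¬close (inj₁ (start∈ P)) }) (≃-sub h)) ]′ link

        w⁻≄m₂ : ¬ m₂ ≃ w⁻
        w⁻≄m₂ h = [ (λ (_ , eq) → m₂₃ (subst (m₂ ≃_) eq h))
                  , (λ x → priv₂ x (λ { refl → ¬close (inj₁ (end∈ P)) }) (≃-sub h)) ]′ link

        record Window : Set where
          field
            {x y z t} : V
            xy  : x ~ y
            yz  : y ~ z
            zt  : z ~ t
            wy  : w ~ y
            wz  : w ~ z
            ¬xz : ¬ x ≃ z
            ¬yt : ¬ y ≃ t
            ¬xt : ¬ x ≃ t
            ¬wx : ¬ w ≃ x
            y∈  : y ∈ L
            z∈  : z ∈ L
            x∈  : x ∈ L ⊎ (x ≡ m₁ × y ≡ a₁)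
            t∈  : t ∈ L ⊎ (t ≡ m₂ × z ≡ a₂)

        m₂-far : ∀ {v y} → v ∈ L ⊎ (v ≡ m₁ × y ≡ a₁) → v ≢ a₂ → ¬ v ≃ m₂
        m₂-far (inj₁ i) v≢ h          = priv₂ (L⊆X i) v≢ (F.≃-sym (≃-sub h))
        m₂-far (inj₂ (refl , _)) _ h = m₁₂ h

        -- Let `y` be the first neighbour of `w` along the spine and `x` its predecessor.
        -- Claw-freeness at `y` makes `w` adjacent to the successor of `y` too; at `y ≡ a₂` the same
        -- claw with `m₂` as leaf is a contradiction.
        find : ∀ {x y M} (d : x ~ y) (p : Path y M a₂) → Taut G (d ∷ p) → (∀ {v} → v ∈ M → v ∈ L) →
               x ∈ L ⊎ (x ≡ m₁ × y ≡ a₁) → ¬ w ≃ x → ∀ {u} → u ∈ M → w ~ u → Window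
        find {y = y} d p h i x∈ ¬wx u∈ wu with w ~? y
        find d one h i x∈ ¬wx (here refl) wu | no ¬wy = contradiction wu ¬wy
        find d (d′ ∷ p) h i x∈ ¬wx (here refl) wu | no ¬wy = contradiction wu ¬wy
        find d (d′ ∷ p) h i x∈ ¬wx (there u∈) wu | no ¬wy =
          find d′ p (taut-tail G h) (i ∘ there) (inj₁ (i (here refl))) (¬wy ∘ ≃⇒~ (λ { refl → w∉L (i (here refl)) })) u∈ wu
        find d one h i x∈ ¬wx u∈ wu | yes wy with nc (~-sym d) a~m₂ (~-sym wy)
        ... | inj₁ q        = contradiction q (m₂-far x∈ (~⇒≢ d))
        ... | inj₂ (inj₁ q) = contradiction (≃-sym q) w≄m₂
        ... | inj₂ (inj₂ q) = contradiction (≃-sym q) ¬wx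
        find {x} {y} d (_∷_ {w = z} d′ p) (taut₃ ¬xz far h) i x∈ ¬wx u∈ wu | yes wy with nc (~-sym d) d′ (~-sym wy)
        ... | inj₁ q        = contradiction q ¬xz
        ... | inj₂ (inj₂ q) = contradiction (≃-sym q) ¬wx
        ... | inj₂ (inj₁ q) with p | far | h
        ...   | one | _ | _ = record
                { xy = d ; yz = d′ ; zt = a~m₂ ; wy = wy ; wz = w~z ; ¬xz = ¬xz
                ; ¬yt = m₂-far {y = y} (inj₁ (i (here refl))) (~⇒≢ d′) ; ¬xt = m₂-far x∈ (¬xz ∘ inj₁) ; ¬wx = ¬wx
                ; y∈ = i (here refl) ; z∈ = i (there (here refl)) ; x∈ = x∈ ; t∈ = inj₂ (refl , refl) }
          where
          w~z : w ~ z
          w~z = ~-sym (≃⇒~ (λ { refl → w∉L (i (there (here refl))) }) q)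
        ...   | d″ ∷ p′ | far₂ ¬xt | taut₃ ¬yt _ _ = record
                { xy = d ; yz = d′ ; zt = d″ ; wy = wy ; wz = w~z ; ¬xz = ¬xz ; ¬yt = ¬yt ; ¬xt = ¬xt ; ¬wx = ¬wx
                ; y∈ = i (here refl) ; z∈ = i (there (here refl)) ; x∈ = x∈ ; t∈ = inj₁ (i (there (there (start∈ p′)))) }
          where
          w~z : w ~ z
          w~z = ~-sym (≃⇒~ (λ { refl → w∉L (i (there (here refl))) }) q)

        -- The spine is prolonged by `m₁`, which sees nothing of the clique but `a₁`, so a window
        -- may begin at the very first corner.
        taut-m₁ : ∀ {M} (p : Path a₁ M a₂) → Taut G p → (∀ {v} → v ∈ M → X v) → Taut G (~-sym a~m₁ ∷ p)
        taut-m₁ one h i = taut₂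
        taut-m₁ (d ∷ one) h i = taut₃ (priv₁ (i (there (here refl))) (~⇒≢ d ∘ ≡-sym) ∘ ≃-sub) far₁ h
        taut-m₁ (d ∷ (d′ ∷ p)) h@(taut₃ ¬xz _ _) i =
          taut₃ (priv₁ (i (there (here refl))) (~⇒≢ d ∘ ≡-sym) ∘ ≃-sub)
                (far₂ (priv₁ (i (there (there (start∈ p)))) (λ { refl → ¬xz (inj₁ refl) }) ∘ ≃-sub)) h

        touched : Σ[ u ∈ V ] (u ∈ L × w ~ u)
        touched = [ (λ i → contradiction i w∉L) , (λ u → u) ]′ touch-w

        window : Window
        window = find (~-sym a~m₁) P (taut-m₁ P (Tight.taut spine) L⊆X) (λ i → i) (inj₂ (refl , refl)) w≄m₁
                   (proj₁ (proj₂ touched)) (proj₂ (proj₂ touched))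

        netAt : NetInX
        netAt = record
          { isNet = record
            { c₁₂ = yz ; c₂₃ = ~-sym wz ; c₁₃ = ~-sym wy ; d₁ = ~-sym xy ; d₂ = zt ; d₃ = w~w⁻
            ; n₁₂ = ¬yt ; n₁₃ = w⁻≄ y∈ ; n₂₁ = ¬xz ∘ ≃-sym ; n₂₃ = w⁻≄ z∈ ; n₃₁ = ¬wx ; n₃₂ = ¬wt
            ; t₁₂ = ¬xt ; t₁₃ = ¬xw⁻ x∈ ; t₂₃ = ¬tw⁻ t∈ }
          ; Xc₁ = L⊆X y∈ ; Xc₂ = L⊆X z∈ ; Xc₃ = Xw
          ; l₁ = [ inj₂ ∘ L⊆X , inj₁ ∘ proj₂ ]′ x∈ ; l₂ = [ inj₂ ∘ L⊆X , inj₁ ∘ proj₂ ]′ t∈ ; l₃ = [ inj₁ ∘ proj₁ , inj₂ ]′ link }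
          where
          open Window window
          ¬xw⁻ : ∀ {x y} → x ∈ L ⊎ (x ≡ m₁ × y ≡ a₁) → ¬ x ≃ w⁻
          ¬xw⁻ (inj₁ i)          = w⁻≄ i
          ¬xw⁻ (inj₂ (refl , _)) = w⁻≄m₁
          ¬tw⁻ : ∀ {t z} → t ∈ L ⊎ (t ≡ m₂ × z ≡ a₂) → ¬ t ≃ w⁻
          ¬tw⁻ (inj₁ i)          = w⁻≄ i
          ¬tw⁻ (inj₂ (refl , _)) = w⁻≄m₂
          w≢t : ∀ {t z} → t ∈ L ⊎ (t ≡ m₂ × z ≡ a₂) → w ≢ t
          w≢t (inj₁ i) refl          = w∉L i
          w≢t (inj₂ (refl , _)) refl = w≄m₂ (inj₁ refl)
          ¬wt : ¬ w ≃ t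
          ¬wt (inj₁ eq) = w≢t t∈ eq
          -- The last non-edge comes from a claw at `w` with leaves `y`, `t` and `w⁻`.
          ¬wt (inj₂ d) with nc wy d w~w⁻
          ... | inj₁ q        = ¬yt q
          ... | inj₂ (inj₁ q) = ¬tw⁻ t∈ q
          ... | inj₂ (inj₂ q) = w⁻≄ y∈ q

    netInX : NetInX
    netInX = AtTouch.netAt (Touch.Xw T) (Touch.w~w⁻ T) (Touch.¬close T) (Touch.touch-w T) (Touch.link T)
      where
      T : Touch
      T = touch (reach-map (λ h → h) (λ (h , h′) → nd g (h , h′) (inj₁ refl , inj₂ g) , nd g (h , h′) (inj₂ (F.~-sym e) , inj₂ f))
            (reach-sym (conn g))) a~m₃ ¬close-m₃ (inj₁ (refl , refl))

    -- A net vertex other than aᵢ has its whole G-neighbourhood in X.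
    link-degree : ∀ {c τ a o} → X a → X c → X o → c ~ τ → c ~ o → ¬ o ≃ τ → Link c τ a → deg G c ≤ deg F a
    link-degree xa xc xo cτ co ¬oτ (inj₁ refl) = degree-mono {G = G} {F} sub _
    link-degree {c} {τ} xa xc xo cτ co ¬oτ (inj₂ xτ) = degree-clique {G = G} {F} sub (X-clique xa xc) (λ cw → X-clique xa (inside cw))
      where
      inside : ∀ {w} → c ~ w → X w
      inside cw with nc co cτ cw
      ... | inj₁ q        = contradiction q ¬oτ
      ... | inj₂ (inj₁ q) = X-absorb xc xτ (~⇒≢ cτ) (inj₂ (sub (~-sym cw))) (F.≃-sym (≃-sub q))
      ... | inj₂ (inj₂ q) = X-absorb xc xo (~⇒≢ co) (inj₂ (sub (~-sym cw))) (F.≃-sym (≃-sub q))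

-- The net condition for the triangles of `F`

module _ {n : ℕ} {G : Graph n} where

  net-213 : ∀ {c₁ c₂ c₃ τ₁ τ₂ τ₃} → NetIn G c₁ c₂ c₃ τ₁ τ₂ τ₃ → NetIn G c₂ c₁ c₃ τ₂ τ₁ τ₃
  net-213 N = record
    { c₁₂ = ~-sym c₁₂ ; c₂₃ = c₁₃ ; c₁₃ = c₂₃ ; d₁ = d₂ ; d₂ = d₁ ; d₃ = d₃
    ; n₁₂ = n₂₁ ; n₁₃ = n₂₃ ; n₂₁ = n₁₂ ; n₂₃ = n₁₃ ; n₃₁ = n₃₂ ; n₃₂ = n₃₁
    ; t₁₂ = t₁₂ ∘ ≃-sym ; t₁₃ = t₂₃ ; t₂₃ = t₁₃ }
    where
    open Basics G
    open NetIn N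

  net-312 : ∀ {c₁ c₂ c₃ τ₁ τ₂ τ₃} → NetIn G c₁ c₂ c₃ τ₁ τ₂ τ₃ → NetIn G c₃ c₁ c₂ τ₃ τ₁ τ₂
  net-312 N = record
    { c₁₂ = ~-sym c₁₃ ; c₂₃ = c₁₂ ; c₁₃ = ~-sym c₂₃ ; d₁ = d₃ ; d₂ = d₁ ; d₃ = d₂
    ; n₁₂ = n₃₁ ; n₁₃ = n₃₂ ; n₂₁ = n₁₃ ; n₂₃ = n₁₂ ; n₃₁ = n₂₃ ; n₃₂ = n₂₁
    ; t₁₂ = t₁₃ ∘ ≃-sym ; t₁₃ = t₂₃ ∘ ≃-sym ; t₂₃ = t₁₂ }
    where
    open Basics G
    open NetIn N

module Nets {n : ℕ} {G F : Graph n} (nc : Basics.NoClaw G) (npq : NpqHeavy G) (cl : Closure G F) (nd : Visits.NoDiamond F) where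

  open Basics G
  open Visits F using (K)
  open NetCentres F
  private module F = Basics F

  sub : G ⊆ᴱ F
  sub = closure-⊆ cl

  open Extraction {G = G} {F} nc sub nd (clique-connected {G = G} {F} nc nd cl (λ e → e))

  heavy-mono : ∀ {v} → Heavy G v → Heavy F v
  heavy-mono {v} h = ≤-trans h (*-monoʳ-≤ 2 (degree-mono {G = G} {F} sub v))

  -- In F the q-heavy net still has its two pendant paths, so its triangle is a whole maximal clique.
  qtype-from : ∀ {X : V → Set} → (∀ {u v} → X u → X v → u F.≃ v) →
    ∀ {c₁ c₂ c₃ τ₁ τ₂ τ₃ a₁ a₂ a₃} → NetIn G c₁ c₂ c₃ τ₁ τ₂ τ₃ → X c₁ → X c₂ → X c₃ →
    c₁ ≡ a₁ ⊎ X τ₁ → c₂ ≡ a₂ ⊎ X τ₂ → c₃ ≡ a₃ ⊎ X τ₃ → Heavy G c₁ →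
    deg G c₂ ≡ 3 → deg G τ₂ ≡ 2 → deg G c₃ ≡ 3 → deg G τ₃ ≡ 2 →
    (∀ w → τ₂ ~ w → w ≢ c₂ → Heavy G w) → (∀ w → τ₃ ~ w → w ≢ c₃ → Heavy G w) → QType a₁ a₂ a₃
  qtype-from {X} clique {c₁} {c₂} {c₃} {τ₁} {τ₂} {τ₃} N x₁ x₂ x₃ l₁ l₂ l₃ h₁ dc₂ dτ₂ dc₃ dτ₃ h₂ h₃
    with degree-two G dτ₂ (~-sym (NetIn.d₂ N)) | degree-two G dτ₃ (~-sym (NetIn.d₃ N))
  ... | σ , τσ , σ≢ , onlyτ | σ′ , τσ′ , σ′≢ , onlyτ′ = by l₁ l₂ l₃
    where
    open NetIn N
    c₁≢σ : c₁ ≢ σ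
    c₁≢σ refl = n₁₂ (inj₂ (~-sym τσ))
    c₃≢σ : c₃ ≢ σ
    c₃≢σ refl = n₃₂ (inj₂ (~-sym τσ))
    PF : Pendant c₁ c₂ c₃ τ₂ σ F × Pendant c₁ c₃ c₂ τ₃ σ′ F
    PF = pendant-closure (~⇒≢ c₁₂) (~⇒≢ c₁₃) (~⇒≢ c₂₃) c₁≢σ (λ { refl → n₁₃ (inj₂ (~-sym τσ′)) }) (λ { refl → n₂₃ (inj₂ (~-sym τσ′)) }) c₃≢σ nc cl
      ( record { N-b = degree-three G dc₂ (~-sym c₁₂) c₂₃ d₂ (~⇒≢ c₁₃) (n₁₂ ∘ inj₁) (n₃₂ ∘ inj₁) ; N-τ = onlyτ }
      , record { N-b = degree-three G dc₃ (~-sym c₁₃) (~-sym c₂₃) d₃ (~⇒≢ c₁₂) (n₁₃ ∘ inj₁) (n₂₃ ∘ inj₁) ; N-τ = onlyτ′ } )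
    module P = Pendant (proj₁ PF)
    module P′ = Pendant (proj₂ PF)
    -- A pendant vertex in the clique would see a further corner in `F`, against `Pendant`. This
    -- forces each corner of the net to be the corner of the triangle that it stands for.
    ¬Xτ₂ : ¬ X τ₂
    ¬Xτ₂ x with P.N-τ (F.≃⇒~ (n₁₂ ∘ inj₁ ∘ ≡-sym) (clique x x₁))
    ... | inj₁ eq = ~⇒≢ c₁₂ eq
    ... | inj₂ eq = c₁≢σ eq
    ¬Xτ₃ : ¬ X τ₃
    ¬Xτ₃ x with P′.N-τ (F.≃⇒~ (n₁₃ ∘ inj₁ ∘ ≡-sym) (clique x x₁))
    ... | inj₁ eq = ~⇒≢ c₁₃ eq
    ... | inj₂ eq = n₁₃ (inj₂ (~-sym (subst (τ₃ ~_) (≡-sym eq) τσ′)))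
    ¬Xτ₁ : ¬ X τ₁
    ¬Xτ₁ x with P.N-b (F.≃⇒~ (n₂₁ ∘ inj₁) (clique x₂ x))
    ... | inj₁ eq        = ~⇒≢ d₁ (≡-sym eq)
    ... | inj₂ (inj₁ eq) = n₃₁ (inj₁ (≡-sym eq))
    ... | inj₂ (inj₂ eq) = t₁₂ (inj₁ eq)
    by : ∀ {a₁ a₂ a₃} → c₁ ≡ a₁ ⊎ X τ₁ → c₂ ≡ a₂ ⊎ X τ₂ → c₃ ≡ a₃ ⊎ X τ₃ → QType a₁ a₂ a₃
    by (inj₂ x) _ _ = contradiction x ¬Xτ₁
    by _ (inj₂ x) _ = contradiction x ¬Xτ₂
    by _ _ (inj₂ x) = contradiction x ¬Xτ₃
    by (inj₁ refl) (inj₁ refl) (inj₁ refl) = record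
      { heavy-a = heavy-mono h₁ ; heavy-σ = heavy-mono (h₂ σ τσ σ≢) ; heavy-σ′ = heavy-mono (h₃ σ′ τσ′ σ′≢)
      ; N-b = P.N-b ; N-c = P′.N-b ; N-τ = P.N-τ ; N-τ′ = P′.N-τ }

  -- A p-heavy pair transfers through the three degree bounds; a q-heavy net is the net at the
  -- triangle itself.
  nets : ∀ {a₁ a₂ a₃} → Triangle a₁ a₂ a₃ → Tails a₁ a₂ a₃ → NetAlternative a₁ a₂ a₃
  nets {a₁} {a₂} {a₃} (e , f , g) ts = by (npq (NetIn.net isNet))
    where
    open NetInX (netInX e f g ts)
    open NetIn isNet
    b₁ : deg G c₁ ≤ deg F a₁
    b₁ = link-degree e f g ts (x₁ e f g ts) Xc₁ Xc₂ d₁ c₁₂ n₂₁ l₁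
    b₂ : deg G c₂ ≤ deg F a₂
    b₂ = link-degree e f g ts (x₂ e f g ts) Xc₂ Xc₁ d₂ (~-sym c₁₂) n₁₂ l₂
    b₃ : deg G c₃ ≤ deg F a₃
    b₃ = link-degree e f g ts (x₃ e f g ts) Xc₃ Xc₁ d₃ (~-sym c₁₃) n₁₃ l₃
    clique : ∀ {u v} → K a₁ a₂ u → K a₁ a₂ v → u F.≃ v
    clique = nd e
    ore : ∀ {x y c d} → deg G c ≤ deg F x → deg G d ≤ deg F y → n ≤ deg G c + deg G d → Ore x y
    ore b b′ h = ≤-trans h (+-mono-≤ b b′)
    flop : ∀ x y → n ≤ deg G x + deg G y → n ≤ deg G y + deg G x
    flop x y h = ≤-trans h (≤-reflexive (+-comm (deg G x) (deg G y)))
    by : PHeavy G (NetIn.net isNet) ⊎ QHeavy G (NetIn.net isNet) → NetAlternative a₁ a₂ a₃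
    by (inj₁ (0F , 0F , ne , _)) = contradiction refl ne
    by (inj₁ (0F , 1F , _ , _ , h)) = inj₁ (inj₁ (ore b₁ b₂ h))
    by (inj₁ (0F , 2F , _ , _ , h)) = inj₁ (inj₂ (inj₁ (ore b₁ b₃ h)))
    by (inj₁ (1F , 0F , _ , _ , h)) = inj₁ (inj₁ (ore b₁ b₂ (flop c₂ c₁ h)))
    by (inj₁ (1F , 1F , ne , _)) = contradiction refl ne
    by (inj₁ (1F , 2F , _ , _ , h)) = inj₁ (inj₂ (inj₂ (ore b₂ b₃ h)))
    by (inj₁ (2F , 0F , _ , _ , h)) = inj₁ (inj₂ (inj₁ (ore b₁ b₃ (flop c₃ c₁ h))))
    by (inj₁ (2F , 1F , _ , _ , h)) = inj₁ (inj₂ (inj₂ (ore b₂ b₃ (flop c₃ c₂ h))))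
    by (inj₁ (2F , 2F , ne , _)) = contradiction refl ne
    by (inj₂ (0F , h , _ , ds , hs)) = inj₂ (inj₁ (qtype-from clique isNet Xc₁ Xc₂ Xc₃ l₁ l₂ l₃ h
      (proj₁ (ds 1F λ ())) (proj₂ (ds 1F λ ())) (proj₁ (ds 2F λ ())) (proj₂ (ds 2F λ ()))
      (hs 1F λ ()) (hs 2F λ ())))
    by (inj₂ (1F , h , _ , ds , hs)) = inj₂ (inj₂ (inj₁ (qtype-from clique (net-213 isNet) Xc₂ Xc₁ Xc₃ l₂ l₁ l₃ h
      (proj₁ (ds 0F λ ())) (proj₂ (ds 0F λ ())) (proj₁ (ds 2F λ ())) (proj₂ (ds 2F λ ()))
      (hs 0F λ ()) (hs 2F λ ()))))
    by (inj₂ (2F , h , _ , ds , hs)) = inj₂ (inj₂ (inj₂ (qtype-from clique (net-312 isNet) Xc₃ Xc₁ Xc₂ l₃ l₁ l₂ h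
      (proj₁ (ds 0F λ ())) (proj₂ (ds 0F λ ())) (proj₁ (ds 1F λ ())) (proj₂ (ds 1F λ ()))
      (hs 0F λ ()) (hs 1F λ ()))))

theorem16 : ∀ {n : ℕ} (G : Graph n) → TwoConnected G → ClawFree G → NpqHeavy G → Hamiltonian G
-- Matching on two successors exhibits the two distinct vertices from which the first cycle is
-- grown.
theorem16 {suc (suc n)} G (3≤n , conn , conn₂) cf npq with close G
... | F , cl , nd = hamCycle⇒hamiltonian G 3≤n (closure-ham cl nc
        (Thetas.hamCycle F (closure-noClaw cl nc) nd (Nets.nets nc npq cl nd)
          (λ u v → lift-reach (conn u v)) (λ x u v u≢x v≢x → lift-reach (conn₂ x u v u≢x v≢x)) {zero} {suc zero} (λ ())))
  where
  nc : Basics.NoClaw G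
  nc = Basics.clawFree⇒noClaw G cf
  lift-reach : ∀ {ok u v} → Reach G ok u v → Reach F ok u v
  lift-reach = reach-map (closure-⊆ cl) (λ o → o)
theorem16 {suc zero} G (s≤s () , _)
theorem16 {zero} G (() , _)
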